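{- Let $n\ge1$. The restriction of $\Omega$ to the Edelman-Greene BPDs of size $n$ defines a bijection onto $\mathsf{RWT}(n-1)$. This bijection is shape preserving, and for each $w\in S_n$ it takes Edelman-Greene BPDs for $w$ (those lying in $\mathsf{Pipes}(w)$) to reduced word tableaux for $w$ (those whose column reading word is a reduced word for $w$).
   Context: Bumpless pipe dreams. Cells $(i,j)$ of the $n\times n$ grid: row $i$ from the top, column $j$ from the left. There are six tiles: downward elbow (a pipe joining the bottom and right edges), upward elbow (a pipe joining the left and top edges), crossing (one pipe joining left and right edges and one joining bottom and top edges), blank (no pipe), horizontal (left to right), vertical (bottom to top). A bumpless pipe dream (BPD) of size $n$ is a tiling of the grid by these tiles such that an edge shared by two cells is met by a pipe from both sides or from neither, every bottom and right boundary edge is met by a pipe, and no left or top boundary edge is met by a pipe. So there are $n$ pipes, running from the bottom boundary to the right boundary. A BPD is reduced if every pair of pipes crosses at most once. $D(\mathcal P)$ is the set of positions of blank tiles. Demazure product $\partial(\mathcal P)\in S_n$: label the bottom boundary edges $1,\dots,n$ from left to right and propagate labels along pipes north and east; at a crossing tile, of the two labels entering from the left and from below, the smaller leaves through the right edge and the larger through the top edge. $\partial(\mathcal P)(i)$ is the label arriving at the right boundary edge of row $i$. $\mathsf{Pipes}(w)=\{\mathcal P:\partial(\mathcal P)=w\}$. For a partition $\lambda$, $\mathbb Y(\lambda)=\{(i,j):1\le j\le\lambda_i\}$. A BPD $\mathcal P$ is Hecke, of shape $\lambda$, if $D(\mathcal P)=\mathbb Y(\lambda)$ for some partition $\lambda$.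 An Edelman-Greene BPD is a Hecke BPD that is reduced. A decreasing tableau of shape $\lambda$ is a function $\mathbb Y(\lambda)\to\{1,2,\dots\}$ whose values strictly decrease along rows (left to right) and down columns. The column reading word reads entries along columns from bottom to top, columns taken from left to right. A word $(a_1,\dots,a_k)$ is a reduced word for $w$ if $w=s_{a_1}\cdots s_{a_k}$ with $s_i=(i\ i+1)$ and $k=\ell(w)$. $\mathsf{RWT}(n-1)$ is the set of reduced word tableaux: decreasing tableaux with entries in $\{1,\dots,n-1\}$ whose column reading word is reduced (a reduced word of the permutation it represents). The map $\Omega$: in each diagonal $\{(i,j):j-i=c\}$ of a BPD there are as many blank tiles as crossing tiles. Ordering each diagonal from northwest to southeast, pair the first blank tile with the last crossing tile, the second blank tile with the second-to-last crossing tile, and so on. For a Hecke BPD $\mathcal P$, $\Omega(\mathcal P)$ is the filling of $D(\mathcal P)$ in which a blank cell in row $i$ whose paired crossing tile is in row $i'$ receives the value $i'-i$. -}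

module Defs where

open import Algebra.Construct.NaturalChoice.Max using () renaming (_⊔_ to maxOf)
open import Algebra.Construct.NaturalChoice.Min using () renaming (_⊓_ to minOf)
open import Data.Bool using (Bool; true; false)
open import Data.Fin using (Fin; zero; suc; toℕ; inject₁)
open import Data.Fin.Permutation using (Permutation′; transpose; _∘ₚ_; _⟨$⟩ʳ_; _≈_)
  renaming (id to idₚ)
open import Data.Fin.Properties using (≤-totalOrder) renaming (_≟_ to _≟ᶠ_; _<?_ to _<?ᶠ_)
open import Data.Integer using (ℤ; +_; _⊖_) renaming (_≟_ to _≟ᶻ_)
open import Data.List using
  (List; []; _∷_; length; map; filter; find; zip; reverse; mapMaybe; concatMap
  ; upTo; downFrom; allFin; cartesianProduct)
open import Data.List.Relation.Unary.All using (All)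
open import Data.List.Relation.Unary.Linked using (Linked)
open import Data.Maybe using (Maybe; just; nothing) renaming (map to mapᴹ; zipWith to zipWithᴹ)
open import Data.Nat using (ℕ; zero; suc; _<_; _≤_; _≥_; _<?_)
open import Data.Product using (Σ; ∃; ∃-syntax; Σ-syntax; _×_; _,_; proj₁; proj₂; curry)
open import Data.Product.Properties using (≡-dec)
open import Data.Sum using (_⊎_)
open import Function using (_∘_)
open import Level using (0ℓ)
open import Relation.Binary.Bundles using (Setoid)
open import Relation.Binary.Definitions using (DecidableEquality)
open import Relation.Binary.PropositionalEquality
  using (_≡_; refl; sym; trans; subst; cong; _→-setoid_)
import Relation.Binary.Construct.On as On
open import Relation.Nullary using (Dec; yes; no)
open import Relation.Nullary.Decidable using (_×-dec_)
open import Relation.Unary using (Pred; _≐_)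

-- Rows, columns, pipe labels and the points permuted by S_n are all elements
-- of Fin n (or of ℕ), counted from 0: k stands for the usual k + 1.
-- The entries of tableaux and the values of Ω are not shifted.

----------------------------------------------------------------------
-- Bumpless pipe dreams

data Tile : Set where
  downElbow : Tile   -- bottom and right
  upElbow   : Tile   -- left and top
  cross     : Tile
  blank     : Tile
  horiz     : Tile
  vert      : Tile

onLeft onRight onTop onBottom : Tile → Bool
onLeft downElbow = false
onLeft upElbow   = true
onLeft cross     = true
onLeft blank     = false
onLeft horiz     = true
onLeft vert      = false

onRight downElbow = true
onRight upElbow   = false
onRight cross     = true
onRight blank     = false
onRight horiz     = true
onRight vert      = false

onTop downElbow = false
onTop upElbow   = true
onTop cross     = true
onTop blank     = false
onTop horiz     = false
onTop vert      = true

onBottom downElbow = true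
onBottom upElbow   = false
onBottom cross     = true
onBottom blank     = false
onBottom horiz     = false
onBottom vert      = true

isBlank? : (t : Tile) → Dec (t ≡ blank)
isBlank? downElbow = no λ ()
isBlank? upElbow   = no λ ()
isBlank? cross     = no λ ()
isBlank? blank     = yes refl
isBlank? horiz     = no λ ()
isBlank? vert      = no λ ()

isCross? : (t : Tile) → Dec (t ≡ cross)
isCross? downElbow = no λ ()
isCross? upElbow   = no λ ()
isCross? cross     = yes refl
isCross? blank     = no λ ()
isCross? horiz     = no λ ()
isCross? vert      = no λ ()

Cell : ℕ → Set
Cell n = Fin n × Fin n

_≟ᶜ_ : ∀ {n} → DecidableEquality (Cell n)
_≟ᶜ_ = ≡-dec _≟ᶠ_ _≟ᶠ_

record BPD (n : ℕ) : Set where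
  field
    tile : Cell n → Tile
    matchH : ∀ i j k → toℕ k ≡ suc (toℕ j) →
             onRight (tile (i , j)) ≡ onLeft (tile (i , k))
    matchV : ∀ i k j → toℕ k ≡ suc (toℕ i) →
             onBottom (tile (i , j)) ≡ onTop (tile (k , j))
    leftBoundary   : ∀ i j → toℕ j ≡ 0 → onLeft (tile (i , j)) ≡ false
    topBoundary    : ∀ i j → toℕ i ≡ 0 → onTop (tile (i , j)) ≡ false
    rightBoundary  : ∀ i j → suc (toℕ j) ≡ n → onRight (tile (i , j)) ≡ true
    bottomBoundary : ∀ i j → suc (toℕ i) ≡ n → onBottom (tile (i , j)) ≡ true

open BPD public

-- D P lives in ℕ × ℕ so that it can be compared with the diagram of an
-- arbitrary partition.
D : ∀ {n} → BPD n → Pred (ℕ × ℕ) 0ℓ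
D {n} P (i , j) = ∃[ r ] ∃[ c ] toℕ r ≡ i × toℕ c ≡ j × tile P (r , c) ≡ blank

----------------------------------------------------------------------
-- Propagating labels along pipes

-- What happens at a crossing: (label from left , label from below) is sent to
-- (label leaving right , label leaving through the top).
Rule : ℕ → Set
Rule n = Fin n → Fin n → Fin n × Fin n

-- Labels follow the actual pipes.
straight : ∀ {n} → Rule n
straight a b = a , b

demazure : ∀ {n} → Rule n
demazure {n} a b = minOf (≤-totalOrder n) a b , maxOf (≤-totalOrder n) a b

-- Labels on the right and top edges of a tile, from those on its left and
-- bottom edges; `nothing` marks an edge without a pipe.
rightOut topOut : ∀ {n} → Rule n → Tile → (left bottom : Maybe (Fin n)) → Maybe (Fin n)
rightOut ρ downElbow l b = b
rightOut ρ upElbow   l b = nothing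
rightOut ρ cross     l b = zipWithᴹ (λ x y → proj₁ (ρ x y)) l b
rightOut ρ blank     l b = nothing
rightOut ρ horiz     l b = l
rightOut ρ vert      l b = nothing

topOut ρ downElbow l b = nothing
topOut ρ upElbow   l b = l
topOut ρ cross     l b = zipWithᴹ (λ x y → proj₂ (ρ x y)) l b
topOut ρ blank     l b = nothing
topOut ρ horiz     l b = nothing
topOut ρ vert      l b = b

-- In a row of tiles ts with labels bs on the bottom edges and l on the leftmost
-- edge: the labels on the left edges of the tiles, and on the rightmost edge.
rowLefts : ∀ {n m} → Rule n → (ts : Fin m → Tile) (bs : Fin m → Maybe (Fin n)) →
           (l : Maybe (Fin n)) → Fin m → Maybe (Fin n)
rowLefts ρ ts bs l zero    = l
rowLefts ρ ts bs l (suc j) =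
  rowLefts ρ (ts ∘ suc) (bs ∘ suc) (rightOut ρ (ts zero) l (bs zero)) j

rowExit : ∀ {n m} → Rule n → (ts : Fin m → Tile) (bs : Fin m → Maybe (Fin n)) →
          (l : Maybe (Fin n)) → Maybe (Fin n)
rowExit {m = zero}  ρ ts bs l = l
rowExit {m = suc m} ρ ts bs l =
  rowExit ρ (ts ∘ suc) (bs ∘ suc) (rightOut ρ (ts zero) l (bs zero))

-- The labels on the top edge of a stack of m rows, the lowest of which is the
-- bottom row of the grid.
stackTops : ∀ {n m} → Rule n → (Fin m → Fin n → Tile) → Fin n → Maybe (Fin n)
stackTops {m = zero}  ρ t j = just j
stackTops {m = suc m} ρ t j =
  topOut ρ (t zero j) (rowLefts ρ (t zero) below nothing j) (below j)
  where below = stackTops ρ (t ∘ suc)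

stackBottoms : ∀ {n m} → Rule n → (Fin m → Fin n → Tile) →
               Fin m → Fin n → Maybe (Fin n)
stackBottoms ρ t zero    = stackTops ρ (t ∘ suc)
stackBottoms ρ t (suc i) = stackBottoms ρ (t ∘ suc) i

fromBelow fromLeft : ∀ {n} → Rule n → BPD n → Cell n → Maybe (Fin n)
fromBelow ρ P (i , j) = stackBottoms ρ (curry (tile P)) i j
fromLeft  ρ P (i , j) =
  rowLefts ρ (curry (tile P) i) (stackBottoms ρ (curry (tile P)) i) nothing j

rowLabel : ∀ {n} → Rule n → BPD n → Fin n → Maybe (Fin n)
rowLabel ρ P i =
  rowExit ρ (curry (tile P) i) (stackBottoms ρ (curry (tile P)) i) nothing

∂ : ∀ {n} → BPD n → Fin n → Maybe (Fin n)
∂ = rowLabel demazure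

Pipes : ∀ {n} → Permutation′ n → Pred (BPD n) 0ℓ
Pipes w P = ∀ i → ∂ P i ≡ just (w ⟨$⟩ʳ i)

-- A pipe is named by the column in which it starts.
CrossAt : ∀ {n} → BPD n → (p q : Fin n) → Cell n → Set
CrossAt P p q c =
  tile P c ≡ cross ×
  ((fromLeft straight P c ≡ just p × fromBelow straight P c ≡ just q) ⊎
   (fromLeft straight P c ≡ just q × fromBelow straight P c ≡ just p))

Reduced : ∀ {n} → BPD n → Set
Reduced P = ∀ p q c c′ → CrossAt P p q c → CrossAt P p q c′ → c ≡ c′

----------------------------------------------------------------------
-- Partitions and Edelman-Greene BPDs

part : List ℕ → ℕ → ℕ
part []       i       = 0
part (x ∷ xs) zero    = x
part (x ∷ xs) (suc i) = part xs i

record Partition : Set where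
  field
    parts      : List ℕ
    decreasing : Linked _≥_ parts
    positive   : All (0 <_) parts

open Partition public using (parts)

𝕐 : Partition → Pred (ℕ × ℕ) 0ℓ
𝕐 μ (i , j) = j < part (parts μ) i

Hecke : ∀ {n} → BPD n → Set
Hecke P = ∃[ μ ] D P ≐ 𝕐 μ

EdelmanGreene : ∀ {n} → BPD n → Set
EdelmanGreene P = Hecke P × Reduced P

EG : ℕ → Set
EG n = Σ (BPD n) EdelmanGreene

shapeEG : ∀ {n} → EG n → Partition
shapeEG (_ , (μ , _) , _) = μ

BPD-setoid : ℕ → Setoid 0ℓ 0ℓ
BPD-setoid n = On.setoid (Cell n →-setoid Tile) tile

EG-setoid : ℕ → Setoid 0ℓ 0ℓ
EG-setoid n = On.setoid (BPD-setoid n) (proj₁ {B = EdelmanGreene {n}})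

----------------------------------------------------------------------
-- Words and permutations

-- The letter a : Fin m stands for a + 1 ∈ {1, …, m}.
s : ∀ {m} → Fin m → Permutation′ (suc m)
s a = transpose (inject₁ a) (suc a)

-- s_{a₁} ⋯ s_{aₖ} as a composite of functions, the rightmost factor acting
-- first (the library's _∘ₚ_ composes the other way round).
wordProduct : ∀ {m} → List (Fin m) → Permutation′ (suc m)
wordProduct []       = idₚ
wordProduct (a ∷ as) = wordProduct as ∘ₚ s a

ℓ : ∀ {n} → Permutation′ n → ℕ
ℓ {n} w = length (filter inversion? (cartesianProduct (allFin n) (allFin n)))
  where
  inversion? = λ ((i , j) : Fin n × Fin n) → (i <?ᶠ j) ×-dec ((w ⟨$⟩ʳ j) <?ᶠ (w ⟨$⟩ʳ i))

ReducedWordFor : ∀ {m} → List ℕ → Permutation′ (suc m) → Set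
ReducedWordFor {m} word w =
  Σ[ as ∈ List (Fin m) ]
    (word ≡ map (suc ∘ toℕ) as) × (wordProduct as ≈ w) × (length as ≡ ℓ w)

----------------------------------------------------------------------
-- Tableaux

record DecreasingTableau : Set where
  field
    shape : Partition
    entry : ∀ i j → .(𝕐 shape (i , j)) → ℕ
    entry-positive : ∀ i j .(p : 𝕐 shape (i , j)) → 0 < entry i j p
    rows-decrease : ∀ i j k .(p : 𝕐 shape (i , j)) .(q : 𝕐 shape (i , k)) →
                    j < k → entry i k q < entry i j p
    columns-decrease : ∀ i k j .(p : 𝕐 shape (i , j)) .(q : 𝕐 shape (k , j)) →
                       i < k → entry k j q < entry i j p

  entry? : ℕ → ℕ → Maybe ℕ
  entry? i j with j <? part (parts shape) i
  ... | yes p = just (entry i j p)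
  ... | no  _ = nothing

  columnWord : List ℕ
  columnWord =
    concatMap (λ j → mapMaybe (λ i → entry? i j) (downFrom (length (parts shape))))
              (upTo (part (parts shape) 0))

open DecreasingTableau public using (shape; entry; columnWord)

record _≈ᵗ_ (T U : DecreasingTableau) : Set where
  field
    same-shape   : parts (shape T) ≡ parts (shape U)
    same-entries : ∀ i j .(p : 𝕐 (shape T) (i , j)) .(q : 𝕐 (shape U) (i , j)) →
                   entry T i j p ≡ entry U i j q

Tableau-setoid : Setoid 0ℓ 0ℓ
Tableau-setoid = record
  { Carrier = DecreasingTableau
  ; _≈_ = _≈ᵗ_
  ; isEquivalence = record
    { refl  = record { same-shape = refl ; same-entries = λ _ _ _ _ → refl }
    ; sym   = λ e → record
      { same-shape   = sym (same-shape e)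
      ; same-entries = λ i j p q → sym (same-entries e i j q p) }
    ; trans = λ e f → record
      { same-shape   = trans (same-shape e) (same-shape f)
      ; same-entries = λ i j p q →
          trans (same-entries e i j p (subst (λ μ → j < part μ i) (same-shape e) p))
                (same-entries f i j (subst (λ μ → j < part μ i) (same-shape e) p) q) }
    }
  }
  where open _≈ᵗ_

-- Entries in {1, …, m}; words in the letters 1, …, m represent elements of S_{m+1}.
record IsRWT (m : ℕ) (T : DecreasingTableau) : Set where
  field
    bounded : ∀ i j .(p : 𝕐 (shape T) (i , j)) → entry T i j p ≤ m
    reduced : Σ[ w ∈ Permutation′ (suc m) ] ReducedWordFor (columnWord T) w

RWT : ℕ → Set
RWT m = Σ DecreasingTableau (IsRWT m)

RWT-setoid : ℕ → Setoid 0ℓ 0ℓ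
RWT-setoid m = On.setoid Tableau-setoid (proj₁ {B = IsRWT m})

----------------------------------------------------------------------
-- The map Ω

content : ∀ {n} → Cell n → ℤ
content (i , j) = toℕ j ⊖ toℕ i

-- The cells with j - i = c, from northwest to southeast (cartesianProduct lists
-- the grid row by row).
diagonal : (n : ℕ) → ℤ → List (Cell n)
diagonal n c = filter (λ x → content x ≟ᶻ c) (cartesianProduct (allFin n) (allFin n))

diagonalPairs : ∀ {n} → BPD n → ℤ → List (Cell n × Cell n)
diagonalPairs {n} P c =
  zip (filter (λ x → isBlank? (tile P x)) (diagonal n c))
      (reverse (filter (λ x → isCross? (tile P x)) (diagonal n c)))

-- A filling of D P, as a partial function on the grid.  A blank cell has a value
-- because each diagonal has as many blanks as crossings; a non-blank cell has none.
Ω : ∀ {n} → BPD n → Cell n → Maybe ℤ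
Ω P b = mapᴹ (λ (_ , x) → toℕ (proj₁ x) ⊖ toℕ (proj₁ b))
             (find (λ (a , _) → a ≟ᶜ b) (diagonalPairs P (content b)))

-- Equality of the filling Ω P of D P with the filling T of 𝕐 (shape T).
record Ω[_]≈_ {n : ℕ} (P : BPD n) (T : DecreasingTableau) : Set where
  field
    same-domain : D P ≐ 𝕐 (shape T)
    same-values : ∀ (b : Cell n) .(p : 𝕐 (shape T) (toℕ (proj₁ b) , toℕ (proj₂ b))) →
                  Ω P b ≡ just (+ entry T (toℕ (proj₁ b)) (toℕ (proj₂ b)) p)

{-# OPTIONS --safe #-}
-- Let r (i , j) be the number of pipes separating the corner (i , j) of the grid
-- from its northwest corner.  Along a diagonal r grows by 0 at a blank, by 2 at
-- a cross and by 1 at every other tile.  If τ is Ω P, extended by zero, then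
--   τ (a , b) ≤ t  ⇔  t < r (a + t + 1 , b + t + 1).
-- This determines r and τ from each other, and turns the condition that r grows
-- by 0 or 1 along each edge of the grid into the condition that τ decreases.
--
-- Sweeping the grid from the southwest, the cross in the cell (i , j) exchanges
-- the pipes number r (i , j) + 1 and r (i , j) + 2 of the sweep line, so it is
-- the letter r (i , j) + 1 of a wiring diagram; this is the Ω-value of the
-- paired blank.  The order of the sweep and the column order of the blanks
-- differ only on letters at distance at least 2, so the column reading word is
-- obtained from the wiring diagram by commutations.  Finally, no two pipes cross
-- twice iff every letter creates an inversion, and then the Demazure rule makes
-- labels follow the pipes.
module Submission where

open import Defs
open import Data.Bool using (Bool; true; false; _∧_)
open import Data.Bool.Properties using (T-≡)
open import Data.Fin as Fin using (Fin; zero; suc; toℕ; fromℕ<; inject₁)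
open import Data.Fin.Permutation using (Permutation′; _⟨$⟩ʳ_; lift₀-transpose)
open import Data.Fin.Properties as Finₚ
  using (toℕ<n; toℕ-fromℕ<; fromℕ<-toℕ; toℕ-injective) renaming (_<?_ to _<?ᶠ_)
open import Data.Integer using (ℤ; _⊖_) renaming (+_ to fromℕ; _+_ to _+ᶻ_; _≟_ to _≟ᶻ_)
import Data.Integer.Properties as ℤₚ
open import Data.List using
  (List; []; _∷_; _++_; length; map; filter; find; zip; reverse; mapMaybe; concatMap
  ; tabulate; allFin; cartesianProduct; upTo; downFrom)
open import Data.List.Properties using
  (++-assoc; ++-identityʳ; ∷-injectiveˡ; ∷-injectiveʳ; length-++; length-map; length-reverse
  ; map-++; map-∘; map-cong; map-cong-local; map-injective; map-tabulate; tabulate-cong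
  ; filter-++; filter-all; filter-accept; filter-reject; concatMap-cong; map-concatMap
  ; reverse-++; unfold-reverse)
open import Data.List.Membership.Propositional using (_∈_)
open import Data.List.Membership.Propositional.Properties
open import Data.List.Relation.Unary.All as All using (All; []; _∷_)
import Data.List.Relation.Unary.All.Properties as Allₚ
open import Data.List.Relation.Unary.AllPairs as AllPairs using (AllPairs; []; _∷_)
import Data.List.Relation.Unary.AllPairs.Properties as AllPairsₚ
open import Data.List.Relation.Unary.Any using (here; there)
open import Data.List.Relation.Unary.Linked using (Linked; []; [-]; _∷_)
open import Data.Maybe using (Maybe; just; nothing; is-just; fromMaybe)
  renaming (map to mapᴹ; zipWith to zipWithᴹ)
open import Data.Maybe.Properties using (just-injective)
open import Data.Nat using
  (ℕ; zero; suc; pred; _+_; _∸_; _⊓_; _≤_; _<_; _≥_; _≤?_; _<?_; _<ᵇ_; z≤n; s≤s; z<s; s<s; s≤s⁻¹)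
open import Data.Nat.ListAction using (sum)
open import Data.Nat.Properties as ℕₚ using
  (≤-trans; ≤-reflexive; ≤-refl; +-suc; +-identityʳ; +-comm; +-assoc; ≰⇒>)
open import Data.Product using
  (Σ-syntax; ∃; ∃₂; _×_; _,_; proj₁; proj₂; map₁; swap; curry; uncurry)
open import Data.Sum as Sum using (_⊎_; inj₁; inj₂)
open import Data.Empty using (⊥-elim)
open import Function using (_∘_; id; case_of_; mk⇔; Equivalence)
open import Function.Bundles using (Bijection; _⇔_)
open import Level using (0ℓ)
import Algebra.Construct.NaturalChoice.Max as Max
import Algebra.Construct.NaturalChoice.Min as Min
open import Relation.Binary.Bundles using (Setoid)
open import Relation.Binary.Definitions using (tri<; tri≈; tri>)
open import Relation.Binary.PropositionalEquality
open import Relation.Nullary using (¬_; Dec; yes; no; does; ¬?; contradiction; recompute)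
open import Relation.Nullary.Decidable using (_×-dec_; dec-true; dec-false; decidable-stable)
open import Relation.Unary using (Pred; Decidable; _≐_)

-- `Ω` pairs two lists on each diagonal, a form that is hard to invert. The equivalence `Matches`
-- replaces the pairing by a threshold: for every cell and every `t` it compares one entry with one
-- rank. Uniqueness in both directions, the existence of the tiling and the decrease of the entries
-- then reduce to inequalities at neighbouring corners. That the threshold is the value of `Ω` is a
-- separate count: a blank with `k` blanks before it on its diagonal has a partner with `k` crosses
-- after it. Large `t` leads to corners beyond the grid. Extending the tiling by the identity gives
-- these the rank `i ⊓ j`, which exceeds every threshold in time. On the side of words, the sweep
-- line is a plain list of labels, so one word acts both through the actual pipes and through the
-- Demazure rule, while `trace` keeps the pairs that meet. Commutations preserve two things, the
-- length of a word and the list it produces. These decide reducedness, because a word is reduced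
-- exactly when its list has as many inversions as the word has letters.

-- Words acting on lists of labels

stepAt : ∀ {n} → Rule n → ℕ → List (Fin n) → List (Fin n)
stepAt ρ a       []           = []
stepAt ρ zero    (x ∷ [])     = x ∷ []
-- The list follows the sweep line from the left boundary to the bottom right corner. On it the left
-- edge of a cross comes just before the bottom edge, and the top edge just before the right edge,
-- so the second output of `ρ` is listed first.
stepAt ρ zero    (x ∷ y ∷ xs) = proj₂ (ρ x y) ∷ proj₁ (ρ x y) ∷ xs
stepAt ρ (suc a) (x ∷ xs)     = x ∷ stepAt ρ a xs

run : ∀ {n} → Rule n → List ℕ → List (Fin n) → List (Fin n)
run ρ []       xs = xs
run ρ (a ∷ as) xs = run ρ as (stepAt ρ a xs)

pairAt : ∀ {n} → ℕ → List (Fin n) → Maybe (Fin n × Fin n)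
pairAt a       []           = nothing
pairAt zero    (x ∷ [])     = nothing
pairAt zero    (x ∷ y ∷ xs) = just (x , y)
pairAt (suc a) (x ∷ xs)     = pairAt a xs

trace : ∀ {n} → List ℕ → List (Fin n) → List (Maybe (Fin n × Fin n))
trace []       xs = []
trace (a ∷ as) xs = pairAt a xs ∷ trace as (stepAt straight a xs)

run-++ : ∀ {n} (ρ : Rule n) as bs xs → run ρ (as ++ bs) xs ≡ run ρ bs (run ρ as xs)
run-++ ρ []       bs xs = refl
run-++ ρ (a ∷ as) bs xs = run-++ ρ as bs (stepAt ρ a xs)

trace-++ : ∀ {n} as bs (xs : List (Fin n)) →
           trace (as ++ bs) xs ≡ trace as xs ++ trace bs (run straight as xs)
trace-++ []       bs xs = refl
trace-++ (a ∷ as) bs xs = cong (_ ∷_) (trace-++ as bs _)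

stepAt-length : ∀ {n} (ρ : Rule n) us x y zs →
  stepAt ρ (length us) (us ++ x ∷ y ∷ zs) ≡ us ++ proj₂ (ρ x y) ∷ proj₁ (ρ x y) ∷ zs
stepAt-length ρ []       x y zs = refl
stepAt-length ρ (u ∷ us) x y zs = cong (u ∷_) (stepAt-length ρ us x y zs)

pairAt-length : ∀ {n} us (x y : Fin n) zs → pairAt (length us) (us ++ x ∷ y ∷ zs) ≡ just (x , y)
pairAt-length []       x y zs = refl
pairAt-length (u ∷ us) x y zs = pairAt-length us x y zs

-- Commutation classes of words

Far : ℕ → ℕ → Set
Far a b = suc a < b ⊎ suc b < a

stepAt-comm< : ∀ {n} (ρ : Rule n) a b xs → suc a < b →
               stepAt ρ a (stepAt ρ b xs) ≡ stepAt ρ b (stepAt ρ a xs)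
stepAt-comm< ρ a b [] p = refl
stepAt-comm< ρ zero (suc zero) (x ∷ xs) (s≤s ())
stepAt-comm< ρ zero (suc (suc b)) (x ∷ []) p = refl
stepAt-comm< ρ zero (suc (suc b)) (x ∷ y ∷ xs) p = refl
stepAt-comm< ρ (suc a) (suc b) (x ∷ xs) (s≤s p) = cong (x ∷_) (stepAt-comm< ρ a b xs p)

stepAt-comm : ∀ {n} (ρ : Rule n) {a b} xs → Far a b →
              stepAt ρ a (stepAt ρ b xs) ≡ stepAt ρ b (stepAt ρ a xs)
stepAt-comm ρ xs (inj₁ p) = stepAt-comm< ρ _ _ xs p
stepAt-comm ρ xs (inj₂ p) = sym (stepAt-comm< ρ _ _ xs p)

run-move : ∀ {n} (ρ : Rule n) {a us} vs xs → All (Far a) us →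
           run ρ (us ++ a ∷ vs) xs ≡ run ρ (a ∷ us ++ vs) xs
run-move ρ vs xs []                         = refl
run-move ρ {a} {u ∷ us} vs xs (far ∷ fars) =
  trans (run-move ρ vs (stepAt ρ u xs) fars) (cong (run ρ (us ++ vs)) (stepAt-comm ρ xs far))

allPairs-++⁻ : ∀ {X : Set} {R : X → X → Set} xs {ys} → AllPairs R (xs ++ ys) →
               AllPairs R xs × AllPairs R ys × All (λ x → All (R x) ys) xs
allPairs-++⁻ []       rs       = [] , rs , []
allPairs-++⁻ (x ∷ xs) (r ∷ rs) =
  let rxs , rys , rxys = allPairs-++⁻ xs rs
  in Allₚ.++⁻ˡ xs r ∷ rxs , rys , Allₚ.++⁻ʳ xs r ∷ rxys

-- Two listings of the same set whose orders differ only on pairs with far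
-- letters give words related by commutations.
module _ {X : Set} (f : X → ℕ) (R₁ R₂ : X → X → Set)
         (irr₁ : ∀ {x} → ¬ R₁ x x) (irr₂ : ∀ {x} → ¬ R₂ x x)
         (far : ∀ {x y} → R₁ x y → R₂ y x → Far (f x) (f y)) where

  reorder : ∀ xs ys → AllPairs R₁ xs → AllPairs R₂ ys →
            (∀ {x} → x ∈ xs → x ∈ ys) → (∀ {x} → x ∈ ys → x ∈ xs) →
            length xs ≡ length ys ×
            (∀ {n} (zs : List (Fin n)) → run straight (map f xs) zs ≡ run straight (map f ys) zs)
  reorder [] [] _ _ _ _ = refl , λ _ → refl
  reorder [] (y ∷ ys) _ _ _ ⊇ = case ⊇ (here refl) of λ ()
  reorder (x ∷ xs) ys (x<xs ∷ <xs) <ys ⊆ ⊇ with ∈-∃++ (⊆ (here refl))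
  ... | us , vs , refl with allPairs-++⁻ us <ys
  ... | <us , x<vs ∷ <vs , us<xvs with reorder xs (us ++ vs) <xs <usvs ⊆′ ⊇′
    where
    <usvs : AllPairs R₂ (us ++ vs)
    <usvs = AllPairsₚ.++⁺ <us <vs (All.map All.tail us<xvs)
    ⊆′ : ∀ {z} → z ∈ xs → z ∈ us ++ vs
    ⊆′ z∈xs with ∈-++⁻ us (⊆ (there z∈xs))
    ... | inj₁ z∈us         = ∈-++⁺ˡ z∈us
    ... | inj₂ (here refl)  = contradiction (All.lookup x<xs z∈xs) irr₁
    ... | inj₂ (there z∈vs) = ∈-++⁺ʳ us z∈vs
    ⊇′ : ∀ {z} → z ∈ us ++ vs → z ∈ xs
    ⊇′ z∈ with ∈-++⁻ us z∈
    ⊇′ z∈ | inj₁ z∈us with ⊇ (∈-++⁺ˡ z∈us)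
    ... | here refl = contradiction (All.head (All.lookup us<xvs z∈us)) irr₂
    ... | there z∈xs = z∈xs
    ⊇′ z∈ | inj₂ z∈vs with ⊇ (∈-++⁺ʳ us (there z∈vs))
    ... | here refl = contradiction (All.lookup x<vs z∈vs) irr₂
    ... | there z∈xs = z∈xs
  ... | len , runs = len′ , runs′
    where
    len′ : suc (length xs) ≡ length (us ++ x ∷ vs)
    len′ rewrite length-++ us {x ∷ vs} | ℕₚ.+-suc (length us) (length vs) | sym (length-++ us {vs}) =
      cong suc len
    -- An entry before `x` in the second list is not `x` itself, so it stands after `x` in the first
    -- list: the two orders disagree on this pair.
    farUs : All (Far (f x)) (map f us)
    farUs = Allₚ.map⁺ (All.tabulate λ {z} z∈us →
      case ⊇ (∈-++⁺ˡ z∈us) of λ where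
        (here refl)  → contradiction (All.head (All.lookup us<xvs z∈us)) irr₂
        (there z∈xs) → far (All.lookup x<xs z∈xs) (All.head (All.lookup us<xvs z∈us)))
    runs′ : ∀ {n} (zs : List (Fin n)) →
            run straight (map f (x ∷ xs)) zs ≡ run straight (map f (us ++ x ∷ vs)) zs
    runs′ zs rewrite map-++ f us (x ∷ vs) | run-move straight (map f vs) zs farUs
      | sym (map-++ f us vs) = runs (stepAt straight (f x) zs)

-- Inversions

bit : Bool → ℕ
bit true  = 1
bit false = 0

countBelow : ∀ {n} → Fin n → List (Fin n) → ℕ
countBelow x []       = 0
countBelow x (y ∷ ys) = bit (does (y <?ᶠ x)) + countBelow x ys

inversions : ∀ {n} → List (Fin n) → ℕ
inversions []       = 0
inversions (x ∷ xs) = countBelow x xs + inversions xs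

+-swap : ∀ a b c → a + (b + c) ≡ b + (a + c)
+-swap a b c = trans (sym (ℕₚ.+-assoc a b c)) (trans (cong (_+ c) (ℕₚ.+-comm a b)) (ℕₚ.+-assoc b a c))

countBelow-stepAt : ∀ {n} (x : Fin n) a ys → countBelow x (stepAt straight a ys) ≡ countBelow x ys
countBelow-stepAt x a       []           = refl
countBelow-stepAt x zero    (y ∷ [])     = refl
countBelow-stepAt x zero    (y ∷ z ∷ ys) = +-swap (bit (does (z <?ᶠ x))) (bit (does (y <?ᶠ x))) _
countBelow-stepAt x (suc a) (y ∷ ys)     = cong (_ +_) (countBelow-stepAt x a ys)

bit-yes : ∀ {n} {x y : Fin n} → x Fin.< y → bit (does (x <?ᶠ y)) ≡ 1
bit-yes {x = x} {y} x<y = cong bit (dec-true (x <?ᶠ y) x<y)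

bit-no : ∀ {n} {x y : Fin n} → ¬ x Fin.< y → bit (does (x <?ᶠ y)) ≡ 0
bit-no {x = x} {y} x≮y = cong bit (dec-false (x <?ᶠ y) x≮y)

inversions-asc : ∀ {n} a {x y : Fin n} xs → pairAt a xs ≡ just (x , y) → x Fin.< y →
                 inversions (stepAt straight a xs) ≡ suc (inversions xs)
inversions-asc zero    (x ∷ y ∷ xs) refl x<y
  rewrite bit-yes x<y | bit-no (ℕₚ.<-asym x<y) =
  cong suc (+-swap (countBelow y xs) (countBelow x xs) _)
inversions-asc (suc a) (x ∷ xs) eq x<y
  rewrite countBelow-stepAt x a xs | inversions-asc a xs eq x<y = ℕₚ.+-suc _ _

inversions-desc : ∀ {n} a {x y : Fin n} xs → pairAt a xs ≡ just (x , y) → ¬ x Fin.< y →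
                  inversions (stepAt straight a xs) ≤ inversions xs
inversions-desc zero    (x ∷ y ∷ xs) refl x≮y
  rewrite bit-no x≮y | +-swap (countBelow y xs) (countBelow x xs) (inversions xs)
        | ℕₚ.+-assoc (bit (does (y <?ᶠ x))) (countBelow x xs) (countBelow y xs + inversions xs)
        = ℕₚ.m≤n+m _ (bit (does (y <?ᶠ x)))
inversions-desc (suc a) (x ∷ xs) eq x≮y
  rewrite countBelow-stepAt x a xs = ℕₚ.+-monoʳ-≤ _ (inversions-desc a xs eq x≮y)

stepAt-nothing : ∀ {n} (ρ : Rule n) a xs → pairAt a xs ≡ nothing → stepAt ρ a xs ≡ xs
stepAt-nothing ρ a       []       eq = refl
stepAt-nothing ρ zero    (x ∷ []) eq = refl
stepAt-nothing ρ (suc a) (x ∷ xs) eq = cong (x ∷_) (stepAt-nothing ρ a xs eq)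

Ascending : ∀ {n} → Maybe (Fin n × Fin n) → Set
Ascending mp = ∃₂ λ x y → mp ≡ just (x , y) × x Fin.< y

inversions-step : ∀ {n} a (xs : List (Fin n)) →
  Ascending (pairAt a xs) × inversions (stepAt straight a xs) ≡ suc (inversions xs)
  ⊎ inversions (stepAt straight a xs) ≤ inversions xs
inversions-step a xs with pairAt a xs in eq
... | nothing rewrite stepAt-nothing straight a xs eq = inj₂ ℕₚ.≤-refl
... | just (x , y) with x <?ᶠ y
...   | yes x<y = inj₁ ((x , y , refl , x<y) , inversions-asc a xs eq x<y)
...   | no x≮y  = inj₂ (inversions-desc a xs eq x≮y)

inversions-run-≤ : ∀ {n} as (xs : List (Fin n)) →
                   inversions (run straight as xs) ≤ length as + inversions xs
inversions-run-≤ []       xs = ℕₚ.≤-refl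
inversions-run-≤ (a ∷ as) xs = ℕₚ.≤-trans (inversions-run-≤ as _)
    (ℕₚ.≤-trans (ℕₚ.+-monoʳ-≤ (length as) one) (ℕₚ.≤-reflexive (ℕₚ.+-suc _ _)))
  where
  one : inversions (stepAt straight a xs) ≤ suc (inversions xs)
  one with inversions-step a xs
  ... | inj₁ (_ , eq) = ℕₚ.≤-reflexive eq
  ... | inj₂ le       = ℕₚ.m≤n⇒m≤1+n le

ascending⇒inversions : ∀ {n} as (xs : List (Fin n)) → All Ascending (trace as xs) →
                       inversions (run straight as xs) ≡ length as + inversions xs
ascending⇒inversions []       xs [] = refl
ascending⇒inversions (a ∷ as) xs ((x , y , eq , x<y) ∷ asc)
  rewrite ascending⇒inversions as _ asc | inversions-asc a xs eq x<y = ℕₚ.+-suc _ _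

-- A letter adds at most one inversion, and adds one only at an ascending pair; reaching the maximal
-- total leaves no slack at any letter.
inversions⇒ascending : ∀ {n} as (xs : List (Fin n)) →
                       inversions (run straight as xs) ≡ length as + inversions xs →
                       All Ascending (trace as xs)
inversions⇒ascending []       xs eq = []
inversions⇒ascending (a ∷ as) xs eq with inversions-step a xs
... | inj₁ (asc , eq₁) = asc ∷ inversions⇒ascending as _
        (trans eq (sym (trans (cong (length as +_) eq₁) (ℕₚ.+-suc _ _))))
... | inj₂ le = contradiction (ℕₚ.≤-reflexive (sym eq))
        (ℕₚ.<⇒≱ (s≤s (ℕₚ.≤-trans (inversions-run-≤ as _) (ℕₚ.+-monoʳ-≤ (length as) le))))

-- Double crossings

data Before {n} (u v : Fin n) : List (Fin n) → Set where
  bhere  : ∀ {xs} → v ∈ xs → Before u v (u ∷ xs)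
  bthere : ∀ {x xs} → Before u v xs → Before u v (x ∷ xs)

before-∈ : ∀ {n} {u v : Fin n} {xs} → Before u v xs → v ∈ xs
before-∈ (bhere p)  = there p
before-∈ (bthere b) = there (before-∈ b)

Distinct : ∀ {n} → List (Fin n) → Set
Distinct = AllPairs _≢_

before-asym : ∀ {n} {u v : Fin n} {xs} → Distinct xs → Before u v xs → ¬ Before v u xs
before-asym (d ∷ ds) (bhere p)   (bhere q)   = All.lookup d q refl
before-asym (d ∷ ds) (bhere p)   (bthere c)  = All.lookup d (before-∈ c) refl
before-asym (d ∷ ds) (bthere b)  (bhere q)   = All.lookup d (before-∈ b) refl
before-asym (d ∷ ds) (bthere b)  (bthere c)  = before-asym ds b c

∈-stepAt⁻ : ∀ {n} {x : Fin n} a xs → x ∈ stepAt straight a xs → x ∈ xs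
∈-stepAt⁻ zero    (x ∷ [])     p                    = p
∈-stepAt⁻ zero    (x ∷ y ∷ xs) (here refl)          = there (here refl)
∈-stepAt⁻ zero    (x ∷ y ∷ xs) (there (here refl))  = here refl
∈-stepAt⁻ zero    (x ∷ y ∷ xs) (there (there p))    = there (there p)
∈-stepAt⁻ (suc a) (x ∷ xs)     (here refl)          = here refl
∈-stepAt⁻ (suc a) (x ∷ xs)     (there p)            = there (∈-stepAt⁻ a xs p)

∈-stepAt⁺ : ∀ {n} {x : Fin n} a xs → x ∈ xs → x ∈ stepAt straight a xs
∈-stepAt⁺ zero    (x ∷ [])     p                    = p
∈-stepAt⁺ zero    (x ∷ y ∷ xs) (here refl)          = there (here refl)
∈-stepAt⁺ zero    (x ∷ y ∷ xs) (there (here refl))  = here refl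
∈-stepAt⁺ zero    (x ∷ y ∷ xs) (there (there p))    = there (there p)
∈-stepAt⁺ (suc a) (x ∷ xs)     (here refl)          = here refl
∈-stepAt⁺ (suc a) (x ∷ xs)     (there p)            = there (∈-stepAt⁺ a xs p)

distinct-stepAt : ∀ {n} a {xs : List (Fin n)} → Distinct xs → Distinct (stepAt straight a xs)
distinct-stepAt a       []                         = []
distinct-stepAt zero    (d ∷ [])                   = d ∷ []
distinct-stepAt zero    ((x≢y ∷ dx) ∷ (dy ∷ ds))   = (≢-sym x≢y ∷ dy) ∷ (dx ∷ ds)
distinct-stepAt (suc a) {x ∷ xs} (d ∷ ds)          =
  All.tabulate (λ p → All.lookup d (∈-stepAt⁻ a xs p)) ∷ distinct-stepAt a ds

pairAt-before : ∀ {n} a {x y : Fin n} xs → pairAt a xs ≡ just (x , y) → Before x y xs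
pairAt-before zero    (x ∷ y ∷ xs) refl = bhere (here refl)
pairAt-before (suc a) (x ∷ xs)     eq   = bthere (pairAt-before a xs eq)

stepAt-pair : ∀ {n} a {x y : Fin n} xs → pairAt a xs ≡ just (x , y) → Before y x (stepAt straight a xs)
stepAt-pair zero    (x ∷ y ∷ xs) refl = bhere (here refl)
stepAt-pair (suc a) (x ∷ xs)     eq   = bthere (stepAt-pair a xs eq)

before-stepAt⁺ : ∀ {n} a {u v : Fin n} xs → Before u v xs →
                 pairAt a xs ≡ just (u , v) ⊎ Before u v (stepAt straight a xs)
before-stepAt⁺ zero (x ∷ []) b = inj₂ b
before-stepAt⁺ zero (x ∷ y ∷ xs) (bhere (here refl))  = inj₁ refl
before-stepAt⁺ zero (x ∷ y ∷ xs) (bhere (there p))    = inj₂ (bthere (bhere p))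
before-stepAt⁺ zero (x ∷ y ∷ xs) (bthere (bhere p))   = inj₂ (bhere (there p))
before-stepAt⁺ zero (x ∷ y ∷ xs) (bthere (bthere b))  = inj₂ (bthere (bthere b))
before-stepAt⁺ (suc a) (x ∷ xs) (bhere p)  = inj₂ (bhere (∈-stepAt⁺ a xs p))
before-stepAt⁺ (suc a) (x ∷ xs) (bthere b) with before-stepAt⁺ a xs b
... | inj₁ eq = inj₁ eq
... | inj₂ c  = inj₂ (bthere c)

before-stepAt⁻ : ∀ {n} a {u v : Fin n} xs → Before u v (stepAt straight a xs) →
                 pairAt a xs ≡ just (v , u) ⊎ Before u v xs
before-stepAt⁻ zero (x ∷ []) b = inj₂ b
before-stepAt⁻ zero (x ∷ y ∷ xs) (bhere (here refl))  = inj₁ refl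
before-stepAt⁻ zero (x ∷ y ∷ xs) (bhere (there p))    = inj₂ (bthere (bhere p))
before-stepAt⁻ zero (x ∷ y ∷ xs) (bthere (bhere p))   = inj₂ (bhere (there p))
before-stepAt⁻ zero (x ∷ y ∷ xs) (bthere (bthere b))  = inj₂ (bthere (bthere b))
before-stepAt⁻ (suc a) (x ∷ xs) (bhere p)  = inj₂ (bhere (∈-stepAt⁻ a xs p))
before-stepAt⁻ (suc a) (x ∷ xs) (bthere b) with before-stepAt⁻ a xs b
... | inj₁ eq = inj₁ eq
... | inj₂ c  = inj₂ (bthere c)

Avoids : ∀ {n} → Fin n → Fin n → Maybe (Fin n × Fin n) → Set
Avoids u v mp = mp ≢ just (u , v) × mp ≢ just (v , u)

-- As unordered pairs; nothing differs from everything.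
Differ : ∀ {n} (mp mq : Maybe (Fin n × Fin n)) → Set
Differ mp mq = ∀ {u v} → mp ≡ just (u , v) → Avoids u v mq

-- An inverted pair cannot meet again: meeting in its present order would be a descent, and the
-- opposite order is not the one in the list. Its order therefore persists, and so does the
-- argument.
ascending⇒avoids : ∀ {n} as {xs : List (Fin n)} → Distinct xs → All Ascending (trace as xs) →
                   ∀ {u v} → Before u v xs → v Fin.< u → All (Avoids u v) (trace as xs)
ascending⇒avoids []       ds [] b v<u = []
ascending⇒avoids (a ∷ as) {xs} ds ((x , y , eq , x<y) ∷ asc) {u} {v} b v<u =
  (≢₁ , ≢₂) ∷ ascending⇒avoids as (distinct-stepAt a ds) asc
    (Sum.[ (λ e → contradiction e ≢₁) , id ]′ (before-stepAt⁺ a xs b)) v<u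
  where
  ≢₁ : pairAt a xs ≢ just (u , v)
  ≢₁ e with trans (sym eq) e
  ... | refl = ℕₚ.<-asym x<y v<u
  ≢₂ : pairAt a xs ≢ just (v , u)
  ≢₂ e = before-asym ds b (pairAt-before a xs e)

ascending⇒differ : ∀ {n} as {xs : List (Fin n)} → Distinct xs → All Ascending (trace as xs) →
                   AllPairs Differ (trace as xs)
ascending⇒differ []       ds [] = []
ascending⇒differ (a ∷ as) {xs} ds ((x , y , eq , x<y) ∷ asc) =
  All.map differ (ascending⇒avoids as (distinct-stepAt a ds) asc (stepAt-pair a xs eq) x<y)
  ∷ ascending⇒differ as (distinct-stepAt a ds) asc
  where
  differ : ∀ {mp} → Avoids y x mp → Differ (pairAt a xs) mp
  differ av e with trans (sym eq) e
  ... | refl = swap av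

-- The last hypothesis is the invariant of the induction: every inverted pair is avoided by the rest
-- of the word. It forces the next pair to be ascending, and `Differ` restores it for the pair just
-- inverted.
differ⇒ascending : ∀ {n} as {xs : List (Fin n)} → Distinct xs →
  All (λ mp → ∃₂ λ x y → mp ≡ just (x , y)) (trace as xs) → AllPairs Differ (trace as xs) →
  (∀ {u v} → Before u v xs → v Fin.< u → All (Avoids u v) (trace as xs)) →
  All Ascending (trace as xs)
differ⇒ascending []       ds js df av = []
differ⇒ascending (a ∷ as) {xs} ds ((x , y , eq) ∷ js) (d ∷ df) av =
  (x , y , eq , x<y) ∷ differ⇒ascending as (distinct-stepAt a ds) js df av′
  where
  xy : Before x y xs
  xy = pairAt-before a xs eq
  x<y : x Fin.< y
  x<y with Finₚ.<-cmp x y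
  ... | tri< lt _ _   = lt
  ... | tri≈ _ refl _ = contradiction xy (before-asym ds xy)
  ... | tri> _ _ gt   = contradiction eq (proj₁ (All.head (av xy gt)))
  av′ : ∀ {u v} → Before u v (stepAt straight a xs) → v Fin.< u →
        All (Avoids u v) (trace as (stepAt straight a xs))
  av′ b v<u with before-stepAt⁻ a xs b
  ... | inj₁ e = All.map (λ m → swap (m e)) d
  ... | inj₂ c = All.tail (av c v<u)

-- The Demazure rule on ascending pairs

demazure-< : ∀ {n} {x y : Fin n} → x Fin.< y → demazure x y ≡ straight x y
demazure-< {n} {x} {y} x<y = cong₂ _,_ (Min.x≤y⇒x⊓y≈x (Finₚ.≤-totalOrder n) (ℕₚ.<⇒≤ x<y))
                                       (Max.x≤y⇒x⊔y≈y (Finₚ.≤-totalOrder n) (ℕₚ.<⇒≤ x<y))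

stepAt-demazure : ∀ {n} a {x y : Fin n} xs → pairAt a xs ≡ just (x , y) → x Fin.< y →
                  stepAt demazure a xs ≡ stepAt straight a xs
stepAt-demazure zero    (x ∷ y ∷ xs) refl x<y = cong (λ p → proj₂ p ∷ proj₁ p ∷ xs) (demazure-< x<y)
stepAt-demazure (suc a) (x ∷ xs)     eq   x<y = cong (x ∷_) (stepAt-demazure a xs eq x<y)

run-demazure : ∀ {n} as (xs : List (Fin n)) → All Ascending (trace as xs) →
               run demazure as xs ≡ run straight as xs
run-demazure []       xs [] = refl
run-demazure (a ∷ as) xs ((x , y , eq , x<y) ∷ asc)
  rewrite stepAt-demazure a xs eq x<y = run-demazure as _ asc

-- Word products, length and reduced words

tabulate-injective : ∀ {A : Set} {n} {f g : Fin n → A} → tabulate f ≡ tabulate g → ∀ i → f i ≡ g i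
tabulate-injective {n = suc n} eq zero    = ∷-injectiveˡ eq
tabulate-injective {n = suc n} eq (suc i) = tabulate-injective (∷-injectiveʳ eq) i

stepAt-tabulate : ∀ {m n} (a : Fin m) (g : Fin (suc m) → Fin n) →
                  stepAt straight (toℕ a) (tabulate g) ≡ tabulate (g ∘ (s a ⟨$⟩ʳ_))
stepAt-tabulate zero    g = refl
stepAt-tabulate (suc a) g = cong (g zero ∷_) (trans (stepAt-tabulate a (g ∘ suc))
  (tabulate-cong λ i → cong g (sym (lift₀-transpose (inject₁ a) (suc a) (suc i)))))

-- A letter permutes positions, so it composes on the argument side of `g`. Later letters end up
-- further to the right, which is the order of the factors in `wordProduct`.
run-tabulate : ∀ {m n} (as : List (Fin m)) (g : Fin (suc m) → Fin n) →
               run straight (map toℕ as) (tabulate g) ≡ tabulate (g ∘ (wordProduct as ⟨$⟩ʳ_))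
run-tabulate []       g = refl
run-tabulate (a ∷ as) g rewrite stepAt-tabulate a g = run-tabulate as (g ∘ (s a ⟨$⟩ʳ_))

length-filter : ∀ {A : Set} {P : Pred A 0ℓ} (P? : Decidable P) xs →
                length (filter P? xs) ≡ sum (map (bit ∘ does ∘ P?) xs)
length-filter P? [] = refl
length-filter P? (x ∷ xs) with does (P? x)
... | true  = cong suc (length-filter P? xs)
... | false = length-filter P? xs

length-filter-× : ∀ {A B : Set} {P : Pred (A × B) 0ℓ} (P? : Decidable P) xs ys →
  length (filter P? (cartesianProduct xs ys)) ≡
  sum (map (λ x → sum (map (λ y → bit (does (P? (x , y)))) ys)) xs)
length-filter-× P? [] ys = refl
length-filter-× P? (x ∷ xs) ys = begin
  length (filter P? (map (x ,_) ys ++ cartesianProduct xs ys))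
    ≡⟨ cong length (filter-++ P? (map (x ,_) ys) _) ⟩
  length (filter P? (map (x ,_) ys) ++ filter P? (cartesianProduct xs ys))
    ≡⟨ length-++ (filter P? (map (x ,_) ys)) ⟩
  length (filter P? (map (x ,_) ys)) + length (filter P? (cartesianProduct xs ys))
    ≡⟨ cong₂ _+_ (length-filter P? (map (x ,_) ys)) (length-filter-× P? xs ys) ⟩
  sum (map (bit ∘ does ∘ P?) (map (x ,_) ys)) + _
    ≡⟨ cong (λ zs → sum zs + _) (sym (map-∘ ys)) ⟩
  sum (map (λ y → bit (does (P? (x , y)))) ys) + _ ∎
  where open ≡-Reasoning

sum-allFin : ∀ {n} (g : Fin (suc n) → ℕ) →
             sum (map g (allFin (suc n))) ≡ g zero + sum (map (g ∘ suc) (allFin n))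
sum-allFin g = cong (λ zs → g zero + sum zs) (trans (map-tabulate suc g) (sym (map-tabulate id (g ∘ suc))))

sum-inversions : ∀ {n N} (v : Fin n → Fin N) →
  sum (map (λ i → sum (map (λ j → bit (does (i <?ᶠ j) ∧ does (v j <?ᶠ v i))) (allFin n))) (allFin n))
  ≡ inversions (tabulate v)
sum-inversions {zero} v = refl
sum-inversions {suc n} v = trans
  (sum-allFin (λ i → sum (map (λ j → bit (does (i <?ᶠ j) ∧ does (v j <?ᶠ v i))) (allFin (suc n)))))
  (cong₂ _+_
    (trans (sum-allFin (λ j → bit (does (zero {n} <?ᶠ j) ∧ does (v j <?ᶠ v zero)))) (below (v ∘ suc)))
    (trans (cong sum (map-cong (λ i → sum-allFin (λ j → bit
        (does (suc i <?ᶠ j) ∧ does (v j <?ᶠ v (suc i))))) (allFin n)))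
           (sum-inversions (v ∘ suc))))
  where
  below : ∀ {m} (u : Fin m → Fin _) →
          sum (map (λ j → bit (does (u j <?ᶠ v zero))) (allFin m)) ≡ countBelow (v zero) (tabulate u)
  below {zero}  u = refl
  below {suc m} u = trans (sum-allFin (λ j → bit (does (u j <?ᶠ v zero))))
      (cong (bit (does (u zero <?ᶠ v zero)) +_) (below (u ∘ suc)))

ℓ-inversions : ∀ {n} (w : Permutation′ n) → ℓ w ≡ inversions (tabulate (w ⟨$⟩ʳ_))
ℓ-inversions {n} w = trans (length-filter-× _ (allFin n) (allFin n)) (sum-inversions (w ⟨$⟩ʳ_))

distinct-allFin : ∀ n → Distinct (allFin n)
distinct-allFin n = AllPairsₚ.tabulate⁺ id

sorted-before : ∀ {n} {u v : Fin n} {xs} → AllPairs Fin._<_ xs → Before u v xs → u Fin.< v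
sorted-before (u< ∷ _) (bhere p)  = All.lookup u< p
sorted-before (_ ∷ <s) (bthere b) = sorted-before <s b

sorted-allFin : ∀ n → AllPairs Fin._<_ (allFin n)
sorted-allFin n = AllPairsₚ.tabulate⁺-< id

inversions-sorted : ∀ {n} {xs : List (Fin n)} → AllPairs Fin._<_ xs → inversions xs ≡ 0
inversions-sorted []        = refl
inversions-sorted (<s ∷ ss) rewrite inversions-sorted ss = trans (ℕₚ.+-identityʳ _) (none <s)
  where
  none : ∀ {x ys} → All (x Fin.<_) ys → countBelow x ys ≡ 0
  none []         = refl
  none (lt ∷ lts) rewrite bit-no (ℕₚ.<-asym lt) = none lts

-- Reducedness for letters counted from zero, read off the list that the word produces. A letter out
-- of range creates no inversion and is thereby excluded.
ReducedWord : ℕ → List ℕ → Set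
ReducedWord n as = inversions (run straight as (allFin n)) ≡ length as

reducedWord⇒ascending : ∀ {n} as → ReducedWord n as → All Ascending (trace as (allFin n))
reducedWord⇒ascending {n} as red = inversions⇒ascending as (allFin n)
  (trans red (sym (trans (cong (length as +_) (inversions-sorted (sorted-allFin n))) (ℕₚ.+-identityʳ _))))

differ⇒reducedWord : ∀ {n} as → All (λ mp → ∃₂ λ x y → mp ≡ just (x , y)) (trace as (allFin n)) →
                     AllPairs Differ (trace as (allFin n)) → ReducedWord n as
differ⇒reducedWord {n} as js df =
  trans (ascending⇒inversions as (allFin n)
          (differ⇒ascending as (distinct-allFin n) js df λ b v<u →
             contradiction v<u (ℕₚ.<-asym (sorted-before (sorted-allFin n) b))))
        (trans (cong (length as +_) (inversions-sorted (sorted-allFin n))) (ℕₚ.+-identityʳ _))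

module _ {m : ℕ} (as : List ℕ) (as<m : All (_< m) as) where

  letters : List (Fin m)
  letters = All.reduce (λ lt → Fin.fromℕ< lt) as<m

  toℕ-letters : map toℕ letters ≡ as
  toℕ-letters = go as as<m
    where
    go : ∀ bs (bs<m : All (_< m) bs) → map toℕ (All.reduce (λ lt → Fin.fromℕ< lt) bs<m) ≡ bs
    go []       []         = refl
    go (b ∷ bs) (lt ∷ lts) = cong₂ _∷_ (Finₚ.toℕ-fromℕ< lt) (go bs lts)

  run-letters : run straight as (allFin (suc m)) ≡ tabulate (wordProduct letters ⟨$⟩ʳ_)
  run-letters = trans (cong (λ bs → run straight bs (allFin (suc m))) (sym toℕ-letters))
                      (run-tabulate letters id)

  reducedWordFor⁺ : (w : Permutation′ (suc m)) → ReducedWord (suc m) as →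
    run straight as (allFin (suc m)) ≡ tabulate (w ⟨$⟩ʳ_) → ReducedWordFor (map suc as) w
  reducedWordFor⁺ w red eq = letters
    , trans (cong (map suc) (sym toℕ-letters)) (sym (map-∘ letters))
    , tabulate-injective (trans (sym run-letters) eq)
    , trans (sym (length-map toℕ letters)) (trans (cong length toℕ-letters)
        (trans (sym red) (trans (cong inversions eq) (sym (ℓ-inversions w)))))

reducedWordFor⁻ : ∀ {m} as (w : Permutation′ (suc m)) → ReducedWordFor (map suc as) w →
  ReducedWord (suc m) as × run straight as (allFin (suc m)) ≡ tabulate (w ⟨$⟩ʳ_)
reducedWordFor⁻ {m} as w (bs , eq , prod , len) = red , tab
  where
  as≡ : as ≡ map toℕ bs
  as≡ = map-injective ℕₚ.suc-injective (trans eq (map-∘ bs))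
  tab : run straight as (allFin (suc m)) ≡ tabulate (w ⟨$⟩ʳ_)
  tab = trans (cong (λ cs → run straight cs (allFin (suc m))) as≡)
              (trans (run-tabulate bs id) (tabulate-cong prod))
  red : ReducedWord (suc m) as
  red = trans (cong inversions tab) (trans (sym (ℓ-inversions w))
        (trans (sym len) (trans (sym (length-map toℕ bs)) (cong length (sym as≡)))))

-- The crosses of a stack of rows and their word

crossIf : ∀ {A : Set} → Tile → A → List A → List A
crossIf downElbow x xs = xs
crossIf upElbow   x xs = xs
crossIf cross     x xs = x ∷ xs
crossIf blank     x xs = xs
crossIf horiz     x xs = xs
crossIf vert      x xs = xs

map-crossIf : ∀ {A B : Set} (f : A → B) t x xs → map f (crossIf t x xs) ≡ crossIf t (f x) (map f xs)
map-crossIf f downElbow x xs = refl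
map-crossIf f upElbow   x xs = refl
map-crossIf f cross     x xs = refl
map-crossIf f blank     x xs = refl
map-crossIf f horiz     x xs = refl
map-crossIf f vert      x xs = refl

rowCrosses : ∀ {m} → (Fin m → Tile) → List (Fin m)
rowCrosses {zero}  ts = []
rowCrosses {suc m} ts = crossIf (ts zero) zero (map suc (rowCrosses (ts ∘ suc)))

-- `a` counts the labels ahead of the current tile on the sweep line; each earlier tile of the row
-- contributes the label on its top edge, if any. The pair at a cross thus begins at position `a`.
rowWord : ∀ {m} → ℕ → (Fin m → Tile) → List ℕ
rowWord {zero}  a ts = []
rowWord {suc m} a ts = crossIf (ts zero) a (rowWord (bit (onTop (ts zero)) + a) (ts ∘ suc))

stackCrosses : ∀ {m n} → (Fin m → Fin n → Tile) → List (Fin m × Fin n)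
stackCrosses {zero}  t = []
stackCrosses {suc m} t = map (map₁ suc) (stackCrosses (t ∘ suc)) ++ map (zero ,_) (rowCrosses (t zero))

stackWord : ∀ {m n} → (Fin m → Fin n → Tile) → List ℕ
stackWord {zero}  t = []
stackWord {suc m} t = stackWord (t ∘ suc) ++ rowWord 0 (t zero)

topsBefore : ∀ {m} → (Fin m → Tile) → Fin m → ℕ
topsBefore ts zero    = 0
topsBefore ts (suc j) = bit (onTop (ts zero)) + topsBefore (ts ∘ suc) j

rowWord-letters : ∀ {m} a (ts : Fin m → Tile) →
                  rowWord a ts ≡ map (λ j → topsBefore ts j + a) (rowCrosses ts)
rowWord-letters {zero}  a ts = refl
rowWord-letters {suc m} a ts
  rewrite map-crossIf (λ j → topsBefore ts j + a) (ts zero) zero (map suc (rowCrosses (ts ∘ suc))) =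
  cong (crossIf (ts zero) a) (trans (rowWord-letters (bit (onTop (ts zero)) + a) (ts ∘ suc))
    (trans (map-cong (λ j → shift (bit (onTop (ts zero))) (topsBefore (ts ∘ suc) j)) (rowCrosses (ts ∘ suc)))
           (map-∘ (rowCrosses (ts ∘ suc)))))
  where
  shift : ∀ b c → c + (b + a) ≡ b + c + a
  shift b c = trans (+-swap c b a) (sym (ℕₚ.+-assoc b c a))

stackWord-letters : ∀ {m n} (t : Fin m → Fin n → Tile) →
                    stackWord t ≡ map (λ (i , j) → topsBefore (t i) j) (stackCrosses t)
stackWord-letters {zero}  t = refl
stackWord-letters {suc m} t = trans
  (cong₂ _++_ (trans (stackWord-letters (t ∘ suc)) (map-∘ (stackCrosses (t ∘ suc))))
              (trans (rowWord-letters 0 (t zero))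
                (trans (map-cong (λ j → ℕₚ.+-identityʳ _) (rowCrosses (t zero)))
                       (map-∘ (rowCrosses (t zero))))))
  (sym (map-++ _ (map (map₁ suc) (stackCrosses (t ∘ suc))) _))

All-crossIf : ∀ {A : Set} {P : A → Set} t {x xs} → (t ≡ cross → P x) → All P xs → All P (crossIf t x xs)
All-crossIf downElbow p ps = ps
All-crossIf upElbow   p ps = ps
All-crossIf cross     p ps = p refl ∷ ps
All-crossIf blank     p ps = ps
All-crossIf horiz     p ps = ps
All-crossIf vert      p ps = ps

AllPairs-crossIf : ∀ {A : Set} {R : A → A → Set} t {x xs} → All (R x) xs → AllPairs R xs →
                   AllPairs R (crossIf t x xs)
AllPairs-crossIf downElbow r rs = rs
AllPairs-crossIf upElbow   r rs = rs
AllPairs-crossIf cross     r rs = r ∷ rs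
AllPairs-crossIf blank     r rs = rs
AllPairs-crossIf horiz     r rs = rs
AllPairs-crossIf vert      r rs = rs

∈-crossIf : ∀ {A : Set} t {x y : A} {xs} → y ∈ xs → y ∈ crossIf t x xs
∈-crossIf downElbow p = p
∈-crossIf upElbow   p = p
∈-crossIf cross     p = there p
∈-crossIf blank     p = p
∈-crossIf horiz     p = p
∈-crossIf vert      p = p

rowCrosses-cross : ∀ {m} (ts : Fin m → Tile) → All (λ j → ts j ≡ cross) (rowCrosses ts)
rowCrosses-cross {zero}  ts = []
rowCrosses-cross {suc m} ts = All-crossIf (ts zero) id (Allₚ.map⁺ (rowCrosses-cross (ts ∘ suc)))

∈-rowCrosses : ∀ {m} (ts : Fin m → Tile) j → ts j ≡ cross → j ∈ rowCrosses ts
∈-rowCrosses ts zero    eq rewrite eq = here refl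
∈-rowCrosses ts (suc j) eq = ∈-crossIf (ts zero) (∈-map⁺ suc (∈-rowCrosses (ts ∘ suc) j eq))

rowCrosses-sorted : ∀ {m} (ts : Fin m → Tile) → AllPairs Fin._<_ (rowCrosses ts)
rowCrosses-sorted {zero}  ts = []
rowCrosses-sorted {suc m} ts = AllPairs-crossIf (ts zero)
  (Allₚ.map⁺ (All.tabulate λ _ → z<s))
  (AllPairsₚ.map⁺ (AllPairs.map s<s (rowCrosses-sorted (ts ∘ suc))))

_◃_ : ∀ {m n} → Fin m × Fin n → Fin m × Fin n → Set
(i , j) ◃ (i′ , j′) = i′ Fin.< i ⊎ (i ≡ i′ × j Fin.< j′)

stackCrosses-cross : ∀ {m n} (t : Fin m → Fin n → Tile) → All (λ c → uncurry t c ≡ cross) (stackCrosses t)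
stackCrosses-cross {zero}  t = []
stackCrosses-cross {suc m} t = Allₚ.++⁺ (Allₚ.map⁺ (stackCrosses-cross (t ∘ suc)))
                                        (Allₚ.map⁺ (rowCrosses-cross (t zero)))

∈-stackCrosses : ∀ {m n} (t : Fin m → Fin n → Tile) i j → t i j ≡ cross → (i , j) ∈ stackCrosses t
∈-stackCrosses t zero    j eq = ∈-++⁺ʳ (map (map₁ suc) (stackCrosses (t ∘ suc)))
                                       (∈-map⁺ (zero ,_) (∈-rowCrosses (t zero) j eq))
∈-stackCrosses t (suc i) j eq = ∈-++⁺ˡ (∈-map⁺ (map₁ suc) (∈-stackCrosses (t ∘ suc) i j eq))

stackCrosses-sorted : ∀ {m n} (t : Fin m → Fin n → Tile) → AllPairs _◃_ (stackCrosses t)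
stackCrosses-sorted {zero}  t = []
stackCrosses-sorted {suc m} t = AllPairsₚ.++⁺
  (AllPairsₚ.map⁺ (AllPairs.map lift (stackCrosses-sorted (t ∘ suc))))
  (AllPairsₚ.map⁺ (AllPairs.map (λ lt → inj₂ (refl , lt)) (rowCrosses-sorted (t zero))))
  (Allₚ.map⁺ (All.tabulate λ _ → Allₚ.map⁺ (All.tabulate λ _ → inj₁ z<s)))
  where
  lift : ∀ {m n} {c d : Fin m × Fin n} → c ◃ d → map₁ suc c ◃ map₁ suc d
  lift (inj₁ lt)          = inj₁ (s<s lt)
  lift (inj₂ (refl , lt)) = inj₂ (refl , lt)

-- Labels of pipes

consᴹ : ∀ {A : Set} → Maybe A → List A → List A
consᴹ (just x) xs = x ∷ xs
consᴹ nothing  xs = xs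

justs : ∀ {A : Set} {m} → (Fin m → Maybe A) → List A
justs {m = zero}  f = []
justs {m = suc m} f = consᴹ (f zero) (justs (f ∘ suc))

consᴹ-++ : ∀ {A : Set} (x : Maybe A) ys zs → consᴹ x ys ++ zs ≡ consᴹ x (ys ++ zs)
consᴹ-++ (just x) ys zs = refl
consᴹ-++ nothing  ys zs = refl

justs-just : ∀ {A : Set} {m} {f : Fin m → Maybe A} {g} → (∀ i → f i ≡ just (g i)) → justs f ≡ tabulate g
justs-just {m = zero}  eq = refl
justs-just {m = suc m} eq rewrite eq zero = cong (_ ∷_) (justs-just (eq ∘ suc))

justs-nothing : ∀ {A : Set} {m} {f : Fin m → Maybe A} → (∀ i → f i ≡ nothing) → justs f ≡ []
justs-nothing {m = zero}  eq = refl
justs-nothing {m = suc m} eq rewrite eq zero = justs-nothing (eq ∘ suc)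

module _ {n} (ρ : Rule n) where

  rightOut-just : ∀ t l b → is-just l ≡ onLeft t → is-just b ≡ onBottom t →
                  is-just (rightOut ρ t l b) ≡ onRight t
  rightOut-just downElbow l b p q = q
  rightOut-just upElbow   l b p q = refl
  rightOut-just cross     (just x) (just y) p q = refl
  rightOut-just blank     l b p q = refl
  rightOut-just horiz     l b p q = p
  rightOut-just vert      l b p q = refl

  topOut-just : ∀ t l b → is-just l ≡ onLeft t → is-just b ≡ onBottom t →
                is-just (topOut ρ t l b) ≡ onTop t
  topOut-just downElbow l b p q = refl
  topOut-just upElbow   l b p q = p
  topOut-just cross     (just x) (just y) p q = refl
  topOut-just blank     l b p q = refl
  topOut-just horiz     l b p q = refl
  topOut-just vert      l b p q = q

  -- Only a cross carries two pipes. At any other tile at most one label enters and leaves, so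
  -- passing from the left and bottom edges to the top and right edges does not change the list.
  tile-run : ∀ t l b → is-just l ≡ onLeft t → is-just b ≡ onBottom t → ∀ pre rest as →
    run ρ (crossIf t (length pre) as) (pre ++ consᴹ l (consᴹ b rest)) ≡
    run ρ as (pre ++ consᴹ (topOut ρ t l b) (consᴹ (rightOut ρ t l b) rest))
  tile-run downElbow nothing  b        p q pre rest as = refl
  tile-run upElbow   l        nothing  p q pre rest as = refl
  tile-run cross     (just x) (just y) p q pre rest as = cong (run ρ as) (stepAt-length ρ pre x y rest)
  tile-run blank     nothing  nothing  p q pre rest as = refl
  tile-run horiz     l        nothing  p q pre rest as = refl
  tile-run vert      nothing  (just x) p q pre rest as = refl

  prefix-++ : (pre : List (Fin n)) (x : Maybe (Fin n)) → ∀ zs → (pre ++ consᴹ x []) ++ zs ≡ pre ++ consᴹ x zs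
  prefix-++ pre x zs = trans (++-assoc pre (consᴹ x []) zs) (cong (pre ++_) (consᴹ-++ x [] zs))

  length-prefix : ∀ (pre : List (Fin n)) x b → is-just x ≡ b → length (pre ++ consᴹ x []) ≡ bit b + length pre
  length-prefix pre (just x) true  eq = trans (length-++ pre) (ℕₚ.+-comm (length pre) 1)
  length-prefix pre nothing  false eq = trans (length-++ pre) (ℕₚ.+-identityʳ (length pre))

  RowLabelled : ∀ {m} → (Fin m → Tile) → (Fin m → Maybe (Fin n)) → Maybe (Fin n) → Set
  RowLabelled ts bs l = ∀ j → is-just (rowLefts ρ ts bs l j) ≡ onLeft (ts j) × is-just (bs j) ≡ onBottom (ts j)

  -- Induction along the row: `pre` grows by the labels that leave through the tops, which keeps its
  -- length equal to the letter of a cross at the next tile. `suf` stands for the exits of the rows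
  -- below.
  row-run : ∀ {m} (ts : Fin m → Tile) bs l → RowLabelled ts bs l → ∀ pre suf →
    run ρ (rowWord (length pre) ts) (pre ++ consᴹ l (justs bs ++ suf)) ≡
    pre ++ justs (λ j → topOut ρ (ts j) (rowLefts ρ ts bs l j) (bs j)) ++ consᴹ (rowExit ρ ts bs l) suf
  row-run {zero}  ts bs l ok pre suf = refl
  row-run {suc m} ts bs l ok pre suf = begin
    run ρ (crossIf t (length pre) as) (pre ++ consᴹ l (consᴹ b (justs bs′) ++ suf))
      ≡⟨ cong (λ zs → run ρ (crossIf t (length pre) as) (pre ++ consᴹ l zs)) (consᴹ-++ b _ suf) ⟩
    run ρ (crossIf t (length pre) as) (pre ++ consᴹ l (consᴹ b (justs bs′ ++ suf)))
      ≡⟨ tile-run t l b okl okb pre _ as ⟩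
    run ρ as (pre ++ consᴹ u (consᴹ r (justs bs′ ++ suf)))
      ≡⟨ cong₂ (λ k zs → run ρ (rowWord k (ts ∘ suc)) zs)
               (length-prefix pre u _ (topOut-just t l b okl okb)) (prefix-++ pre u _) ⟨
    run ρ (rowWord (length (pre ++ consᴹ u [])) (ts ∘ suc)) ((pre ++ consᴹ u []) ++ consᴹ r (justs bs′ ++ suf))
      ≡⟨ row-run (ts ∘ suc) bs′ r (ok ∘ suc) (pre ++ consᴹ u []) suf ⟩
    (pre ++ consᴹ u []) ++ justs us ++ x
      ≡⟨ prefix-++ pre u _ ⟩
    pre ++ consᴹ u (justs us ++ x)
      ≡⟨ cong (pre ++_) (consᴹ-++ u (justs us) x) ⟨
    pre ++ consᴹ u (justs us) ++ x ∎
    where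
    open ≡-Reasoning
    t = ts zero
    b = bs zero
    bs′ = bs ∘ suc
    u = topOut ρ t l b
    r = rightOut ρ t l b
    as = rowWord (bit (onTop t) + length pre) (ts ∘ suc)
    us = λ j → topOut ρ (ts (suc j)) (rowLefts ρ (ts ∘ suc) bs′ r j) (bs′ j)
    x = consᴹ (rowExit ρ ts bs l) suf
    okl = proj₁ (ok zero)
    okb = proj₂ (ok zero)

  rowLabelled : ∀ {m} (ts : Fin m → Tile) bs l →
    (∀ j k → toℕ k ≡ suc (toℕ j) → onRight (ts j) ≡ onLeft (ts k)) →
    (∀ j → toℕ j ≡ 0 → is-just l ≡ onLeft (ts j)) →
    (∀ j → is-just (bs j) ≡ onBottom (ts j)) → RowLabelled ts bs l
  rowLabelled ts bs l mH hl hb zero    = hl zero refl , hb zero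
  rowLabelled ts bs l mH hl hb (suc j) = rowLabelled (ts ∘ suc) (bs ∘ suc) _
    (λ j k eq → mH (suc j) (suc k) (cong suc eq))
    (λ k eq → trans (rightOut-just _ l (bs zero) (hl zero refl) (hb zero)) (mH zero (suc k) (cong suc eq)))
    (hb ∘ suc) j

  rowExit-just : ∀ {m} (ts : Fin (suc m) → Tile) bs l → RowLabelled ts bs l →
    ∀ e → (∀ j → toℕ j ≡ m → onRight (ts j) ≡ e) → is-just (rowExit ρ ts bs l) ≡ e
  rowExit-just {zero}  ts bs l ok e last = trans (rightOut-just _ l _ (proj₁ (ok zero)) (proj₂ (ok zero)))
      (last zero refl)
  rowExit-just {suc m} ts bs l ok e last =
    rowExit-just (ts ∘ suc) (bs ∘ suc) _ (ok ∘ suc) e (λ j eq → last (suc j) (cong suc eq))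

row-trace : ∀ {n m} (ts : Fin m → Tile) (bs : Fin m → Maybe (Fin n)) l → RowLabelled straight ts bs l →
  ∀ pre suf →
  trace (rowWord (length pre) ts) (pre ++ consᴹ l (justs bs ++ suf)) ≡
  map (λ j → zipWithᴹ _,_ (rowLefts straight ts bs l j) (bs j)) (rowCrosses ts)
row-trace {m = zero}  ts bs l ok pre suf = refl
row-trace {m = suc m} ts bs l ok pre suf = begin
  trace (crossIf t (length pre) as) (pre ++ consᴹ l (consᴹ b (justs bs′) ++ suf))
    ≡⟨ cong (λ zs → trace (crossIf t (length pre) as) (pre ++ consᴹ l zs)) (consᴹ-++ b _ suf) ⟩
  trace (crossIf t (length pre) as) (pre ++ consᴹ l (consᴹ b (justs bs′ ++ suf)))
    ≡⟨ tile-trace t l b okl okb (justs bs′ ++ suf) as ⟩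
  crossIf t lb (trace as (pre ++ consᴹ u (consᴹ r (justs bs′ ++ suf))))
    ≡⟨ cong (crossIf t lb) (cong₂ (λ k zs → trace (rowWord k (ts ∘ suc)) zs)
             (length-prefix straight pre u _ (topOut-just straight t l b okl okb))
                 (prefix-++ straight pre u _)) ⟨
  crossIf t lb (trace (rowWord (length (pre ++ consᴹ u [])) (ts ∘ suc))
      ((pre ++ consᴹ u []) ++ consᴹ r (justs bs′ ++ suf)))
    ≡⟨ cong (crossIf t lb) (row-trace (ts ∘ suc) bs′ r (ok ∘ suc) (pre ++ consᴹ u []) suf) ⟩
  crossIf t lb (map (lab ∘ suc) (rowCrosses (ts ∘ suc)))
    ≡⟨ cong (crossIf t lb) (map-∘ (rowCrosses (ts ∘ suc))) ⟩
  crossIf t lb (map lab (map suc (rowCrosses (ts ∘ suc))))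
    ≡⟨ map-crossIf lab t zero _ ⟨
  map lab (rowCrosses ts) ∎
  where
  open ≡-Reasoning
  t = ts zero
  b = bs zero
  bs′ = bs ∘ suc
  u = topOut straight t l b
  r = rightOut straight t l b
  lb = zipWithᴹ _,_ l b
  as = rowWord (bit (onTop t) + length pre) (ts ∘ suc)
  lab = λ j → zipWithᴹ _,_ (rowLefts straight ts bs l j) (bs j)
  okl = proj₁ (ok zero)
  okb = proj₂ (ok zero)
  tile-trace : ∀ t l b → is-just l ≡ onLeft t → is-just b ≡ onBottom t → ∀ rest as →
    trace (crossIf t (length pre) as) (pre ++ consᴹ l (consᴹ b rest)) ≡
    crossIf t (zipWithᴹ _,_ l b)
      (trace as (pre ++ consᴹ (topOut straight t l b) (consᴹ (rightOut straight t l b) rest)))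
  tile-trace downElbow nothing  b        p q rest as = refl
  tile-trace upElbow   l        nothing  p q rest as = refl
  tile-trace cross     (just x) (just y) p q rest as =
    cong₂ _∷_ (pairAt-length pre x y rest) (cong (trace as) (stepAt-length straight pre x y rest))
  tile-trace blank     nothing  nothing  p q rest as = refl
  tile-trace horiz     l        nothing  p q rest as = refl
  tile-trace vert      nothing  (just x) p q rest as = refl

-- The conditions on a BPD that survive the removal of its top row. Those on the top and right
-- boundaries enter only once the sweep is complete.
record Stack {m n} (t : Fin m → Fin n → Tile) : Set where
  field
    rows   : ∀ i j k → toℕ k ≡ suc (toℕ j) → onRight (t i j) ≡ onLeft (t i k)
    cols   : ∀ i k j → toℕ k ≡ suc (toℕ i) → onBottom (t i j) ≡ onTop (t k j)
    left   : ∀ i j → toℕ j ≡ 0 → onLeft (t i j) ≡ false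
    bottom : ∀ i j → suc (toℕ i) ≡ m → onBottom (t i j) ≡ true

tailStack : ∀ {m n} {t : Fin (suc m) → Fin n → Tile} → Stack t → Stack (t ∘ suc)
tailStack st = record
  { rows   = λ i → rows (suc i)
  ; cols   = λ i k j eq → cols (suc i) (suc k) j (cong suc eq)
  ; left   = λ i → left (suc i)
  ; bottom = λ i j eq → bottom (suc i) j (cong suc eq) }
  where open Stack st

bpdStack : ∀ {n} (P : BPD n) → Stack (curry (tile P))
bpdStack P = record { rows = matchH P ; cols = matchV P ; left = leftBoundary P ; bottom = bottomBoundary P }

module _ {n} (ρ : Rule n) where

  stackTops-just : ∀ {m} {t : Fin (suc m) → Fin n → Tile} → Stack t →
                   ∀ j → is-just (stackTops ρ (t ∘ suc) j) ≡ onBottom (t zero j)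
  stackTops-just {zero}  st j = sym (Stack.bottom st zero j refl)
  stackTops-just {suc m} {t} st j =
    trans (topOut-just ρ (t (suc zero) j) _ _ (proj₁ (ok j)) (proj₂ (ok j)))
        (sym (Stack.cols st zero (suc zero) j refl))
    where
    ok : RowLabelled ρ (t (suc zero)) (stackTops {m = m} ρ (λ i → t (suc (suc i)))) nothing
    ok = rowLabelled ρ _ _ _ (Stack.rows st (suc zero)) (λ j eq → sym (Stack.left st (suc zero) j eq))
                     (stackTops-just (tailStack st))

  stackLabelled : ∀ {m} {t : Fin m → Fin n → Tile} → Stack t → ∀ i →
                  RowLabelled ρ (t i) (stackBottoms ρ t i) nothing
  stackLabelled st zero    = rowLabelled ρ _ _ _ (Stack.rows st zero)
      (λ j eq → sym (Stack.left st zero j eq)) (stackTops-just st)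
  stackLabelled st (suc i) = stackLabelled (tailStack st) i

  stack-run : ∀ {m} {t : Fin m → Fin n → Tile} → Stack t →
    run ρ (stackWord t) (allFin n) ≡
    justs (stackTops ρ t) ++ justs (λ i → rowExit ρ (t i) (stackBottoms ρ t i) nothing)
  stack-run {zero}  st = sym (trans (++-identityʳ _) (justs-just λ _ → refl))
  stack-run {suc m} {t} st = begin
    run ρ (stackWord (t ∘ suc) ++ rowWord 0 (t zero)) (allFin n)
      ≡⟨ run-++ ρ (stackWord (t ∘ suc)) _ _ ⟩
    run ρ (rowWord 0 (t zero)) (run ρ (stackWord (t ∘ suc)) (allFin n))
      ≡⟨ cong (run ρ (rowWord 0 (t zero))) (stack-run (tailStack st)) ⟩
    run ρ (rowWord 0 (t zero)) (justs (stackTops ρ (t ∘ suc)) ++ _)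
      ≡⟨ row-run ρ (t zero) _ nothing (stackLabelled st zero) [] _ ⟩
    _ ∎
    where open ≡-Reasoning

stack-trace : ∀ {m n} {t : Fin m → Fin n → Tile} → Stack t →
  trace (stackWord t) (allFin n) ≡
  map (λ (i , j) → zipWithᴹ _,_ (rowLefts straight (t i) (stackBottoms straight t i) nothing j)
                                (stackBottoms straight t i j)) (stackCrosses t)
stack-trace {zero}  st = refl
stack-trace {suc m} {n} {t} st = begin
  trace (stackWord (t ∘ suc) ++ rowWord 0 (t zero)) (allFin n)
    ≡⟨ trace-++ (stackWord (t ∘ suc)) _ _ ⟩
  trace (stackWord (t ∘ suc)) (allFin n) ++ trace (rowWord 0 (t zero))
      (run straight (stackWord (t ∘ suc)) (allFin n))
    ≡⟨ cong₂ _++_ (trans (stack-trace (tailStack st)) (map-∘ (stackCrosses (t ∘ suc))))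
         (trans (cong (trace (rowWord 0 (t zero))) (stack-run straight (tailStack st)))
           (trans (row-trace (t zero) _ nothing (stackLabelled straight st zero) [] _)
               (map-∘ (rowCrosses (t zero))))) ⟩
  map _ (map (map₁ suc) (stackCrosses (t ∘ suc))) ++ map _ (map (zero ,_) (rowCrosses (t zero)))
    ≡⟨ map-++ _ (map (map₁ suc) (stackCrosses (t ∘ suc))) _ ⟨
  _ ∎
  where open ≡-Reasoning

-- The crossing word of a BPD and its reducedness

crossWord : ∀ {n} → BPD n → List ℕ
crossWord P = stackWord (curry (tile P))

crossCells : ∀ {n} → BPD n → List (Cell n)
crossCells P = stackCrosses (curry (tile P))

is-just⇒just : ∀ {A : Set} {x : Maybe A} → is-just x ≡ true → ∃ λ y → x ≡ just y
is-just⇒just {x = just y} eq = y , refl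

is-just⇒nothing : ∀ {A : Set} {x : Maybe A} → is-just x ≡ false → x ≡ nothing
is-just⇒nothing {x = nothing} eq = refl

AllPairs-lookup : ∀ {A : Set} {R : A → A → Set} {xs x y} → AllPairs R xs → x ∈ xs → y ∈ xs →
                  x ≡ y ⊎ (R x y ⊎ R y x)
AllPairs-lookup (r ∷ rs) (here refl) (here refl) = inj₁ refl
AllPairs-lookup (r ∷ rs) (here refl) (there q)   = inj₂ (inj₁ (All.lookup r q))
AllPairs-lookup (r ∷ rs) (there p)   (here refl) = inj₂ (inj₂ (All.lookup r p))
AllPairs-lookup (r ∷ rs) (there p)   (there q)   = AllPairs-lookup rs p q

module _ {m} (P : BPD (suc m)) where

  private
    n = suc m

  -- After the last row the top edges carry nothing and every right edge carries a label, so the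
  -- final list consists of the row labels alone.
  rowLabel-run : (ρ : Rule n) → ∃ λ (g : Fin n → Fin n) →
    (∀ i → rowLabel ρ P i ≡ just (g i)) × run ρ (crossWord P) (allFin n) ≡ tabulate g
  rowLabel-run ρ = proj₁ ∘ exits , proj₂ ∘ exits
    , trans (stack-run ρ (bpdStack P)) (cong₂ _++_ (justs-nothing tops) (justs-just (proj₂ ∘ exits)))
    where
    labelled = stackLabelled ρ (bpdStack P)
    exits : ∀ i → ∃ λ y → rowLabel ρ P i ≡ just y
    exits i = is-just⇒just (rowExit-just ρ _ _ nothing (labelled i) true
                             λ j eq → rightBoundary P i j (cong suc eq))
    tops : ∀ j → stackTops ρ (curry (tile P)) j ≡ nothing
    tops j = is-just⇒nothing (trans (topOut-just ρ _ _ _ (proj₁ (labelled zero j)) (proj₂ (labelled zero j)))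
                                    (topBoundary P zero j refl))

  pairLabel : Cell n → Maybe (Fin n × Fin n)
  pairLabel c = zipWithᴹ _,_ (fromLeft straight P c) (fromBelow straight P c)

  crossLabels : ∀ c → tile P c ≡ cross → ∃₂ λ p q →
                fromLeft straight P c ≡ just p × fromBelow straight P c ≡ just q
  crossLabels (i , j) eq =
    let p , eqp = is-just⇒just (trans (proj₁ (labelled i j)) (cong onLeft eq))
        q , eqq = is-just⇒just (trans (proj₂ (labelled i j)) (cong onBottom eq))
    in p , q , eqp , eqq
    where labelled = stackLabelled straight (bpdStack P)

  pairLabel⁻ : ∀ c {p q} → pairLabel c ≡ just (p , q) →
               fromLeft straight P c ≡ just p × fromBelow straight P c ≡ just q
  pairLabel⁻ c eq with fromLeft straight P c | fromBelow straight P c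
  pairLabel⁻ c refl | just p | just q = refl , refl

  pairLabel⁺ : ∀ c {p q} → fromLeft straight P c ≡ just p → fromBelow straight P c ≡ just q →
               pairLabel c ≡ just (p , q)
  pairLabel⁺ c eqp eqq = cong₂ (zipWithᴹ _,_) eqp eqq

  crossWord-trace : trace (crossWord P) (allFin n) ≡ map pairLabel (crossCells P)
  crossWord-trace = stack-trace (bpdStack P)

  -- Two entries of the trace with the same pair of pipes would belong to one cell by `Reduced`, yet
  -- the sweep order is irreflexive.
  reduced⇒reducedWord : Reduced P → ReducedWord n (crossWord P)
  reduced⇒reducedWord red = differ⇒reducedWord (crossWord P)
    (subst (All _) (sym crossWord-trace) (Allₚ.map⁺ (All.map labels crosses)))
    (subst (AllPairs Differ) (sym crossWord-trace)
      (AllPairsₚ.map⁺ (differ crosses (stackCrosses-sorted (curry (tile P))))))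
    where
    crosses : All (λ c → tile P c ≡ cross) (crossCells P)
    crosses = stackCrosses-cross (curry (tile P))
    labels : ∀ {c} → tile P c ≡ cross → ∃₂ λ p q → pairLabel c ≡ just (p , q)
    labels {c} eq = let p , q , eqp , eqq = crossLabels c eq in p , q , pairLabel⁺ c eqp eqq
    ◃-irrefl : ∀ (c : Cell n) → c ◃ c → ∀ {A : Set} → A
    ◃-irrefl c (inj₁ lt)       = contradiction lt (ℕₚ.<-irrefl refl)
    ◃-irrefl c (inj₂ (_ , lt)) = contradiction lt (ℕₚ.<-irrefl refl)
    differs : ∀ c d → tile P c ≡ cross → tile P d ≡ cross → c ◃ d → Differ (pairLabel c) (pairLabel d)
    differs c d x y lt {p} {q} eq =
        (λ eq′ → same (inj₁ (pairLabel⁻ d eq′)))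
      , (λ eq′ → same (inj₂ (pairLabel⁻ d eq′)))
      where
      same : (fromLeft straight P d ≡ just p × fromBelow straight P d ≡ just q) ⊎
             (fromLeft straight P d ≡ just q × fromBelow straight P d ≡ just p) → ∀ {A : Set} → A
      same eq′ with red p q c d (x , inj₁ (pairLabel⁻ c eq)) (y , eq′)
      ... | refl = ◃-irrefl c lt
    differ : ∀ {cs} → All (λ c → tile P c ≡ cross) cs → AllPairs _◃_ cs →
             AllPairs (λ c d → Differ (pairLabel c) (pairLabel d)) cs
    differ []       []         = []
    differ (x ∷ xs) (lt ∷ lts) = All.zipWith (λ (lt , y) {p} {q} → differs _ _ x y lt {p} {q}) (lt , xs) ∷
        differ xs lts

  meet : ∀ c d {p q} →
         (fromLeft straight P c ≡ just p × fromBelow straight P c ≡ just q) ⊎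
         (fromLeft straight P c ≡ just q × fromBelow straight P c ≡ just p) →
         (fromLeft straight P d ≡ just p × fromBelow straight P d ≡ just q) ⊎
         (fromLeft straight P d ≡ just q × fromBelow straight P d ≡ just p) →
         ¬ Differ (pairLabel c) (pairLabel d)
  meet c d (inj₁ (a , b)) (inj₁ (a′ , b′)) df = proj₁ (df (pairLabel⁺ c a b)) (pairLabel⁺ d a′ b′)
  meet c d (inj₁ (a , b)) (inj₂ (a′ , b′)) df = proj₂ (df (pairLabel⁺ c a b)) (pairLabel⁺ d a′ b′)
  meet c d (inj₂ (a , b)) (inj₁ (a′ , b′)) df = proj₂ (df (pairLabel⁺ c a b)) (pairLabel⁺ d a′ b′)
  meet c d (inj₂ (a , b)) (inj₂ (a′ , b′)) df = proj₁ (df (pairLabel⁺ c a b)) (pairLabel⁺ d a′ b′)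

  reducedWord⇒reduced : ReducedWord n (crossWord P) → Reduced P
  reducedWord⇒reduced red p q c d (x , lx) (y , ly)
    with AllPairs-lookup differ (∈-stackCrosses (curry (tile P)) _ _ x) (∈-stackCrosses (curry (tile P)) _ _ y)
    where
    differ : AllPairs (λ c d → Differ (pairLabel c) (pairLabel d)) (crossCells P)
    differ = AllPairsₚ.map⁻ (subst (AllPairs Differ) crossWord-trace
      (ascending⇒differ (crossWord P) (distinct-allFin n) (reducedWord⇒ascending (crossWord P) red)))
  ... | inj₁ eq = eq
  ... | inj₂ (inj₁ df) = ⊥-elim (meet c d lx ly df)
  ... | inj₂ (inj₂ df) = ⊥-elim (meet d c ly lx df)

  -- Along an ascending trace the Demazure rule lets the labels follow the pipes, so `∂ P` is the
  -- list of the straight run.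
  pipes⇔run : ReducedWord n (crossWord P) → (w : Permutation′ n) →
              Pipes w P ⇔ (run straight (crossWord P) (allFin n) ≡ tabulate (w ⟨$⟩ʳ_))
  pipes⇔run red w with rowLabel-run demazure
  ... | g , ∂≡g , run≡g = mk⇔
    (λ pipes → trans straight≡g (tabulate-cong {f = g} λ i → just-injective (trans (sym (∂≡g i)) (pipes i))))
    (λ eq i → trans (∂≡g i) (cong just (tabulate-injective {f = g} {g = w ⟨$⟩ʳ_}
        (trans (sym straight≡g) eq) i)))
    where
    straight≡g : run straight (crossWord P) (allFin n) ≡ tabulate g
    straight≡g = trans (sym (run-demazure (crossWord P) (allFin n)
        (reducedWord⇒ascending (crossWord P) red))) run≡g

-- Tilings of the quarter plane

record Tiling (t : ℕ → ℕ → Tile) : Set where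
  field
    rows : ∀ i j → onRight (t i j) ≡ onLeft (t i (suc j))
    cols : ∀ i j → onBottom (t i j) ≡ onTop (t (suc i) j)
    left : ∀ i → onLeft (t i 0) ≡ false
    top  : ∀ j → onTop (t 0 j) ≡ false

tops : (ℕ → Tile) → ℕ → ℕ
tops u zero    = 0
tops u (suc j) = tops u j + bit (onTop (u j))

-- The number of pipes separating the corner (i , j) from the northwest corner.
rank : (ℕ → ℕ → Tile) → ℕ → ℕ → ℕ
rank t i = tops (t i)

conservation : ∀ t → bit (onLeft t) + bit (onBottom t) ≡ bit (onTop t) + bit (onRight t)
conservation downElbow = refl
conservation upElbow   = refl
conservation cross     = refl
conservation blank     = refl
conservation horiz     = refl
conservation vert      = refl

bit≤1 : ∀ b → bit b ≤ 1
bit≤1 true  = ≤-refl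
bit≤1 false = z≤n

gain : Tile → ℕ
gain t = bit (onTop t) + bit (onRight t)

gain-two : ∀ t → 2 ≤ gain t → t ≡ cross
gain-two downElbow (s≤s ())
gain-two upElbow   (s≤s ())
gain-two cross     p = refl
gain-two horiz     (s≤s ())
gain-two vert      (s≤s ())

gain≤2 : ∀ t → gain t ≤ 2
gain≤2 t = ℕₚ.+-mono-≤ (bit≤1 (onTop t)) (bit≤1 (onRight t))

gain-zero : ∀ t → gain t ≤ 0 → t ≡ blank
gain-zero blank p = refl

gain-pos : ∀ t → t ≢ blank → 1 ≤ gain t
gain-pos downElbow p = ≤-refl
gain-pos upElbow   p = ≤-refl
gain-pos cross     p = s≤s z≤n
gain-pos blank     p = contradiction refl p
gain-pos horiz     p = ≤-refl
gain-pos vert      p = ≤-refl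

-- τ is a tableau extended by zero.  At the southeast corners of the cells
-- (a + t , b + t) after a blank (a , b), the rank is at most t until the paired
-- cross, at t = τ a b, is passed.
record Matches (r τ : ℕ → ℕ → ℕ) : Set where
  field
    ≤⇒rank : ∀ {a b t} → τ a b ≤ t → t < r (suc t + a) (suc t + b)
    rank⇒≤ : ∀ {a b t} → t < r (suc t + a) (suc t + b) → τ a b ≤ t

-- `pred` fits the extension by zero: a positive entry is smaller than its upper and left
-- neighbours, and to the right of and below a zero there are only zeros.
Decreasing : (ℕ → ℕ → ℕ) → Set
Decreasing τ = ∀ a b → τ (suc a) b ≤ pred (τ a b) × τ a (suc b) ≤ pred (τ a b)

module _ {t : ℕ → ℕ → Tile} (tl : Tiling t) where
  open Tiling tl

  -- `rank` is a count along a row. Each tile is left upward and to the right by as many pipes as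
  -- enter it from the left and from below, so ranks also change by the crossed edges along columns.
  rank-down : ∀ i j → rank t (suc i) j ≡ rank t i j + bit (onLeft (t i j))
  rank-down i zero rewrite left i = refl
  rank-down i (suc j) rewrite rank-down i j | sym (cols i j) | sym (rows i j) = begin
    rank t i j + bit (onLeft (t i j)) + bit (onBottom (t i j))   ≡⟨ +-assoc (rank t i j) _ _ ⟩
    rank t i j + (bit (onLeft (t i j)) + bit (onBottom (t i j)))
        ≡⟨ cong (rank t i j +_) (conservation (t i j)) ⟩
    rank t i j + gain (t i j)                                    ≡⟨ +-assoc (rank t i j) _ _ ⟨
    rank t i j + bit (onTop (t i j)) + bit (onRight (t i j)) ∎
    where open ≡-Reasoning

  rank-diagonal : ∀ i j → rank t (suc i) (suc j) ≡ rank t i j + gain (t i j)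
  rank-diagonal i j = trans (rank-down i (suc j))
    (trans (cong (λ b → rank t i (suc j) + bit b) (sym (rows i j))) (+-assoc (rank t i j) _ _))

  rank-zero : ∀ j → rank t 0 j ≡ 0
  rank-zero zero    = refl
  rank-zero (suc j) rewrite rank-zero j | top j = refl

  rank≤col : ∀ i j → rank t i j ≤ j
  rank≤col i zero    = z≤n
  rank≤col i (suc j) = ≤-trans (ℕₚ.+-mono-≤ (rank≤col i j) (bit≤1 _)) (≤-reflexive (+-comm j 1))

  rank≤row : ∀ i j → rank t i j ≤ i
  rank≤row zero    j = ≤-reflexive (rank-zero j)
  rank≤row (suc i) j = ≤-trans (≤-reflexive (rank-down i j))
    (≤-trans (ℕₚ.+-mono-≤ (rank≤row i j) (bit≤1 _)) (≤-reflexive (+-comm i 1)))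

  rank-down-≤ : ∀ i j → rank t i j ≤ rank t (suc i) j
  rank-down-≤ i j = ≤-trans (ℕₚ.m≤m+n _ _) (≤-reflexive (sym (rank-down i j)))

  rank-right-≤ : ∀ i j → rank t i j ≤ rank t i (suc j)
  rank-right-≤ i j = ℕₚ.m≤m+n _ _

  rank-down-≥ : ∀ i j → rank t (suc i) j ≤ suc (rank t i j)
  rank-down-≥ i j = ≤-trans (≤-reflexive (rank-down i j))
    (≤-trans (ℕₚ.+-monoʳ-≤ (rank t i j) (bit≤1 _)) (≤-reflexive (+-comm (rank t i j) 1)))

  rank-right-≥ : ∀ i j → rank t i (suc j) ≤ suc (rank t i j)
  rank-right-≥ i j =
    ≤-trans (ℕₚ.+-monoʳ-≤ (rank t i j) (bit≤1 _)) (≤-reflexive (+-comm (rank t i j) 1))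

  module _ {τ : ℕ → ℕ → ℕ} (mt : Matches (rank t) τ) where
    open Matches mt

    -- The entry of a neighbour is tested at a corner one edge away from a corner that tests
    -- `τ a b`. For a positive entry, tested at its own value, the rank loses at most one along that
    -- edge; for a zero entry the edge leads away from the origin and the rank does not drop.
    matches⇒decreasing : Decreasing τ
    matches⇒decreasing a b with τ a b in eq
    ... | zero  = rank⇒≤ (≤-trans (≤⇒rank (≤-reflexive eq)) (rank-down-≤ _ _))
                , rank⇒≤ (≤-trans (≤⇒rank (≤-reflexive eq)) (rank-right-≤ _ _))
    ... | suc s = rank⇒≤ (s≤s⁻¹ (≤-trans (subst (suc s <_)
        (cong (λ k → rank t k (suc (suc s + b))) (cong suc (sym (+-suc s a)))) lt) (rank-right-≥ _ _)))
                , rank⇒≤ (s≤s⁻¹ (≤-trans (subst (suc s <_)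
                    (cong (λ k → rank t (suc (suc s + a)) k) (cong suc (sym (+-suc s b)))) lt)
                    (rank-down-≥ _ _)))
      where
      lt : suc s < rank t (suc (suc s) + a) (suc (suc s) + b)
      lt = ≤⇒rank (≤-reflexive eq)

    -- A corner of rank `suc s` is at least `suc s` steps from both axes, so it tests some entry,
    -- which is at most `s`. The entry is then also at most `suc s`, which is the test at the next
    -- corner. Hence no blank follows on a diagonal once the rank is positive.
    rank-grows : ∀ i j → 0 < rank t i j → rank t i j < rank t (suc i) (suc j)
    rank-grows i j pos with rank t i j in eq
    ... | suc s with ℕₚ.m≤n⇒∃[o]m+o≡n (≤-trans (≤-reflexive (sym eq)) (rank≤row i j))
                   | ℕₚ.m≤n⇒∃[o]m+o≡n (≤-trans (≤-reflexive (sym eq)) (rank≤col i j))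
    ...   | a , refl | b , refl = ≤⇒rank (ℕₚ.m≤n⇒m≤1+n (rank⇒≤ (≤-reflexive (sym eq))))

    positive⇒rank : ∀ {a b} → 0 < τ a b → rank t (suc a) (suc b) ≡ 0
    positive⇒rank {a} {b} pos with rank t (suc a) (suc b) in eq
    ... | zero  = refl
    ... | suc _ = contradiction pos (ℕₚ.≤⇒≯ (rank⇒≤ (subst (0 <_) (sym eq) z<s)))

    rank-corner : ∀ i j → rank t i j ≤ rank t (suc i) (suc j)
    rank-corner i j = ≤-trans (rank-down-≤ i j) (rank-right-≤ (suc i) j)

    positive⇒blank : ∀ {a b} → 0 < τ a b → t a b ≡ blank
    positive⇒blank {a} {b} pos = gain-zero _ (≤-trans (ℕₚ.m≤n+m _ (rank t a b))
      (≤-reflexive (trans (sym (rank-diagonal a b)) (positive⇒rank pos))))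

    -- Were the entry zero, the rank at the southeast corner would be positive and, across a blank,
    -- equal to the rank at the northwest corner, against `rank-grows`.
    blank⇒positive : ∀ {a b} → t a b ≡ blank → 0 < τ a b
    blank⇒positive {a} {b} eq = ≰⇒> λ τ≤0 →
      let same = trans (rank-diagonal a b) (trans (cong (λ x → rank t a b + gain x) eq) (+-identityʳ _))
      in ℕₚ.<-irrefl (sym same) (rank-grows a b (subst (0 <_) same (≤⇒rank τ≤0)))

    rank⇒notBlank : ∀ {i j} → 0 < rank t i j → t i j ≢ blank
    rank⇒notBlank {i} {j} pos eq = ℕₚ.<-irrefl
      (sym (trans (rank-diagonal i j) (trans (cong (λ x → rank t i j + gain x) eq) (+-identityʳ _))))
      (rank-grows i j pos)

    -- The cross paired with the blank (a , b) is at (τ a b + a , τ a b + b).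
    partner-cross : ∀ {a b s} → τ a b ≡ suc s →
                    t (suc s + a) (suc s + b) ≡ cross × rank t (suc s + a) (suc s + b) ≡ s
    partner-cross {a} {b} {s} eq = gain-two _ two , ℕₚ.≤-antisym below above
      where
      i = suc s + a
      j = suc s + b
      below : rank t i j ≤ s
      below = ℕₚ.≮⇒≥ λ lt → ℕₚ.<-irrefl refl (subst (_≤ s) eq (rank⇒≤ lt))
      after : suc (suc s) ≤ rank t i j + gain (t i j)
      after = subst (suc s <_) (rank-diagonal i j) (≤⇒rank (≤-reflexive eq))
      above : s ≤ rank t i j
      above = ℕₚ.+-cancelʳ-≤ 2 s (rank t i j)
        (≤-trans (≤-reflexive (+-comm s 2)) (≤-trans after (ℕₚ.+-monoʳ-≤ (rank t i j) (gain≤2 (t i j)))))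
      two : 2 ≤ gain (t i j)
      two = ℕₚ.+-cancelˡ-≤ s 2 _ (≤-trans (≤-reflexive (+-comm s 2))
          (≤-trans after (ℕₚ.+-monoˡ-≤ (gain (t i j)) below)))

    -- With `s` the rank before the cross, the rank after it is `s + 2`, and the bound by row and
    -- column leaves room to walk `suc s` steps back to a cell `(a , b)`. The ranks before and after
    -- the cross are the tests of `τ a b` at `s` and at `suc s`: the first fails and the second
    -- succeeds.
    cross-partner : ∀ {i j} → t i j ≡ cross → ∃₂ λ a b →
                    τ a b ≡ suc (rank t i j) × i ≡ τ a b + a × j ≡ τ a b + b
    cross-partner {i} {j} eq
      with rank t i j in eqr
    ... | s
      with ℕₚ.m≤n⇒∃[o]m+o≡n (s≤s⁻¹ (subst (_≤ suc i)
          (trans (rank-diagonal i j) (trans (cong₂ (λ x y → x + gain y) eqr eq) (+-comm s 2)))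
          (rank≤row (suc i) (suc j))))
         | ℕₚ.m≤n⇒∃[o]m+o≡n (s≤s⁻¹ (subst (_≤ suc j)
             (trans (rank-diagonal i j) (trans (cong₂ (λ x y → x + gain y) eqr eq) (+-comm s 2)))
             (rank≤col (suc i) (suc j))))
    ... | a , refl | b , refl = a , b , τ≡ , cong (_+ a) (sym τ≡) , cong (_+ b) (sym τ≡)
      where
      after : rank t (suc (suc s) + a) (suc (suc s) + b) ≡ suc (suc s)
      after = trans (rank-diagonal _ _) (trans (cong₂ (λ x y → x + gain y) eqr eq) (+-comm s 2))
      τ≡ : τ a b ≡ suc s
      τ≡ = ℕₚ.≤-antisym (rank⇒≤ (≤-reflexive (sym after)))
             (≰⇒> λ le → ℕₚ.<-irrefl (sym eqr) (≤⇒rank le))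

matches-unique-τ : ∀ {r τ τ′} → Matches r τ → Matches r τ′ → ∀ a b → τ a b ≡ τ′ a b
matches-unique-τ m m′ a b = ℕₚ.≤-antisym (rank⇒≤ m (≤⇒rank m′ ≤-refl)) (rank⇒≤ m′ (≤⇒rank m ≤-refl))
  where open Matches

-- `Matches` speaks only of corners `(suc t + a , suc t + b)`. The bounds by row and column bring a
-- corner of rank `suc s` into this form with `t = s`.
matches-rank-≤ : ∀ {r r′ τ} → Matches r τ → Matches r′ τ → (∀ i j → r i j ≤ i) → (∀ i j → r i j ≤ j) →
                 ∀ i j → r i j ≤ r′ i j
matches-rank-≤ {r} m m′ ≤i ≤j i j with r i j in eq
... | zero = z≤n
... | suc s with ℕₚ.m≤n⇒∃[o]m+o≡n (subst (_≤ i) eq (≤i i j)) | ℕₚ.m≤n⇒∃[o]m+o≡n (subst (_≤ j) eq (≤j i j))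
...   | a , refl | b , refl = Matches.≤⇒rank m′ (Matches.rank⇒≤ m (≤-reflexive (sym eq)))

-- `k` is the default, returned when no smaller argument satisfies `Q`; this is why `least⇒` assumes
-- `Q k`.
least : {Q : ℕ → Set} → (∀ t → Dec (Q t)) → ℕ → ℕ
least Q? zero    = 0
least Q? (suc k) with Q? 0
... | yes _ = 0
... | no  _ = suc (least (Q? ∘ suc) k)

up-closed : ∀ {Q : ℕ → Set} → (∀ t → Q t → Q (suc t)) → Q 0 → ∀ t → Q t
up-closed up q zero    = q
up-closed up q (suc t) = up t (up-closed up q t)

least⇒ : ∀ {Q : ℕ → Set} (Q? : ∀ t → Dec (Q t)) → (∀ t → Q t → Q (suc t)) →
         ∀ k → Q k → ∀ {t} → least Q? k ≤ t → Q t
least⇒ Q? up zero    q le = up-closed up q _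
least⇒ Q? up (suc k) q {t} le with Q? 0
... | yes q₀ = up-closed up q₀ _
least⇒ Q? up (suc k) q {suc t} (s≤s le) | no _ = least⇒ (Q? ∘ suc) (up ∘ suc) k q le

⇒least : ∀ {Q : ℕ → Set} (Q? : ∀ t → Dec (Q t)) k → ∀ {t} → Q t → least Q? k ≤ t
⇒least Q? zero    q = z≤n
⇒least Q? (suc k) {t} q with Q? 0
... | yes _ = z≤n
⇒least Q? (suc k) {zero}  q | no ¬q = contradiction q ¬q
⇒least Q? (suc k) {suc t} q | no ¬q = s≤s (⇒least (Q? ∘ suc) k q)

-- The tableau of a tiling with blanks in the northwest

tableauOf : ℕ → (ℕ → ℕ → Tile) → ℕ → ℕ → ℕ
tableauOf N t a b = least (λ s → s <? rank t (suc s + a) (suc s + b)) N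

Outside : ℕ → (ℕ → ℕ → ℕ) → Set
Outside N r = ∀ i j → N ≤ i ⊎ N ≤ j → r i j ≡ i ⊓ j

module _ {N} {t : ℕ → ℕ → Tile} (tl : Tiling t) (out : Outside N (rank t))
         (closed : ∀ i j → t (suc i) (suc j) ≡ blank → t i j ≡ blank) where

  -- All cells northwest of a blank on its diagonal are blank, so the rank keeps the value zero that
  -- it has on the axes.
  blank⇒rank-zero : ∀ i j → t i j ≡ blank → rank t i j ≡ 0
  blank⇒rank-zero zero    j       eq = rank-zero tl j
  blank⇒rank-zero (suc i) zero    eq = refl
  blank⇒rank-zero (suc i) (suc j) eq = trans (rank-diagonal tl i j)
    (cong₂ _+_ (blank⇒rank-zero i j (closed i j eq)) (cong gain (closed i j eq)))

  rank-grows′ : ∀ i j → 0 < rank t i j → rank t i j < rank t (suc i) (suc j)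
  rank-grows′ i j pos = ≤-trans (≤-reflexive (+-comm 1 (rank t i j)))
    (≤-trans (ℕₚ.+-monoʳ-≤ (rank t i j) (gain-pos (t i j) λ eq → contradiction (blank⇒rank-zero i j eq)
        (ℕₚ.>⇒≢ pos)))
             (≤-reflexive (sym (rank-diagonal tl i j))))

  tableauOf-matches : Matches (rank t) (tableauOf N t)
  tableauOf-matches = record
    { ≤⇒rank = λ {a} {b} → least⇒ _ (λ s q → ≤-trans (s≤s q)
        (rank-grows′ (suc s + a) (suc s + b) (≤-trans z<s q))) N
        -- The search bound `N` suffices: the corner tested at `N` lies outside the square, where
        -- the rank is the smaller coordinate and exceeds `N`.
        (≤-trans (ℕₚ.⊓-glb (s≤s (ℕₚ.m≤m+n N a)) (s≤s (ℕₚ.m≤m+n N b)))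
                 (≤-reflexive (sym (out (suc N + a) (suc N + b) (inj₁ (ℕₚ.m≤n⇒m≤1+n (ℕₚ.m≤m+n N a)))))))
    ; rank⇒≤ = ⇒least _ N }

-- The tiling of a tableau

<-transfer : ∀ {x y} → (∀ {s} → s < x → s < y) → x ≤ y
<-transfer {zero}  f = z≤n
<-transfer {suc x} f = f ≤-refl

mkTile : (l t r b : Bool) → Tile
mkTile false false true  true  = downElbow
mkTile true  true  false false = upElbow
mkTile true  true  true  true  = cross
mkTile true  false true  false = horiz
mkTile false true  false true  = vert
mkTile _     _     _     _     = blank

Edges : Tile → (l t r b : Bool) → Set
Edges x l t r b = onLeft x ≡ l × onTop x ≡ t × onRight x ≡ r × onBottom x ≡ b

-- Conservation of pipes has exactly six solutions, one for each tile. It rules out the inconsistent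
-- patterns that `mkTile` sends to `blank` by default.
mkTile-edges : ∀ l t r b → bit l + bit b ≡ bit t + bit r → Edges (mkTile l t r b) l t r b
mkTile-edges false false false false eq = refl , refl , refl , refl
mkTile-edges false false true  true  eq = refl , refl , refl , refl
mkTile-edges true  true  false false eq = refl , refl , refl , refl
mkTile-edges true  true  true  true  eq = refl , refl , refl , refl
mkTile-edges true  false true  false eq = refl , refl , refl , refl
mkTile-edges false true  false true  eq = refl , refl , refl , refl

module FromTableau {m} (τ : ℕ → ℕ → ℕ) (dec : Decreasing τ) (bound : τ 0 0 ≤ m) where

  -- The condition that `Matches` imposes on `s < r i j`, with the tested cell `suc s` steps
  -- northwest of the corner. Where that walk would leave the quarter plane it has to fail, since a
  -- rank is at most either coordinate.
  Full : ℕ → ℕ → ℕ → Set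
  Full i j s = s < i × s < j × τ (i ∸ suc s) (j ∸ suc s) ≤ s

  full? : ∀ i j s → Dec (Full i j s)
  full? i j s = s <? i ×-dec s <? j ×-dec τ (i ∸ suc s) (j ∸ suc s) ≤? s

  dec₂ : ∀ a b → τ (suc a) (suc b) ≤ pred (pred (τ a b))
  dec₂ a b = ≤-trans (proj₂ (dec (suc a) b)) (ℕₚ.pred-mono-≤ (proj₁ (dec a b)))

  -- A step southeast along the diagonal lowers a positive entry, so lowering the threshold by one
  -- keeps the test true. `Full i j` thus holds on an initial segment, whose length is the rank.
  full-down : ∀ {i j} s → Full i j (suc s) → Full i j s
  full-down {suc (suc i)} {suc (suc j)} s (p , q , le) = ℕₚ.<⇒≤ p , ℕₚ.<⇒≤ q , le′
    where
    le′ : τ (suc i ∸ s) (suc j ∸ s) ≤ s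
    le′ rewrite ℕₚ.+-∸-assoc 1 (s≤s⁻¹ (s≤s⁻¹ p)) | ℕₚ.+-∸-assoc 1 (s≤s⁻¹ (s≤s⁻¹ q)) =
      ≤-trans (dec₂ (i ∸ s) (j ∸ s)) (≤-trans (ℕₚ.pred-mono-≤ (ℕₚ.pred-mono-≤ le)) (ℕₚ.pred[n]≤n {s}))
  full-down {suc zero} s (s≤s () , _)
  full-down {suc (suc i)} {suc zero} s (_ , s≤s () , _)

  abstract
    r : ℕ → ℕ → ℕ
    r i j = least (λ s → ¬? (full? i j s)) i

    <r⇒full : ∀ {i j s} → s < r i j → Full i j s
    <r⇒full {i} {j} {s} lt = decidable-stable (full? i j s) λ ¬f →
      contradiction lt (ℕₚ.≤⇒≯ (⇒least _ i ¬f))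

    full⇒<r : ∀ {i j s} → Full i j s → s < r i j
    full⇒<r {i} {j} {s} f = ≰⇒> λ le →
      least⇒ (λ s → ¬? (full? i j s)) (λ t ¬f f → ¬f (full-down t f)) i (λ f → ℕₚ.<-irrefl refl (proj₁ f)) le f

  r-matches : Matches r τ
  r-matches = record
    { ≤⇒rank = λ {a} {b} {t} le → full⇒<r (s≤s (ℕₚ.m≤m+n t a) , s≤s (ℕₚ.m≤m+n t b) ,
        subst₂ (λ x y → τ x y ≤ t) (sym (ℕₚ.m+n∸m≡n t a)) (sym (ℕₚ.m+n∸m≡n t b)) le)
    ; rank⇒≤ = λ {a} {b} {t} lt →
        subst₂ (λ x y → τ x y ≤ t) (ℕₚ.m+n∸m≡n t a) (ℕₚ.m+n∸m≡n t b) (proj₂ (proj₂ (<r⇒full lt))) }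
  open Matches r-matches

  r-split : ∀ {i j s} → s < r i j → ∃₂ λ a b → i ≡ suc s + a × j ≡ suc s + b × τ a b ≤ s
  r-split {i} {j} lt = let p , q , le = <r⇒full lt in
    _ , _ , sym (ℕₚ.m+[n∸m]≡n p) , sym (ℕₚ.m+[n∸m]≡n q) , le

  r≤row : ∀ i j → r i j ≤ i
  r≤row i j = <-transfer (proj₁ ∘ <r⇒full)

  r≤col : ∀ i j → r i j ≤ j
  r≤col i j = <-transfer (proj₁ ∘ proj₂ ∘ <r⇒full)

  r-down-≤ : ∀ i j → r i j ≤ r (suc i) j
  r-down-≤ i j = <-transfer λ {s} lt → case r-split lt of λ where
    (a , b , refl , refl , le) → subst (λ x → s < r x (suc s + b)) (cong suc (+-suc s a))
      (≤⇒rank (≤-trans (proj₁ (dec a b)) (≤-trans ℕₚ.pred[n]≤n le)))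

  r-right-≤ : ∀ i j → r i j ≤ r i (suc j)
  r-right-≤ i j = <-transfer λ {s} lt → case r-split lt of λ where
    (a , b , refl , refl , le) → subst (λ x → s < r (suc s + a) x) (cong suc (+-suc s b))
      (≤⇒rank (≤-trans (proj₂ (dec a b)) (≤-trans ℕₚ.pred[n]≤n le)))

  -- Raising the corner by one row and lowering the threshold by one moves the tested cell one
  -- column to the right. The bound on a vertical edge therefore comes from the decrease along rows.
  r-down-≥ : ∀ i j → r (suc i) j ≤ suc (r i j)
  r-down-≥ i j = <-transfer below
    where
    below : ∀ {s} → s < r (suc i) j → s < suc (r i j)
    below {zero}  lt = z<s
    below {suc s} lt with r-split lt
    ... | a , b , refl , refl , le = s≤s (subst (λ x → s < r (suc s + a) x) (cong suc (+-suc s b))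
      (≤⇒rank (≤-trans (proj₂ (dec a b)) (ℕₚ.pred-mono-≤ le))))

  r-right-≥ : ∀ i j → r i (suc j) ≤ suc (r i j)
  r-right-≥ i j = <-transfer below
    where
    below : ∀ {s} → s < r i (suc j) → s < suc (r i j)
    below {zero}  lt = z<s
    below {suc s} lt with r-split lt
    ... | a , b , refl , refl , le = s≤s (subst (λ x → s < r x (suc s + b)) (cong suc (+-suc s a))
      (≤⇒rank (≤-trans (proj₁ (dec a b)) (ℕₚ.pred-mono-≤ le))))

  τ≤row : ∀ a b → τ a b ≤ m ∸ a
  τ≤row zero    zero    = bound
  τ≤row zero    (suc b) = ≤-trans (proj₂ (dec zero b)) (≤-trans ℕₚ.pred[n]≤n (τ≤row zero b))
  τ≤row (suc a) b       = ≤-trans (proj₁ (dec a b))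
    (≤-trans (ℕₚ.pred-mono-≤ (τ≤row a b)) (≤-reflexive (ℕₚ.pred[m∸n]≡m∸[1+n] m a)))

  τ≤col : ∀ a b → τ a b ≤ m ∸ b
  τ≤col zero    zero    = bound
  τ≤col (suc a) zero    = ≤-trans (proj₁ (dec a zero)) (≤-trans ℕₚ.pred[n]≤n (τ≤col a zero))
  τ≤col a       (suc b) = ≤-trans (proj₂ (dec a b))
    (≤-trans (ℕₚ.pred-mono-≤ (τ≤col a b)) (≤-reflexive (ℕₚ.pred[m∸n]≡m∸[1+n] m b)))

  -- An entry in row `a` is at most `m ∸ a`, and similarly for columns. Outside the square every `s`
  -- below both coordinates therefore passes the test, which makes the rank as large as possible.
  r-outside : Outside (suc m) r
  r-outside i j out = ℕₚ.≤-antisym (ℕₚ.⊓-glb (r≤row i j) (r≤col i j))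
    (<-transfer λ {s} lt → full {s} (ℕₚ.m<n⊓o⇒m<n i j lt) (ℕₚ.m<n⊓o⇒m<o i j lt))
    where
    full : ∀ {s} → s < i → s < j → s < r i j
    full {s} p q with ℕₚ.m≤n⇒∃[o]m+o≡n p | ℕₚ.m≤n⇒∃[o]m+o≡n q
    ... | a , refl | b , refl = ≤⇒rank (case out of λ where
      (inj₁ le) → ≤-trans (τ≤row a b) (ℕₚ.m≤n+o⇒m∸n≤o m a (≤-trans (s≤s⁻¹ le) (≤-reflexive (+-comm s a))))
      (inj₂ le) → ≤-trans (τ≤col a b) (ℕₚ.m≤n+o⇒m∸n≤o m b (≤-trans (s≤s⁻¹ le) (≤-reflexive (+-comm s b)))))

  bit-< : ∀ {x y} → x ≤ y → y ≤ suc x → y ≡ x + bit (x <ᵇ y)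
  bit-< {zero}  {zero}      p q             = refl
  bit-< {zero}  {suc zero}  p q             = refl
  bit-< {zero}  {suc (suc y)} p (s≤s ())
  bit-< {suc x} {suc y}     (s≤s p) (s≤s q) = cong suc (bit-< p q)

  leftEdge topEdge : ℕ → ℕ → Bool
  leftEdge i j = r i j <ᵇ r (suc i) j
  topEdge  i j = r i j <ᵇ r i (suc j)

  leftEdge-bit : ∀ i j → r (suc i) j ≡ r i j + bit (leftEdge i j)
  leftEdge-bit i j = bit-< (r-down-≤ i j) (r-down-≥ i j)

  topEdge-bit : ∀ i j → r i (suc j) ≡ r i j + bit (topEdge i j)
  topEdge-bit i j = bit-< (r-right-≤ i j) (r-right-≥ i j)

  tiles : ℕ → ℕ → Tile
  tiles i j = mkTile (leftEdge i j) (topEdge i j) (leftEdge i (suc j)) (topEdge (suc i) j)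

  -- The two ways around a cell from its northwest to its southeast corner give the same change of
  -- `r`; this is the conservation of pipes that `mkTile-edges` asks for.
  tiles-edges : ∀ i j → Edges (tiles i j) (leftEdge i j) (topEdge i j) (leftEdge i (suc j)) (topEdge (suc i) j)
  tiles-edges i j = mkTile-edges _ _ _ _ (ℕₚ.+-cancelˡ-≡ (r i j) _ _ (begin
    r i j + (bit (leftEdge i j) + bit (topEdge (suc i) j)) ≡⟨ +-assoc (r i j) _ _ ⟨
    r i j + bit (leftEdge i j) + bit (topEdge (suc i) j)
        ≡⟨ cong (_+ bit (topEdge (suc i) j)) (leftEdge-bit i j) ⟨
    r (suc i) j + bit (topEdge (suc i) j)                  ≡⟨ topEdge-bit (suc i) j ⟨
    r (suc i) (suc j)                                      ≡⟨ leftEdge-bit i (suc j) ⟩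
    r i (suc j) + bit (leftEdge i (suc j))
        ≡⟨ cong (_+ bit (leftEdge i (suc j))) (topEdge-bit i j) ⟩
    r i j + bit (topEdge i j) + bit (leftEdge i (suc j))   ≡⟨ +-assoc (r i j) _ _ ⟩
    r i j + (bit (topEdge i j) + bit (leftEdge i (suc j))) ∎))
    where open ≡-Reasoning

  tiles-tiling : Tiling tiles
  tiles-tiling = record
    { rows = λ i j → trans (proj₁ (proj₂ (proj₂ (tiles-edges i j)))) (sym (proj₁ (tiles-edges i (suc j))))
    ; cols = λ i j → trans (proj₂ (proj₂ (proj₂ (tiles-edges i j))))
        (sym (proj₁ (proj₂ (tiles-edges (suc i) j))))
    ; left = λ i → trans (proj₁ (tiles-edges i 0))
        (cong₂ _<ᵇ_ (ℕₚ.n≤0⇒n≡0 (r≤col i 0)) (ℕₚ.n≤0⇒n≡0 (r≤col (suc i) 0)))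
    ; top  = λ j → trans (proj₁ (proj₂ (tiles-edges 0 j)))
        (cong₂ _<ᵇ_ (ℕₚ.n≤0⇒n≡0 (r≤row 0 j)) (ℕₚ.n≤0⇒n≡0 (r≤row 0 (suc j)))) }

  rank-tiles : ∀ i j → rank tiles i j ≡ r i j
  rank-tiles i zero    = sym (ℕₚ.n≤0⇒n≡0 (r≤col i 0))
  rank-tiles i (suc j) = trans
    (cong₂ (λ x y → x + bit y) (rank-tiles i j) (proj₁ (proj₂ (tiles-edges i j)))) (sym (topEdge-bit i j))

  bpd : BPD (suc m)
  bpd = record
    { tile = λ (i , j) → tiles (toℕ i) (toℕ j)
    ; matchH = λ i j k eq → trans (Tiling.rows tiles-tiling (toℕ i) (toℕ j))
        (cong (onLeft ∘ tiles (toℕ i)) (sym eq))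
    ; matchV = λ i k j eq → trans (Tiling.cols tiles-tiling (toℕ i) (toℕ j))
        (cong (λ x → onTop (tiles x (toℕ j))) (sym eq))
    ; leftBoundary = λ i j eq → trans (cong (onLeft ∘ tiles (toℕ i)) eq) (Tiling.left tiles-tiling (toℕ i))
    ; topBoundary = λ i j eq → trans (cong (λ x → onTop (tiles x (toℕ j))) eq) (Tiling.top tiles-tiling (toℕ j))
    -- On the right border the rank is the number of the row, so it grows along every boundary edge.
    -- The bottom border is symmetric.
    ; rightBoundary = λ i j eq → trans (proj₁ (proj₂ (proj₂ (tiles-edges (toℕ i) (toℕ j)))))
        (Equivalence.to T-≡ (ℕₚ.<⇒<ᵇ (≤-reflexive (trans
            (cong suc (at-right (toℕ i) eq (ℕₚ.<⇒≤ (toℕ<n i)))) (sym (at-right (suc (toℕ i)) eq (toℕ<n i)))))))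
    ; bottomBoundary = λ i j eq → trans (proj₂ (proj₂ (proj₂ (tiles-edges (toℕ i) (toℕ j)))))
        (Equivalence.to T-≡ (ℕₚ.<⇒<ᵇ (≤-reflexive (trans
            (cong suc (at-bottom (toℕ j) eq (ℕₚ.<⇒≤ (toℕ<n j))))
            (sym (at-bottom (suc (toℕ j)) eq (toℕ<n j))))))) }
    where
    at-right : ∀ i {j} → suc j ≡ suc m → i ≤ suc m → r i (suc j) ≡ i
    at-right i {j} eq le = trans (r-outside i (suc j) (inj₂ (≤-reflexive (sym eq))))
        (ℕₚ.m≤n⇒m⊓n≡m (≤-trans le (≤-reflexive (sym eq))))
    at-bottom : ∀ j {i} → suc i ≡ suc m → j ≤ suc m → r (suc i) j ≡ j
    at-bottom j {i} eq le = trans (r-outside (suc i) j (inj₁ (≤-reflexive (sym eq))))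
        (ℕₚ.m≥n⇒m⊓n≡n (≤-trans le (≤-reflexive (sym eq))))

-- A BPD extended to the quarter plane by the identity tiling

idTile : ℕ → ℕ → Tile
idTile zero    zero    = downElbow
idTile zero    (suc j) = horiz
idTile (suc i) zero    = vert
idTile (suc i) (suc j) = idTile i j

idTile-rows : ∀ i j → onRight (idTile i j) ≡ onLeft (idTile i (suc j))
idTile-rows zero    zero    = refl
idTile-rows zero    (suc j) = refl
idTile-rows (suc zero) zero = refl
idTile-rows (suc (suc i)) zero = refl
idTile-rows (suc i) (suc j) = idTile-rows i j

idTile-cols : ∀ i j → onBottom (idTile i j) ≡ onTop (idTile (suc i) j)
idTile-cols zero    zero    = refl
idTile-cols (suc i) zero    = refl
idTile-cols zero (suc zero) = refl
idTile-cols zero (suc (suc j)) = refl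
idTile-cols (suc i) (suc j) = idTile-cols i j

idTile-< : ∀ {i j} → i < j → idTile i j ≡ horiz
idTile-< {zero}  (s≤s p) = refl
idTile-< {suc i} (s≤s p) = idTile-< p

idTile-> : ∀ {i j} → j < i → idTile i j ≡ vert
idTile-> {j = zero}  (s≤s p) = refl
idTile-> {j = suc j} (s≤s p) = idTile-> p

idTile-notCross : ∀ i j → idTile i j ≢ cross
idTile-notCross zero    zero    ()
idTile-notCross zero    (suc j) ()
idTile-notCross (suc i) zero    ()
idTile-notCross (suc i) (suc j) = idTile-notCross i j

idTile-notBlank : ∀ i j → idTile i j ≢ blank
idTile-notBlank zero    zero    ()
idTile-notBlank zero    (suc j) ()
idTile-notBlank (suc i) zero    ()
idTile-notBlank (suc i) (suc j) = idTile-notBlank i j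

idTile-top : ∀ i j → i ⊓ suc j ≡ i ⊓ j + bit (onTop (idTile i j))
idTile-top zero    zero    = refl
idTile-top zero    (suc j) = refl
idTile-top (suc i) zero    = cong suc (ℕₚ.⊓-zeroʳ i)
idTile-top (suc i) (suc j) = cong suc (idTile-top i j)

idTile-left : ∀ i j → suc i ⊓ j ≡ i ⊓ j + bit (onLeft (idTile i j))
idTile-left zero    zero    = refl
idTile-left zero    (suc j) = refl
idTile-left (suc i) zero    = refl
idTile-left (suc i) (suc j) = cong suc (idTile-left i j)

module _ {n} (P : BPD n) where

  -- `idTile` is horizontal to the right of the grid and vertical below it, so it continues exactly
  -- the pipes that the boundary conditions supply.
  extend : ℕ → ℕ → Tile
  extend i j with i <? n | j <? n
  ... | yes i<n | yes j<n = tile P (fromℕ< i<n , fromℕ< j<n)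
  ... | yes _   | no _    = idTile i j
  ... | no _    | _       = idTile i j

  extend-in : ∀ {i j} (i<n : i < n) (j<n : j < n) → extend i j ≡ tile P (fromℕ< i<n , fromℕ< j<n)
  extend-in {i} {j} i<n j<n with i <? n | j <? n
  ... | yes _ | yes _ = refl
  ... | yes _ | no ¬p = contradiction j<n ¬p
  ... | no ¬p | _     = contradiction i<n ¬p

  extend-toℕ : ∀ i j → extend (toℕ i) (toℕ j) ≡ tile P (i , j)
  extend-toℕ i j = trans (extend-in (toℕ<n i) (toℕ<n j))
    (cong₂ (λ x y → tile P (x , y)) (fromℕ<-toℕ i _) (fromℕ<-toℕ j _))

  extend-out : ∀ {i j} → n ≤ i ⊎ n ≤ j → extend i j ≡ idTile i j
  extend-out {i} {j} out with i <? n | j <? n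
  ... | yes p | yes q = ⊥-elim (Sum.[ (λ le → ℕₚ.<⇒≱ p le) , (λ le → ℕₚ.<⇒≱ q le) ]′ out)
  ... | yes _ | no _  = refl
  ... | no _  | _     = refl

  cross-inside : ∀ {i j} → extend i j ≡ cross → i < n × j < n
  cross-inside {i} {j} eq = ≰⇒> (inside ∘ inj₁) , ≰⇒> (inside ∘ inj₂)
    where
    inside : ¬ (n ≤ i ⊎ n ≤ j)
    inside out = idTile-notCross i j (trans (sym (extend-out out)) eq)

  extend-rows : ∀ i j → onRight (extend i j) ≡ onLeft (extend i (suc j))
  extend-rows i j = go (i <? n) (j <? n) (suc j <? n)
    where
    beyond : n ≤ i ⊎ n ≤ j → onRight (extend i j) ≡ onLeft (extend i (suc j))
    beyond out = trans (cong onRight (extend-out out)) (trans (idTile-rows i j)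
      (cong onLeft (sym (extend-out (Sum.map₂ ℕₚ.m≤n⇒m≤1+n out)))))
    go : Dec (i < n) → Dec (j < n) → Dec (suc j < n) → onRight (extend i j) ≡ onLeft (extend i (suc j))
    go (yes p) (yes q) (yes q′) = trans (cong onRight (extend-in p q)) (trans
          (matchH P _ _ _ (trans (toℕ-fromℕ< q′) (cong suc (sym (toℕ-fromℕ< q)))))
              (cong onLeft (sym (extend-in p q′))))
    go (yes p) (yes q) (no ¬q′) = let sj≡n = ℕₚ.≤-antisym q (ℕₚ.≮⇒≥ ¬q′) in
          trans (trans (cong onRight (extend-in p q))
              (rightBoundary P _ _ (trans (cong suc (toℕ-fromℕ< q)) sj≡n)))
            (sym (cong onLeft (trans (extend-out (inj₂ (ℕₚ.≮⇒≥ ¬q′))) (idTile-< (subst (i <_) (sym sj≡n) p)))))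
    go (yes p) (no ¬q) _ = beyond (inj₂ (ℕₚ.≮⇒≥ ¬q))
    go (no ¬p) _ _ = beyond (inj₁ (ℕₚ.≮⇒≥ ¬p))

  extend-cols : ∀ i j → onBottom (extend i j) ≡ onTop (extend (suc i) j)
  extend-cols i j = go (j <? n) (i <? n) (suc i <? n)
    where
    beyond : n ≤ i ⊎ n ≤ j → onBottom (extend i j) ≡ onTop (extend (suc i) j)
    beyond out = trans (cong onBottom (extend-out out)) (trans (idTile-cols i j)
      (cong onTop (sym (extend-out (Sum.map₁ ℕₚ.m≤n⇒m≤1+n out)))))
    go : Dec (j < n) → Dec (i < n) → Dec (suc i < n) → onBottom (extend i j) ≡ onTop (extend (suc i) j)
    go (yes q) (yes p) (yes p′) = trans (cong onBottom (extend-in p q)) (trans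
          (matchV P _ _ _ (trans (toℕ-fromℕ< p′) (cong suc (sym (toℕ-fromℕ< p)))))
              (cong onTop (sym (extend-in p′ q))))
    go (yes q) (yes p) (no ¬p′) = let si≡n = ℕₚ.≤-antisym p (ℕₚ.≮⇒≥ ¬p′) in
          trans (trans (cong onBottom (extend-in p q))
              (bottomBoundary P _ _ (trans (cong suc (toℕ-fromℕ< p)) si≡n)))
            (sym (cong onTop (trans (extend-out (inj₁ (ℕₚ.≮⇒≥ ¬p′))) (idTile-> (subst (j <_) (sym si≡n) q)))))
    go (yes q) (no ¬p) _ = beyond (inj₁ (ℕₚ.≮⇒≥ ¬p))
    go (no ¬q) _ _ = beyond (inj₂ (ℕₚ.≮⇒≥ ¬q))

  extend-tiling : Tiling extend
  extend-tiling = record { rows = extend-rows ; cols = extend-cols ; left = left ; top = top }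
    where
    left : ∀ i → onLeft (extend i 0) ≡ false
    left i = go (i <? n) (0 <? n)
      where
      idTile-left₀ : ∀ i → onLeft (idTile i 0) ≡ false
      idTile-left₀ zero    = refl
      idTile-left₀ (suc i) = refl
      go : Dec (i < n) → Dec (0 < n) → onLeft (extend i 0) ≡ false
      go (yes p) (yes q) = trans (cong onLeft (extend-in p q)) (leftBoundary P _ _ (toℕ-fromℕ< q))
      go (yes p) (no ¬q) = contradiction (≤-trans z<s p) ¬q
      go (no ¬p) _ = trans (cong onLeft (extend-out (inj₁ (ℕₚ.≮⇒≥ ¬p)))) (idTile-left₀ i)
    top : ∀ j → onTop (extend 0 j) ≡ false
    top j = go (0 <? n) (j <? n)
      where
      idTile-top₀ : ∀ j → onTop (idTile 0 j) ≡ false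
      idTile-top₀ zero    = refl
      idTile-top₀ (suc j) = refl
      go : Dec (0 < n) → Dec (j < n) → onTop (extend 0 j) ≡ false
      go (yes p) (yes q) = trans (cong onTop (extend-in p q)) (topBoundary P _ _ (toℕ-fromℕ< p))
      go (no ¬p) (yes q) = contradiction (≤-trans z<s q) ¬p
      go _ (no ¬q) = trans (cong onTop (extend-out {0} {j} (inj₂ (ℕₚ.≮⇒≥ ¬q)))) (idTile-top₀ j)

  -- A row below the grid has only identity tiles, so the count along it applies. For a column to
  -- the right of the grid the induction runs down the column, because the row may start inside the
  -- grid.
  extend-outside : Outside n (rank extend)
  extend-outside i j (inj₁ n≤i) = go j
    where
    go : ∀ j → rank extend i j ≡ i ⊓ j
    go zero    = sym (ℕₚ.⊓-zeroʳ i)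
    go (suc j) = trans (cong₂ (λ x y → x + bit (onTop y)) (go j) (extend-out {i} {j} (inj₁ n≤i)))
        (sym (idTile-top i j))
  extend-outside i j (inj₂ n≤j) = go i
    where
    go : ∀ i → rank extend i j ≡ i ⊓ j
    go zero    = rank-zero extend-tiling j
    go (suc i) = trans (rank-down extend-tiling i j)
      (trans (cong₂ (λ x y → x + bit (onLeft y)) (go i) (extend-out {i} {j} (inj₂ n≤j)))
          (sym (idTile-left i j)))

-- Partitions and tableaux

part-antitone : ∀ {xs} → Linked _≥_ xs → ∀ i → part xs (suc i) ≤ part xs i
part-antitone []             i       = z≤n
part-antitone [-]            i       = z≤n
part-antitone (x≥y ∷ _)      zero    = x≥y
part-antitone (_   ∷ linked) (suc i) = part-antitone linked i

part-suc : ∀ μ i → part (parts μ) (suc i) ≤ part (parts μ) i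
part-suc μ = part-antitone (Partition.decreasing μ)

part≤first : ∀ μ i → part (parts μ) i ≤ part (parts μ) 0
part≤first μ zero    = ≤-refl
part≤first μ (suc i) = ≤-trans (part-suc μ i) (part≤first μ i)

part-length : ∀ xs {i j} → j < part xs i → i < length xs
part-length (x ∷ xs) {zero}  lt = z<s
part-length (x ∷ xs) {suc i} lt = s<s (part-length xs lt)

-- The order of the column reading word.
_▷_ : ℕ × ℕ → ℕ × ℕ → Set
(i , j) ▷ (i′ , j′) = j < j′ ⊎ (j ≡ j′ × i′ < i)

-- The order in which the sweep meets the crosses.
_◁_ : ℕ × ℕ → ℕ × ℕ → Set
(i , j) ◁ (i′ , j′) = i′ < i ⊎ (i ≡ i′ × j < j′)

suc≤ : ∀ {x y} → 0 < x → x ≤ pred y → suc x ≤ y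
suc≤ {y = zero}  pos le = contradiction (≤-trans pos le) λ ()
suc≤ {y = suc y} pos le = s≤s le

partner : (ℕ → ℕ → ℕ) → ℕ × ℕ → ℕ × ℕ
partner τ (a , b) = τ a b + a , τ a b + b

module _ {τ : ℕ → ℕ → ℕ} (dec : Decreasing τ) where

  decreasing-down : ∀ k {a b} → 0 < τ (k + a) b → k + τ (k + a) b ≤ τ a b
  decreasing-down zero    pos = ≤-refl
  decreasing-down (suc k) {a} {b} pos = ≤-trans (≤-reflexive (sym (+-suc k _)))
    (≤-trans (ℕₚ.+-monoʳ-≤ k step) (decreasing-down k (≤-trans z<s step)))
    where
    step : suc (τ (suc k + a) b) ≤ τ (k + a) b
    step = suc≤ pos (proj₁ (dec (k + a) b))

  decreasing-right : ∀ k {a b} → 0 < τ a (k + b) → k + τ a (k + b) ≤ τ a b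
  decreasing-right zero    pos = ≤-refl
  decreasing-right (suc k) {a} {b} pos = ≤-trans (≤-reflexive (sym (+-suc k _)))
    (≤-trans (ℕₚ.+-monoʳ-≤ k step) (decreasing-right k (≤-trans z<s step)))
    where
    step : suc (τ a (suc k + b)) ≤ τ a (k + b)
    step = suc≤ pos (proj₂ (dec a (k + b)))

  decreasing-down-< : ∀ {a a′ b} → 0 < τ a′ b → a < a′ → τ a′ b < τ a b
  decreasing-down-< {a} pos a<a′ with ℕₚ.m≤n⇒∃[o]m+o≡n a<a′
  ... | d , refl rewrite +-comm a d = ≤-trans (s≤s (ℕₚ.m≤n+m _ d)) (decreasing-down (suc d) pos)

  decreasing-right-< : ∀ {a b b′} → 0 < τ a b′ → b < b′ → τ a b′ < τ a b
  decreasing-right-< {b = b} pos b<b′ with ℕₚ.m≤n⇒∃[o]m+o≡n b<b′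
  ... | d , refl rewrite +-comm b d = ≤-trans (s≤s (ℕₚ.m≤n+m _ d)) (decreasing-right (suc d) pos)

  private
    gap : ∀ {x y p q} → x + p < y + q → q < p → suc x < y
    gap {x} {y} {p} {q} lt q<p = ℕₚ.+-cancelʳ-< q (suc x) y
      (ℕₚ.≤-<-trans (≤-trans (≤-reflexive (sym (+-suc x q))) (ℕₚ.+-monoʳ-≤ x q<p)) lt)

  -- If the partners are ordered strictly one way in rows or columns and the cells strictly the
  -- other way, the entries differ by at least two; this is `gap`. The other configurations are
  -- contradictory. In particular, if `c` is weakly southeast of `d`, entries drop at least as fast
  -- as coordinates grow, and the partner of `c` is no lower than that of `d`.
  orders-far : ∀ {c d} → 0 < uncurry τ c → 0 < uncurry τ d → partner τ c ◁ partner τ d → d ▷ c →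
               Far (uncurry τ c) (uncurry τ d)
  orders-far pc pd (inj₁ lt) (inj₂ (refl , i<i′)) = inj₂ (gap lt i<i′)
  orders-far {i , j} {i′ , j′} pc pd (inj₂ (eq , lt)) (inj₂ (refl , i<i′)) =
    contradiction eq (ℕₚ.<⇒≢ (ℕₚ.+-mono-< (ℕₚ.+-cancelʳ-< j _ _ lt) i<i′))
  orders-far {i , j} {i′ , j′} pc pd (inj₂ (eq , lt)) (inj₁ j′<j) = inj₁ (gap lt j′<j)
  orders-far {i , j} {i′ , j′} pc pd (inj₁ lt) (inj₁ j′<j) = case i <? i′ of λ where
      (yes i<i′) → inj₂ (gap lt i<i′)
      (no i≮i′)  → contradiction lt (ℕₚ.≤⇒≯ (below (ℕₚ.m≤n⇒∃[o]m+o≡n (ℕₚ.≮⇒≥ i≮i′))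
          (ℕₚ.m≤n⇒∃[o]m+o≡n (ℕₚ.<⇒≤ j′<j))))
    where
    below : (∃ λ k → i′ + k ≡ i) → (∃ λ l → j′ + l ≡ j) → τ i j + i ≤ τ i′ j′ + i′
    below (k , refl) (l , refl) rewrite +-comm i′ k | +-comm j′ l = begin
      τ (k + i′) (l + j′) + (k + i′) ≡⟨ +-assoc (τ (k + i′) (l + j′)) k i′ ⟨
      τ (k + i′) (l + j′) + k + i′   ≡⟨ cong (_+ i′) (+-comm _ k) ⟩
      k + τ (k + i′) (l + j′) + i′   ≤⟨ ℕₚ.+-monoˡ-≤ i′ down ⟩
      τ i′ (l + j′) + i′             ≤⟨ ℕₚ.+-monoˡ-≤ i′
          (≤-trans (ℕₚ.m≤n+m _ l) (decreasing-right l (≤-trans pc (≤-trans (ℕₚ.m≤n+m _ k) down)))) ⟩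
      τ i′ j′ + i′                   ∎
      where
      open ℕₚ.≤-Reasoning
      down = decreasing-down k {i′} {l + j′} pc

module _ (T : DecreasingTableau) where

  private
    μ = parts (shape T)

  extendᵗ : ℕ → ℕ → ℕ
  extendᵗ i j = fromMaybe 0 (DecreasingTableau.entry? T i j)

  entry?-in : ∀ {i j} (p : j < part μ i) → DecreasingTableau.entry? T i j ≡ just (entry T i j p)
  entry?-in {i} {j} p with j <? part μ i
  ... | yes _ = refl
  ... | no ¬p = contradiction p ¬p

  entry?-out : ∀ {i j} → ¬ j < part μ i → DecreasingTableau.entry? T i j ≡ nothing
  entry?-out {i} {j} ¬p with j <? part μ i
  ... | yes p = contradiction p ¬p
  ... | no _  = refl

  extendᵗ-in : ∀ {i j} (p : j < part μ i) → extendᵗ i j ≡ entry T i j p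
  extendᵗ-in p = cong (fromMaybe 0) (entry?-in p)

  extendᵗ-out : ∀ {i j} → ¬ j < part μ i → extendᵗ i j ≡ 0
  extendᵗ-out ¬p = cong (fromMaybe 0) (entry?-out ¬p)

  in⇒positive : ∀ {i j} → j < part μ i → 0 < extendᵗ i j
  in⇒positive p = subst (0 <_) (sym (extendᵗ-in p)) (DecreasingTableau.entry-positive T _ _ p)

  positive⇒in : ∀ {i j} → 0 < extendᵗ i j → j < part μ i
  positive⇒in {i} {j} pos with j <? part μ i
  ... | yes p = p
  positive⇒in () | no _

  extendᵗ-decreasing : Decreasing extendᵗ
  extendᵗ-decreasing a b = down , right
    where
    down : extendᵗ (suc a) b ≤ pred (extendᵗ a b)
    down = case b <? part μ (suc a) of λ where
      (no ¬p) → ≤-trans (≤-reflexive (extendᵗ-out ¬p)) z≤n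
      (yes p) → let q = ≤-trans p (part-suc (shape T) a) in
        subst₂ (λ x y → x ≤ pred y) (sym (extendᵗ-in p)) (sym (extendᵗ-in q))
          (ℕₚ.pred-mono-≤ (DecreasingTableau.columns-decrease T a (suc a) b q p ≤-refl))
    right : extendᵗ a (suc b) ≤ pred (extendᵗ a b)
    right = case suc b <? part μ a of λ where
      (no ¬p) → ≤-trans (≤-reflexive (extendᵗ-out ¬p)) z≤n
      (yes p) → let q = ℕₚ.<⇒≤ p in
        subst₂ (λ x y → x ≤ pred y) (sym (extendᵗ-in p)) (sym (extendᵗ-in q))
          (ℕₚ.pred-mono-≤ (DecreasingTableau.rows-decrease T a b (suc b) q p ≤-refl))

  column : ℕ → List ℕ
  column j = filter (λ i → j <? part μ i) (downFrom (length μ))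

  columnCells : List (ℕ × ℕ)
  columnCells = concatMap (λ j → map (_, j) (column j)) (upTo (part μ 0))

  columnWord-cells : columnWord T ≡ map (uncurry extendᵗ) columnCells
  columnWord-cells = trans
    (concatMap-cong (λ j → trans (each j (downFrom (length μ))) (map-∘ (column j))) (upTo (part μ 0)))
    (sym (map-concatMap (uncurry extendᵗ) _ (upTo (part μ 0))))
    where
    each : ∀ j is → mapMaybe (λ i → DecreasingTableau.entry? T i j) is ≡
                    map (λ i → extendᵗ i j) (filter (λ i → j <? part μ i) is)
    each j [] = refl
    each j (i ∷ is) = go (j <? part μ i)
      where
      go : Dec (j < part μ i) → mapMaybe (λ i → DecreasingTableau.entry? T i j) (i ∷ is) ≡
           map (λ i → extendᵗ i j) (filter (λ i → j <? part μ i) (i ∷ is))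
      go (yes p) rewrite filter-accept (λ i → j <? part μ i) {i} {is} p | entry?-in p = cong (_ ∷_) (each j is)
      go (no ¬p) rewrite filter-reject (λ i → j <? part μ i) {i} {is} ¬p | entry?-out ¬p = each j is

  ∈-columnCells⁺ : ∀ {i j} → j < part μ i → (i , j) ∈ columnCells
  ∈-columnCells⁺ {i} {j} p = ∈-concat⁺′
    (∈-map⁺ (_, j) (∈-filter⁺ (λ i → j <? part μ i) (∈-downFrom⁺ (part-length μ p)) p))
    (∈-map⁺ (λ j → map (_, j) (column j)) (∈-upTo⁺ (≤-trans p (part≤first (shape T) i))))

  ∈-columnCells⁻ : ∀ {i j} → (i , j) ∈ columnCells → j < part μ i
  ∈-columnCells⁻ p with ∈-concat⁻′ (map (λ j → map (_, j) (column j)) (upTo (part μ 0))) p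
  ... | _ , q , q′ with ∈-map⁻ (λ j → map (_, j) (column j)) q′
  ... | j , _ , refl with ∈-map⁻ (_, j) q
  ... | i , q″ , refl = proj₂ (∈-filter⁻ (λ i → j <? part μ i) {xs = downFrom (length μ)} q″)

  columnCells-sorted : AllPairs _▷_ columnCells
  columnCells-sorted = AllPairsₚ.concat⁺
    (Allₚ.map⁺ (All.universal (λ j → AllPairsₚ.map⁺ (AllPairs.map (λ lt → inj₂ (refl , lt))
      (AllPairsₚ.filter⁺ _ (AllPairsₚ.applyDownFrom⁺₁ id (length μ) λ lt _ → lt)))) _))
    (AllPairsₚ.map⁺ (AllPairs.map (λ lt → Allₚ.map⁺
        (All.universal (λ _ → Allₚ.map⁺ (All.universal (λ _ → inj₁ lt) _)) _))
      (AllPairsₚ.applyUpTo⁺₁ id (part μ 0) λ lt _ → lt)))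

-- The crossing word and the column reading word

tops-front : ∀ u j → tops u (suc j) ≡ bit (onTop (u 0)) + tops (u ∘ suc) j
tops-front u zero    = sym (+-identityʳ _)
tops-front u (suc j) = trans (cong (_+ bit (onTop (u (suc j)))) (tops-front u j))
    (+-assoc (bit (onTop (u 0))) _ _)

topsBefore-tops : ∀ {m} (ts : Fin m → Tile) u → (∀ j → u (toℕ j) ≡ ts j) →
    ∀ j → topsBefore ts j ≡ tops u (toℕ j)
topsBefore-tops ts u eq zero    = refl
topsBefore-tops ts u eq (suc j) = trans
  (cong₂ (λ x y → bit (onTop x) + y) (sym (eq zero)) (topsBefore-tops (ts ∘ suc) (u ∘ suc) (eq ∘ suc) j))
  (sym (tops-front u (toℕ j)))

coordinates : ∀ {n} → Cell n → ℕ × ℕ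
coordinates (i , j) = toℕ i , toℕ j

module Correspondence {m} (P : BPD (suc m)) (T : DecreasingTableau)
                      (mt : Matches (rank (extend P)) (extendᵗ T)) where

  private
    n = suc m
    τ = extendᵗ T
    tl = extend-tiling P
    letter = uncurry (rank (extend P))
    crosses = map coordinates (crossCells P)
    partners = map (partner τ) (columnCells T)

  crossWord-letters : crossWord P ≡ map letter crosses
  crossWord-letters = trans (stackWord-letters (curry (tile P)))
    (trans (map-cong (λ (i , j) → topsBefore-tops _ (extend P (toℕ i)) (extend-toℕ P i) j) (crossCells P))
           (map-∘ (crossCells P)))

  crosses-sorted : AllPairs _◁_ crosses
  crosses-sorted = AllPairsₚ.map⁺ (AllPairs.map (λ where
    (inj₁ lt) → inj₁ lt
    (inj₂ (eq , lt)) → inj₂ (cong toℕ eq , lt)) (stackCrosses-sorted (curry (tile P))))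

  ∈-crosses⁺ : ∀ {i j} → extend P i j ≡ cross → (i , j) ∈ crosses
  ∈-crosses⁺ {i} {j} eq = subst (_∈ crosses) (cong₂ _,_ (toℕ-fromℕ< i<n) (toℕ-fromℕ< j<n))
    (∈-map⁺ coordinates (∈-stackCrosses (curry (tile P)) (fromℕ< i<n) (fromℕ< j<n)
        (trans (sym (extend-in P i<n j<n)) eq)))
    where
    i<n = proj₁ (cross-inside P {i} {j} eq)
    j<n = proj₂ (cross-inside P {i} {j} eq)

  ∈-crosses⁻ : ∀ {i j} → (i , j) ∈ crosses → extend P i j ≡ cross
  ∈-crosses⁻ p with ∈-map⁻ coordinates p
  ... | (i , j) , q , refl = trans (extend-toℕ P i j) (All.lookup (stackCrosses-cross (curry (tile P))) q)

  letter-partner : ∀ {c} → 0 < uncurry τ c → suc (letter (partner τ c)) ≡ uncurry τ c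
  letter-partner {a , b} pos with τ a b in eq
  ... | suc s = cong suc (proj₂ (partner-cross tl mt eq))

  columnCells-positive : ∀ {c} → c ∈ columnCells T → 0 < uncurry τ c
  columnCells-positive p = in⇒positive T (∈-columnCells⁻ T p)

  ⊆-partners : ∀ {c} → c ∈ crosses → c ∈ partners
  ⊆-partners {i , j} p with cross-partner tl mt (∈-crosses⁻ p)
  ... | a , b , eq , eqi , eqj = subst (_∈ partners) (cong₂ _,_ (sym eqi) (sym eqj))
    (∈-map⁺ (partner τ) (∈-columnCells⁺ T (positive⇒in T (subst (0 <_) (sym eq) z<s))))

  partner-isCross : ∀ {a b} → 0 < τ a b → extend P (τ a b + a) (τ a b + b) ≡ cross
  partner-isCross {a} {b} pos with τ a b in eq
  ... | suc s = proj₁ (partner-cross tl mt eq)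

  ⊇-partners : ∀ {c} → c ∈ partners → c ∈ crosses
  ⊇-partners p with ∈-map⁻ (partner τ) p
  ... | c , q , refl = ∈-crosses⁺ (partner-isCross (columnCells-positive q))

  -- The column order of the blanks, carried over to their partners, so that both readings list the
  -- same set of crosses.
  data Read : ℕ × ℕ → ℕ × ℕ → Set where
    read : ∀ {c d} → 0 < uncurry τ c → 0 < uncurry τ d → c ▷ d → Read (partner τ c) (partner τ d)

  -- A cross determines its blank: the letter gives the entry, and subtracting the entry from both
  -- coordinates gives the cell.
  read-irrefl : ∀ {x y} → Read x y → x ≢ y
  read-irrefl (read {a , b} {a′ , b′} pc pd ▷cd) eq
    with trans (sym (letter-partner pc)) (trans (cong (suc ∘ letter) eq) (letter-partner pd))
  ... | same with ℕₚ.+-cancelˡ-≡ (τ a b) a a′ (trans (cong proj₁ eq) (cong (_+ a′) (sym same)))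
                | ℕₚ.+-cancelˡ-≡ (τ a b) b b′ (trans (cong proj₂ eq) (cong (_+ b′) (sym same)))
  ... | refl | refl = case ▷cd of λ where
    (inj₁ lt)       → ℕₚ.<-irrefl refl lt
    (inj₂ (_ , lt)) → ℕₚ.<-irrefl refl lt

  partners-sorted : AllPairs Read partners
  partners-sorted = AllPairsₚ.map⁺ (go (All.tabulate columnCells-positive) (columnCells-sorted T))
    where
    go : ∀ {cs} → All (λ c → 0 < uncurry τ c) cs → AllPairs _▷_ cs →
         AllPairs (λ c d → Read (partner τ c) (partner τ d)) cs
    go []         []         = []
    go (p ∷ ps) (lt ∷ lts) = All.zipWith (λ (lt , q) → read p q lt) (lt , ps) ∷ go ps lts

  read-far : ∀ {x y} → x ◁ y → Read y x → Far (letter x) (letter y)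
  read-far ◁xy (read pd pc ▷dc) = Sum.map s≤s⁻¹ s≤s⁻¹
    (subst₂ Far (sym (letter-partner pc)) (sym (letter-partner pd))
      (orders-far (extendᵗ-decreasing T) pc pd ◁xy ▷dc))

  ◁-irrefl : ∀ {x} → ¬ x ◁ x
  ◁-irrefl (inj₁ lt)       = ℕₚ.<-irrefl refl lt
  ◁-irrefl (inj₂ (_ , lt)) = ℕₚ.<-irrefl refl lt

  reordered : length crosses ≡ length partners ×
    (∀ {k} (zs : List (Fin k)) → run straight (map letter crosses) zs ≡ run straight (map letter partners) zs)
  reordered = reorder letter _◁_ Read ◁-irrefl (λ r → read-irrefl r refl) read-far
    crosses partners crosses-sorted partners-sorted ⊆-partners ⊇-partners

  letters-of-columns : List ℕ
  letters-of-columns = map letter partners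

  columnWord-letters : columnWord T ≡ map suc letters-of-columns
  columnWord-letters = trans (columnWord-cells T) (trans
    (map-cong-local (All.tabulate λ p → sym (letter-partner (columnCells-positive p))))
    (trans (map-∘ (columnCells T)) (map-∘ partners)))

  same-run : run straight (crossWord P) (allFin n) ≡ run straight letters-of-columns (allFin n)
  same-run = trans (cong (λ as → run straight as (allFin n)) crossWord-letters) (proj₂ reordered (allFin n))

  same-length : length (crossWord P) ≡ length letters-of-columns
  same-length = trans (cong length crossWord-letters)
    (trans (length-map letter crosses) (trans (proj₁ reordered) (sym (length-map letter partners))))

  reducedWord⇒ : ReducedWord n (crossWord P) → ReducedWord n letters-of-columns
  reducedWord⇒ red = trans (cong inversions (sym same-run)) (trans red same-length)

  reducedWord⇐ : ReducedWord n letters-of-columns → ReducedWord n (crossWord P)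
  reducedWord⇐ red = trans (cong inversions same-run) (trans red (sym same-length))

  -- At `t = m` the tested corner is already outside the square, where its rank is at least `suc m`.
  τ≤m : ∀ a b → τ a b ≤ m
  τ≤m a b = Matches.rank⇒≤ mt (≤-trans (ℕₚ.⊓-glb (ℕₚ.m≤m+n n a) (ℕₚ.m≤m+n n b))
    (≤-reflexive (sym (extend-outside P (n + a) (n + b) (inj₁ (ℕₚ.m≤m+n n a))))))

  letters<m : All (_< m) letters-of-columns
  letters<m = Allₚ.map⁺ (Allₚ.map⁺ (All.tabulate λ {(a , b)} p →
    ≤-trans (≤-reflexive (letter-partner (columnCells-positive p))) (τ≤m a b)))

  reducedWordFor⇒reduced : ∀ {w} → ReducedWordFor (columnWord T) w → Reduced P
  reducedWordFor⇒reduced {w} rw = reducedWord⇒reduced P (reducedWord⇐ (proj₁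
    (reducedWordFor⁻ letters-of-columns w (subst (λ u → ReducedWordFor u w) columnWord-letters rw))))

  pipes⇔reducedWordFor : Reduced P → (w : Permutation′ n) → Pipes w P ⇔ ReducedWordFor (columnWord T) w
  pipes⇔reducedWordFor red w = mk⇔
    (λ pipes → subst (λ u → ReducedWordFor u w) (sym columnWord-letters)
      (reducedWordFor⁺ letters-of-columns letters<m w (reducedWord⇒ rw)
        (trans (sym same-run) (Equivalence.to (pipes⇔run P rw w) pipes))))
    (λ rwf → Equivalence.from (pipes⇔run P rw w) (trans same-run (proj₂
      (reducedWordFor⁻ letters-of-columns w (subst (λ u → ReducedWordFor u w) columnWord-letters rwf)))))
    where
    rw : ReducedWord n (crossWord P)
    rw = reduced⇒reducedWord P red

  isRWT : Reduced P → IsRWT m T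
  isRWT red = record
    { bounded = λ i j p → recompute (entry T i j p ≤? m) (subst (_≤ m) (extendᵗ-in T p) (τ≤m i j))
    ; reduced = w , subst (λ u → ReducedWordFor u w) (sym columnWord-letters)
        (reducedWordFor⁺ letters-of-columns letters<m w (reducedWord⇒ (reduced⇒reducedWord P red))
          (run-letters letters-of-columns letters<m)) }
    where
    w : Permutation′ n
    w = wordProduct (letters letters-of-columns letters<m)

⊖-cross : ∀ i j k l → i ⊖ j ≡ k ⊖ l → i + l ≡ k + j
⊖-cross i j k l eq = ℤₚ.+-injective (trans (sym (shift i j l)) (trans
  (cong₂ (λ x y → x +ᶻ fromℕ y) eq (+-comm j l)) (shift k l j)))
  where
  shift : ∀ i j l → (i ⊖ j) +ᶻ fromℕ (j + l) ≡ fromℕ (i + l)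
  shift i j l = trans (ℤₚ.distribˡ-⊖-+-pos (j + l) i j) (trans
    (ℤₚ.⊖-≥ (≤-trans (ℕₚ.m≤m+n j l) (ℕₚ.m≤n+m (j + l) i)))
    (cong fromℕ (trans (cong (_∸ j) (+-swap i j l)) (ℕₚ.m+n∸m≡n j (i + l)))))

-- Diagonals, from northwest to southeast

-- The grid cells of a diagonal from `(i , j)` on. That `stop` requires the diagonal to have left
-- the grid makes the list complete.
data Chain {n} : ℕ → ℕ → List (Cell n) → Set where
  stop : ∀ {i j} → n ≤ i ⊎ n ≤ j → Chain i j []
  step : ∀ {i j c cs} → coordinates c ≡ (i , j) → Chain (suc i) (suc j) cs → Chain i j (c ∷ cs)

OnDiagonal : ∀ {n} → ℕ → ℕ → Cell n → Set
OnDiagonal i j c = ∃ λ s → coordinates c ≡ (s + i , s + j)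

RowBefore : ∀ {n} → Cell n → Cell n → Set
RowBefore c d = proj₁ c Fin.< proj₁ d

onDiagonal-bounds : ∀ {n i j} {c : Cell n} → OnDiagonal i j c → i < n × j < n
onDiagonal-bounds {i = i} {j} {c} (s , eq) =
    ℕₚ.≤-<-trans (≤-trans (ℕₚ.m≤n+m i s) (≤-reflexive (sym (cong proj₁ eq)))) (toℕ<n (proj₁ c))
  , ℕₚ.≤-<-trans (≤-trans (ℕₚ.m≤n+m j s) (≤-reflexive (sym (cong proj₂ eq)))) (toℕ<n (proj₂ c))

coordinates-injective : ∀ {n} {c d : Cell n} → coordinates c ≡ coordinates d → c ≡ d
coordinates-injective eq = cong₂ _,_ (toℕ-injective (cong proj₁ eq)) (toℕ-injective (cong proj₂ eq))

-- `fuel` bounds the number of rows still to come. Completeness puts the first grid cell of the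
-- diagonal into the list, and as rows increase strictly it can only be the head.
sorted⇒chain : ∀ {n} fuel {i j} → n ≤ fuel + i → (cs : List (Cell n)) → AllPairs RowBefore cs →
  (∀ {c} → c ∈ cs → OnDiagonal i j c) → (∀ {c} → OnDiagonal i j c → c ∈ cs) → Chain i j cs
sorted⇒chain {n} fuel {i} {j} le [] <cs on∈ ∈on = stop (outside (i <? n) (j <? n))
  where
  outside : Dec (i < n) → Dec (j < n) → n ≤ i ⊎ n ≤ j
  outside (no ¬p) _       = inj₁ (ℕₚ.≮⇒≥ ¬p)
  outside _       (no ¬q) = inj₂ (ℕₚ.≮⇒≥ ¬q)
  outside (yes p) (yes q) =
    case ∈on {fromℕ< p , fromℕ< q} (0 , cong₂ _,_ (toℕ-fromℕ< p) (toℕ-fromℕ< q)) of λ ()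
sorted⇒chain zero le (c ∷ cs) <cs on∈ ∈on =
  contradiction le (ℕₚ.<⇒≱ (proj₁ (onDiagonal-bounds (on∈ (here refl)))))
sorted⇒chain {n} (suc fuel) {i} {j} le (c ∷ cs) (c< ∷ <cs) on∈ ∈on =
  step c≡ (sorted⇒chain fuel (≤-trans le (≤-reflexive (sym (+-suc fuel i)))) cs <cs on∈′ ∈on′)
  where
  bounds = onDiagonal-bounds (on∈ (here refl))
  first : Cell n
  first = fromℕ< (proj₁ bounds) , fromℕ< (proj₂ bounds)
  first≡ : coordinates first ≡ (i , j)
  first≡ = cong₂ _,_ (toℕ-fromℕ< (proj₁ bounds)) (toℕ-fromℕ< (proj₂ bounds))
  c≡ : coordinates c ≡ (i , j)
  c≡ with ∈on {first} (0 , first≡) | on∈ {c} (here refl)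
  ... | here eq  | _      = trans (cong coordinates (sym eq)) first≡
  ... | there p  | s , eq = contradiction (All.lookup c< p) (ℕₚ.≤⇒≯
          (≤-trans (≤-reflexive (cong proj₁ first≡))
              (≤-trans (ℕₚ.m≤n+m i s) (≤-reflexive (sym (cong proj₁ eq))))))
  on∈′ : ∀ {d} → d ∈ cs → OnDiagonal (suc i) (suc j) d
  on∈′ p with on∈ (there p)
  ... | zero  , eq = contradiction (All.lookup c< p)
          (ℕₚ.≤⇒≯ (≤-reflexive (trans (cong proj₁ eq) (sym (cong proj₁ c≡)))))
  ... | suc s , eq = s , trans eq (cong₂ _,_ (sym (+-suc s i)) (sym (+-suc s j)))
  ∈on′ : ∀ {d} → OnDiagonal (suc i) (suc j) d → d ∈ cs
  ∈on′ (s , eq) with ∈on (suc s , trans eq (cong₂ _,_ (+-suc s i) (+-suc s j)))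
  ... | there p   = p
  ... | here refl = contradiction (trans (sym (cong proj₁ c≡)) (cong proj₁ eq))
          (ℕₚ.<⇒≢ (ℕₚ.m≤n+m (suc i) s))

Lex : ∀ {n} → Cell n → Cell n → Set
Lex (i , j) (i′ , j′) = i Fin.< i′ ⊎ (i ≡ i′ × j Fin.< j′)

lex-product : ∀ {n} {is js : List (Fin n)} → AllPairs Fin._<_ is → AllPairs Fin._<_ js →
              AllPairs Lex (cartesianProduct is js)
lex-product []         <js = []
lex-product {is = i ∷ is} {js} (i< ∷ <is) <js = AllPairsₚ.++⁺
  (AllPairsₚ.map⁺ (AllPairs.map (λ lt → inj₂ (refl , lt)) <js))
  (lex-product <is <js)
  (Allₚ.map⁺ (All.tabulate λ _ → All.tabulate λ p →
    inj₁ (All.lookup i< (proj₁ (∈-cartesianProduct⁻ is js p)))))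

diagonal-sorted : ∀ n c → AllPairs RowBefore (diagonal n c)
diagonal-sorted n c = go (Allₚ.all-filter _ cells)
  (AllPairsₚ.filter⁺ _ (lex-product (AllPairsₚ.tabulate⁺-< id) (AllPairsₚ.tabulate⁺-< id)))
  where
  cells = cartesianProduct (allFin n) (allFin n)
  row : ∀ {x y : Cell n} → content x ≡ content y → Lex x y → RowBefore x y
  row eq (inj₁ lt) = lt
  row {i , j} {_ , j′} eq (inj₂ (refl , lt)) =
    contradiction (ℕₚ.+-cancelʳ-≡ (toℕ i) _ _ (⊖-cross (toℕ j) (toℕ i) (toℕ j′) (toℕ i) eq)) (ℕₚ.<⇒≢ lt)
  go : ∀ {xs : List (Cell n)} → All (λ x → content x ≡ c) xs → AllPairs Lex xs → AllPairs RowBefore xs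
  go []       []         = []
  go (p ∷ ps) (lt ∷ lts) = All.zipWith (λ (q , l) → row (trans p (sym q)) l) (ps , lt) ∷ go ps lts

diagonal-chain : ∀ {n} (b : Cell n) i j k → i ≡ 0 ⊎ j ≡ 0 → coordinates b ≡ (k + i , k + j) →
                 Chain i j (diagonal n (content b))
diagonal-chain {n} b i j k zeros eqb = sorted⇒chain n (ℕₚ.m≤m+n n i) _ (diagonal-sorted n _) on∈ ∈on
  where
  content-b : content b ≡ j ⊖ i
  content-b = trans (cong₂ _⊖_ (cong proj₂ eqb) (cong proj₁ eqb)) (ℤₚ.+-cancelˡ-⊖ k j i)
  onDiagonal : ∀ {x y} → i ≡ 0 ⊎ j ≡ 0 → y + i ≡ j + x → ∃ λ s → (x , y) ≡ (s + i , s + j)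
  onDiagonal {x} {y} (inj₁ refl) eq = x , cong₂ _,_ (sym (+-identityʳ x))
      (trans (sym (+-identityʳ y)) (trans eq (+-comm j x)))
  onDiagonal {x} {y} (inj₂ refl) eq = y , cong₂ _,_ (sym eq) (sym (+-identityʳ y))
  on∈ : ∀ {c} → c ∈ diagonal n (content b) → OnDiagonal i j c
  on∈ {c} p = onDiagonal zeros (⊖-cross _ _ j i (trans
    (proj₂ (∈-filter⁻ (λ x → content x ≟ᶻ content b) {xs = cartesianProduct (allFin n) (allFin n)} p))
        content-b))
  ∈on : ∀ {c} → OnDiagonal i j c → c ∈ diagonal n (content b)
  ∈on {c} (s , eq) = ∈-filter⁺ (λ x → content x ≟ᶻ content b)
    (∈-cartesianProduct⁺ (∈-allFin (proj₁ c)) (∈-allFin (proj₂ c)))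
    (trans (cong₂ _⊖_ (cong proj₂ eq) (cong proj₁ eq)) (trans (ℤₚ.+-cancelˡ-⊖ s j i) (sym content-b)))

record Split {n} (s i j : ℕ) (cs : List (Cell n)) : Set where
  field
    before  : List (Cell n)
    cell    : Cell n
    after   : List (Cell n)
    splits  : cs ≡ before ++ cell ∷ after
    size    : length before ≡ s
    at      : coordinates cell ≡ (s + i , s + j)
    earlier : All (λ c → ∃ λ s′ → s′ < s × coordinates c ≡ (s′ + i , s′ + j)) before
    later   : Chain (suc (s + i)) (suc (s + j)) after

chain-split : ∀ {n} s {i j} {cs : List (Cell n)} → Chain i j cs → s + i < n → s + j < n → Split s i j cs
chain-split s {i} {j} (stop (inj₁ le)) p q = contradiction p (ℕₚ.≤⇒≯ (≤-trans le (ℕₚ.m≤n+m i s)))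
chain-split s {i} {j} (stop (inj₂ le)) p q = contradiction q (ℕₚ.≤⇒≯ (≤-trans le (ℕₚ.m≤n+m j s)))
chain-split zero (step {c = c} {cs} eq ch) p q = record
  { before = [] ; cell = c ; after = cs ; splits = refl ; size = refl ; at = eq ; earlier = [] ; later = ch }
chain-split {n} (suc s) {i} {j} (step {c = c} eq ch) p q
  with chain-split s ch (subst (_< n) (sym (+-suc s i)) p) (subst (_< n) (sym (+-suc s j)) q)
... | sp = record
  { before = c ∷ before ; cell = cell ; after = after
  ; splits = cong (c ∷_) splits
  ; size = cong suc size
  ; at = trans at (cong₂ _,_ (+-suc s i) (+-suc s j))
  ; earlier = (0 , z<s , eq) ∷ All.map (λ (s′ , lt , eq) → suc s′ , s<s lt , trans eq
      (cong₂ _,_ (+-suc s′ i) (+-suc s′ j))) earlier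
  ; later = subst₂ (λ x y → Chain (suc x) (suc y) after) (+-suc s i) (+-suc s j) later }
  where open Split sp

find-zip : ∀ {n} {us rs : List (Cell n)} {b x} vs ws → length us ≡ length rs → All (_≢ b) us →
           find (λ (a , _) → a ≟ᶜ b) (zip (us ++ b ∷ vs) (rs ++ x ∷ ws)) ≡ just (b , x)
find-zip {us = []}     {[]}     {b} vs ws len [] rewrite dec-true (b ≟ᶜ b) refl = refl
find-zip {us = u ∷ us} {r ∷ rs} {b} vs ws len (u≢b ∷ us≢b) rewrite dec-false (u ≟ᶜ b) u≢b =
  find-zip vs ws (ℕₚ.suc-injective len) us≢b

-- The value of Ω at a blank

module _ {n} (P : BPD n) where

  private
    tl = extend-tiling P
    crosses : List (Cell n) → List (Cell n)
    crosses = filter (λ x → isCross? (tile P x))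

  -- From a corner of positive rank on, no tile is blank: each step raises `i ⊓ j` by one and the
  -- rank by one, or by two at a cross. Their difference counts the crosses still to come and
  -- vanishes outside the grid.
  chain-crosses : ∀ {τ i j cs} → Matches (rank (extend P)) τ → Chain i j cs → 0 < rank (extend P) i j →
                  length (crosses cs) + rank (extend P) i j ≡ i ⊓ j
  chain-crosses {i = i} {j} mt (stop out) pos = extend-outside P i j out
  chain-crosses {i = i} {j} mt (step {c = c} {cs} refl ch) pos = ℕₚ.suc-injective (begin
    suc (length (crosses (c ∷ cs)) + r)       ≡⟨ count (tile P c) refl notBlank ⟩
    length (crosses cs) + (r + gain (tile P c)) ≡⟨ cong (λ t → length (crosses cs) + (r + gain t))
        (extend-toℕ P _ _) ⟨
    length (crosses cs) + (r + gain (extend P i j)) ≡⟨ cong (length (crosses cs) +_) (rank-diagonal tl i j) ⟨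
    length (crosses cs) + rank (extend P) (suc i) (suc j)
        ≡⟨ chain-crosses mt ch (≤-trans pos (rank-corner tl mt i j)) ⟩
    suc (i ⊓ j) ∎)
    where
    open ≡-Reasoning
    r = rank (extend P) i j
    notBlank : tile P c ≢ blank
    notBlank eq = rank⇒notBlank tl mt pos (trans (extend-toℕ P _ _) eq)
    one : ∀ k → suc (k + r) ≡ k + (r + 1)
    one k = trans (sym (+-suc k r)) (cong (k +_) (+-comm 1 r))
    count : ∀ t → tile P c ≡ t → t ≢ blank →
            suc (length (crosses (c ∷ cs)) + r) ≡ length (crosses cs) + (r + gain t)
    count downElbow eq nb rewrite eq = one _
    count upElbow   eq nb rewrite eq = one _
    count cross     eq nb rewrite eq = trans (cong suc (one (length (crosses cs))))
      (trans (sym (+-suc _ (r + 1))) (cong (length (crosses cs) +_) (sym (+-suc r 1))))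
    count blank     eq nb = contradiction refl nb
    count horiz     eq nb rewrite eq = one _
    count vert      eq nb rewrite eq = one _

  -- `b` and its partner have the same index in the zipped lists: all `k` cells before `b` on the
  -- diagonal are blank, and by `chain-crosses` exactly `k` crosses follow the partner, hence
  -- precede it in the reversed list.
  Ω-partner : ∀ {τ} → Matches (rank (extend P)) τ → ∀ (b : Cell n) {v} →
              uncurry τ (coordinates b) ≡ suc v → Ω P b ≡ just (fromℕ (suc v))
  Ω-partner {τ} mt b {v} eqτ = begin
    mapᴹ value (find _ (zip (blanks cells) (reverse (crosses cells))))
      ≡⟨ cong₂ (λ us vs → mapᴹ value (find (λ (a , _) → a ≟ᶜ b) (zip us vs))) blanks≡ crosses≡ ⟩
    mapᴹ value (find (λ (a , _) → a ≟ᶜ b) (zip (B.before ++ b ∷ blanks B.after)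
                                              (reverse (crosses X.after) ++ X.cell ∷ reverse
                                                  (crosses X.before))))
      ≡⟨ cong (mapᴹ value) (find-zip _ _ sizes (All.map earlier≢ B.earlier)) ⟩
    just (toℕ (proj₁ X.cell) ⊖ a)
      ≡⟨ cong (λ x → just (x ⊖ a)) (cong proj₁ X-at) ⟩
    just ((suc v + a) ⊖ a)
      ≡⟨ cong just (trans (ℤₚ.⊖-≥ (ℕₚ.m≤n+m a (suc v))) (cong fromℕ (ℕₚ.m+n∸n≡m (suc v) a))) ⟩
    just (fromℕ (suc v)) ∎
    where
    open ≡-Reasoning
    a = toℕ (proj₁ b)
    a′ = toℕ (proj₂ b)
    -- `k` steps northwest of `b` the diagonal begins, at the border cell `(i , j)`.
    k = a ⊓ a′
    i = a ∸ k
    j = a′ ∸ k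
    value : Cell n × Cell n → ℤ
    value (_ , x) = toℕ (proj₁ x) ⊖ a
    blanks : List (Cell n) → List (Cell n)
    blanks = filter (λ x → isBlank? (tile P x))
    cells = diagonal n (content b)
    k+i : k + i ≡ a
    k+i = ℕₚ.m+[n∸m]≡n (ℕₚ.m⊓n≤m a a′)
    k+j : k + j ≡ a′
    k+j = ℕₚ.m+[n∸m]≡n (ℕₚ.m⊓n≤n a a′)
    zeros : i ≡ 0 ⊎ j ≡ 0
    zeros = Sum.map (λ e → trans (cong (a ∸_) e) (ℕₚ.n∸n≡0 a))
        (λ e → trans (cong (a′ ∸_) e) (ℕₚ.n∸n≡0 a′)) (ℕₚ.⊓-sel a a′)
    b-at : coordinates b ≡ (k + i , k + j)
    b-at = sym (cong₂ _,_ k+i k+j)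
    chain : Chain i j cells
    chain = diagonal-chain b i j k zeros b-at
    isCross : extend P (suc v + a) (suc v + a′) ≡ cross
    isCross = proj₁ (partner-cross tl mt eqτ)
    shifted : ∀ {l x} → k + l ≡ x → suc v + k + l ≡ suc v + x
    shifted {l} eq = trans (+-assoc (suc v) k l) (cong (suc v +_) eq)
    inside : suc v + a < n × suc v + a′ < n
    inside = cross-inside P {suc v + a} {suc v + a′} isCross
    module B = Split (chain-split k chain (subst (_< n) (sym k+i) (toℕ<n (proj₁ b)))
        (subst (_< n) (sym k+j) (toℕ<n (proj₂ b))))
    module X = Split (chain-split (suc v + k) chain (subst (_< n) (sym (shifted k+i)) (proj₁ inside))
                                                    (subst (_< n) (sym (shifted k+j)) (proj₂ inside)))
    X-at : coordinates X.cell ≡ (suc v + a , suc v + a′)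
    X-at = trans X.at (cong₂ _,_ (shifted k+i) (shifted k+j))
    B-cell : B.cell ≡ b
    B-cell = coordinates-injective (trans B.at (sym b-at))
    tile-at : ∀ {c x y} → coordinates c ≡ (x , y) → tile P c ≡ extend P x y
    tile-at {c} eq = trans (sym (extend-toℕ P _ _)) (cong (uncurry (extend P)) eq)
    northwest : ∀ d {x y} → 0 < τ (d + x) (d + y) → 0 < τ x y
    northwest zero    pos = pos
    northwest (suc d) {x} {y} pos = northwest d (≤-trans pos (≤-trans
      (proj₁ (matches⇒decreasing tl mt (d + x) (suc d + y)))
      (≤-trans ℕₚ.pred[n]≤n (≤-trans (proj₂ (matches⇒decreasing tl mt (d + x) (d + y))) ℕₚ.pred[n]≤n))))
    earlier-blank : ∀ {c} → (∃ λ s → s < k × coordinates c ≡ (s + i , s + j)) → tile P c ≡ blank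
    earlier-blank {c} (s , s<k , eq) = trans (tile-at eq) (positive⇒blank tl mt (northwest (k ∸ s)
      (subst₂ (λ x y → 0 < τ x y) (sym (back k+i)) (sym (back k+j)) (subst (0 <_) (sym eqτ) z<s))))
      where
      back : ∀ {l x} → k + l ≡ x → k ∸ s + (s + l) ≡ x
      back {l} e = trans (sym (+-assoc (k ∸ s) s l)) (trans (cong (_+ l) (ℕₚ.m∸n+n≡m (ℕₚ.<⇒≤ s<k))) e)
    earlier≢ : ∀ {c} → (∃ λ s → s < k × coordinates c ≡ (s + i , s + j)) → c ≢ b
    earlier≢ (s , s<k , eq) refl = ℕₚ.<⇒≢ s<k (ℕₚ.+-cancelʳ-≡ i s k (trans (sym (cong proj₁ eq)) (sym k+i)))
    b-blank : tile P b ≡ blank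
    b-blank = trans (tile-at refl) (positive⇒blank tl mt (subst (0 <_) (sym eqτ) z<s))
    blanks≡ : blanks cells ≡ B.before ++ b ∷ blanks B.after
    blanks≡ = trans (cong blanks (trans B.splits (cong (λ c → B.before ++ c ∷ B.after) B-cell)))
      (trans (filter-++ (λ x → isBlank? (tile P x)) B.before _)
             (cong₂ _++_ (filter-all (λ x → isBlank? (tile P x)) (All.map earlier-blank B.earlier))
                         (filter-accept (λ x → isBlank? (tile P x)) b-blank)))
    crosses≡ : reverse (crosses cells) ≡ reverse (crosses X.after) ++ X.cell ∷ reverse (crosses X.before)
    crosses≡ = begin
      reverse (crosses cells)
        ≡⟨ cong (reverse ∘ crosses) X.splits ⟩
      reverse (crosses (X.before ++ X.cell ∷ X.after))
        ≡⟨ cong reverse (filter-++ (λ x → isCross? (tile P x)) X.before _) ⟩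
      reverse (crosses X.before ++ crosses (X.cell ∷ X.after))
        ≡⟨ cong (λ zs → reverse (crosses X.before ++ zs))
            (filter-accept (λ x → isCross? (tile P x)) (trans (tile-at X-at) isCross)) ⟩
      reverse (crosses X.before ++ X.cell ∷ crosses X.after)
        ≡⟨ reverse-++ (crosses X.before) _ ⟩
      reverse (X.cell ∷ crosses X.after) ++ reverse (crosses X.before)
        ≡⟨ cong (_++ reverse (crosses X.before)) (unfold-reverse X.cell (crosses X.after)) ⟩
      (reverse (crosses X.after) ++ X.cell ∷ []) ++ reverse (crosses X.before)
        ≡⟨ ++-assoc (reverse (crosses X.after)) _ _ ⟩
      _ ∎
    rank-after : rank (extend P) (suc (suc v + k + i)) (suc (suc v + k + j)) ≡ suc (suc v)
    rank-after = trans (cong₂ (λ x y → rank (extend P) (suc x) (suc y)) (shifted k+i) (shifted k+j))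
      (trans (rank-diagonal tl (suc v + a) (suc v + a′))
        (trans (cong₂ (λ x y → x + gain y) (proj₂ (partner-cross tl mt eqτ)) isCross) (+-comm v 2)))
    corner : (suc v + k + i) ⊓ (suc v + k + j) ≡ suc v + k
    corner = trans (sym (ℕₚ.+-distribˡ-⊓ (suc v + k) i j))
        (trans (cong (suc v + k +_) (i⊓j zeros)) (+-identityʳ _))
      where
      i⊓j : i ≡ 0 ⊎ j ≡ 0 → i ⊓ j ≡ 0
      i⊓j (inj₁ e) = cong (_⊓ j) e
      i⊓j (inj₂ e) = trans (cong (i ⊓_) e) (ℕₚ.⊓-zeroʳ i)
    sizes : length B.before ≡ length (reverse (crosses X.after))
    sizes = trans B.size (sym (trans (length-reverse (crosses X.after))
      (ℕₚ.+-cancelʳ-≡ (suc (suc v)) (length (crosses X.after)) k (begin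
        length (crosses X.after) + suc (suc v)
          ≡⟨ cong (length (crosses X.after) +_) rank-after ⟨
        length (crosses X.after) + rank (extend P) (suc (suc v + k + i)) (suc (suc v + k + j))
          ≡⟨ chain-crosses mt X.later (subst (0 <_) (sym rank-after) z<s) ⟩
        suc ((suc v + k + i) ⊓ (suc v + k + j))
          ≡⟨ cong suc corner ⟩
        suc (suc v) + k
          ≡⟨ +-comm (suc (suc v)) k ⟩
        k + suc (suc v) ∎))))

-- The rank function determines the tiling

matches-resp : ∀ {r r′ τ τ′} → (∀ i j → r i j ≡ r′ i j) → (∀ a b → τ a b ≡ τ′ a b) → Matches r τ → Matches r′ τ′
matches-resp r≡ τ≡ mt = record
  { ≤⇒rank = λ {a} {b} {t} le → subst (t <_) (r≡ _ _) (≤⇒rank (subst (_≤ t) (sym (τ≡ a b)) le))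
  ; rank⇒≤ = λ {a} {b} {t} lt → subst (_≤ t) (τ≡ a b) (rank⇒≤ (subst (t <_) (sym (r≡ _ _)) lt)) }
  where open Matches mt

bit-injective : ∀ {x y} → bit x ≡ bit y → x ≡ y
bit-injective {true}  {true}  eq = refl
bit-injective {false} {false} eq = refl

mkTile-onEdges : ∀ t → mkTile (onLeft t) (onTop t) (onRight t) (onBottom t) ≡ t
mkTile-onEdges downElbow = refl
mkTile-onEdges upElbow   = refl
mkTile-onEdges cross     = refl
mkTile-onEdges blank     = refl
mkTile-onEdges horiz     = refl
mkTile-onEdges vert      = refl

-- Differences of ranks give the top and left edges of every cell. Its right and bottom edges are
-- left and top edges of its neighbours.
rank-determines : ∀ {t u} → Tiling t → Tiling u → (∀ i j → rank t i j ≡ rank u i j) → ∀ i j → t i j ≡ u i j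
rank-determines {t} {u} tl ul eq i j = trans (sym (mkTile-onEdges (t i j)))
    (trans edges (mkTile-onEdges (u i j)))
  where
  tops≡ : ∀ i j → onTop (t i j) ≡ onTop (u i j)
  tops≡ i j = bit-injective (ℕₚ.+-cancelˡ-≡ (rank t i j) _ _
    (trans (eq i (suc j)) (cong (_+ bit (onTop (u i j))) (sym (eq i j)))))
  lefts≡ : ∀ i j → onLeft (t i j) ≡ onLeft (u i j)
  lefts≡ i j = bit-injective (ℕₚ.+-cancelˡ-≡ (rank t i j) _ _ (trans (sym (rank-down tl i j))
    (trans (eq (suc i) j) (trans (rank-down ul i j) (cong (_+ bit (onLeft (u i j))) (sym (eq i j)))))))
  edges : mkTile (onLeft (t i j)) (onTop (t i j)) (onRight (t i j)) (onBottom (t i j)) ≡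
          mkTile (onLeft (u i j)) (onTop (u i j)) (onRight (u i j)) (onBottom (u i j))
  edges rewrite lefts≡ i j | tops≡ i j
    | trans (Tiling.rows tl i j) (trans (lefts≡ i (suc j)) (sym (Tiling.rows ul i j)))
    | trans (Tiling.cols tl i j) (trans (tops≡ (suc i) j) (sym (Tiling.cols ul i j))) = refl

-- Hecke BPDs

module _ {n} (P : BPD n) where

  blank⇒D : ∀ {i j} → extend P i j ≡ blank → D P (i , j)
  blank⇒D {i} {j} eq = fromℕ< i<n , fromℕ< j<n , toℕ-fromℕ< i<n , toℕ-fromℕ< j<n ,
    trans (sym (extend-in P i<n j<n)) eq
    where
    inside : ¬ (n ≤ i ⊎ n ≤ j)
    inside out = idTile-notBlank i j (trans (sym (extend-out P out)) eq)
    i<n = ≰⇒> (inside ∘ inj₁)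
    j<n = ≰⇒> (inside ∘ inj₂)

  D⇒blank : ∀ {i j} → D P (i , j) → extend P i j ≡ blank
  D⇒blank (r , c , refl , refl , eq) = trans (extend-toℕ P r c) eq

module _ {n} (P : BPD n) (μ : Partition) (D≐𝕐 : D P ≐ 𝕐 μ) where

  heckeTableau : ℕ → ℕ → ℕ
  heckeTableau = tableauOf n (extend P)

  -- The partition shape enters here: it makes the blanks closed under diagonal steps to the
  -- northwest.
  heckeTableau-matches : Matches (rank (extend P)) heckeTableau
  heckeTableau-matches = tableauOf-matches (extend-tiling P) (extend-outside P) λ i j eq →
    D⇒blank P (proj₂ D≐𝕐 (ℕₚ.<⇒≤
      (≤-trans (proj₁ D≐𝕐 (blank⇒D P {suc i} {suc j} eq)) (part-suc μ i))))

  𝕐⇒positive : ∀ {i j} → 𝕐 μ (i , j) → 0 < heckeTableau i j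
  𝕐⇒positive p = blank⇒positive (extend-tiling P) heckeTableau-matches (D⇒blank P (proj₂ D≐𝕐 p))

  positive⇒𝕐 : ∀ {i j} → 0 < heckeTableau i j → 𝕐 μ (i , j)
  positive⇒𝕐 pos = proj₁ D≐𝕐 (blank⇒D P (positive⇒blank (extend-tiling P) heckeTableau-matches pos))

  toTableau : DecreasingTableau
  toTableau = record
    { shape = μ
    ; entry = λ i j _ → heckeTableau i j
    ; entry-positive = λ i j p → recompute (0 <? heckeTableau i j) (𝕐⇒positive p)
    ; rows-decrease = λ i j k p q j<k → recompute (heckeTableau i k <? heckeTableau i j)
        (decreasing-right-< {heckeTableau} decreasing {i} (𝕐⇒positive q) j<k)
    ; columns-decrease = λ i k j p q i<k → recompute (heckeTableau k j <? heckeTableau i j)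
        (decreasing-down-< {heckeTableau} decreasing {b = j} (𝕐⇒positive q) i<k) }
    where
    decreasing : Decreasing heckeTableau
    decreasing = matches⇒decreasing (extend-tiling P) heckeTableau-matches

  toTableau-extend : ∀ a b → heckeTableau a b ≡ extendᵗ toTableau a b
  toTableau-extend a b = case b <? part (parts μ) a of λ where
    (yes p) → sym (extendᵗ-in toTableau {a} {b} p)
    (no ¬p) → trans (ℕₚ.n≤0⇒n≡0 (ℕₚ.≮⇒≥ (¬p ∘ positive⇒𝕐))) (sym (extendᵗ-out toTableau {a} {b} ¬p))

  toTableau-matches : Matches (rank (extend P)) (extendᵗ toTableau)
  toTableau-matches = matches-resp (λ _ _ → refl) toTableau-extend heckeTableau-matches

  Ω-toTableau : Ω[ P ]≈ toTableau
  Ω-toTableau = record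
    { same-domain = D≐𝕐
    ; same-values = λ b p → values b (recompute (_ <? _) p) }
    where
    values : ∀ b → 𝕐 μ (coordinates b) → Ω P b ≡ just (fromℕ (uncurry heckeTableau (coordinates b)))
    values b p with uncurry heckeTableau (coordinates b) in eq | 𝕐⇒positive p
    ... | suc v | _ = Ω-partner P heckeTableau-matches b eq

-- Positive parts exclude trailing zeros, the only ambiguity in a list with a given function `part`.
parts-unique : ∀ μ ν → (∀ i → part (parts μ) i ≡ part (parts ν) i) → parts μ ≡ parts ν
parts-unique μ ν = go (Partition.positive μ) (Partition.positive ν)
  where
  go : ∀ {xs ys} → All (0 <_) xs → All (0 <_) ys → (∀ i → part xs i ≡ part ys i) → xs ≡ ys
  go []       []       eq = refl
  go []       (q ∷ _)  eq = contradiction (eq 0) (ℕₚ.<⇒≢ q)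
  go (p ∷ _)  []       eq = contradiction (sym (eq 0)) (ℕₚ.<⇒≢ p)
  go (_ ∷ ps) (_ ∷ qs) eq = cong₂ _∷_ (eq 0) (go ps qs (eq ∘ suc))

𝕐-unique : ∀ μ ν → 𝕐 μ ≐ 𝕐 ν → parts μ ≡ parts ν
𝕐-unique μ ν (⊆ , ⊇) = parts-unique μ ν λ i → ℕₚ.≤-antisym
  (<-transfer λ {j} → ⊆ {i , j}) (<-transfer λ {j} → ⊇ {i , j})

extend-cong : ∀ {n} {P Q : BPD n} → (∀ c → tile P c ≡ tile Q c) → ∀ i j → extend P i j ≡ extend Q i j
extend-cong {n} eq i j with i <? n | j <? n
... | yes _ | yes _ = eq _
... | yes _ | no _  = refl
... | no _  | _     = refl

rank-cong : ∀ {t u : ℕ → ℕ → Tile} → (∀ i j → t i j ≡ u i j) → ∀ i j → rank t i j ≡ rank u i j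
rank-cong eq i zero    = refl
rank-cong eq i (suc j) = cong₂ (λ x y → x + bit (onTop y)) (rank-cong eq i j) (eq i j)

-- The bijection

module _ {m : ℕ} where

  private
    n = suc m

  toRWT : EG n → RWT m
  toRWT (P , (μ , D≐𝕐) , red) = toTableau P μ D≐𝕐 ,
    Correspondence.isRWT P (toTableau P μ D≐𝕐) (toTableau-matches P μ D≐𝕐) red

  toRWT-cong : ∀ {x y} → Setoid._≈_ (EG-setoid n) x y → Setoid._≈_ (RWT-setoid m) (toRWT x) (toRWT y)
  toRWT-cong {P , (μ , D≐𝕐) , _} {Q , (ν , D≐𝕐′) , _} eq = record
    { same-shape = 𝕐-unique μ ν
        ( (λ {(i , j)} p → proj₁ D≐𝕐′ (blank⇒D Q {i} {j} (trans (sym (ext i j)) (D⇒blank P (proj₂ D≐𝕐 p)))))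
        , (λ {(i , j)} p → proj₁ D≐𝕐 (blank⇒D P {i} {j} (trans (ext i j) (D⇒blank Q (proj₂ D≐𝕐′ p))))))
    ; same-entries = λ i j _ _ → matches-unique-τ
        (matches-resp (rank-cong ext) (λ _ _ → refl) (heckeTableau-matches P μ D≐𝕐))
        (heckeTableau-matches Q ν D≐𝕐′) i j }
    where
    ext : ∀ i j → extend P i j ≡ extend Q i j
    ext = extend-cong {P = P} {Q} eq

  ≈ᵗ⇒extend : ∀ {T U} → T ≈ᵗ U → ∀ i j → extendᵗ T i j ≡ extendᵗ U i j
  ≈ᵗ⇒extend {T} {U} eq i j = case j <? part (parts (shape T)) i of λ where
      (yes p) → let q = subst (λ xs → j < part xs i) same-shape p in
        trans (extendᵗ-in T p) (trans (same-entries i j p q) (sym (extendᵗ-in U q)))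
      (no ¬p) → trans (extendᵗ-out T ¬p) (sym (extendᵗ-out U
          (¬p ∘ subst (λ xs → j < part xs i) (sym same-shape))))
    where open _≈ᵗ_ eq

  toRWT-injective : ∀ {x y} → Setoid._≈_ (RWT-setoid m) (toRWT x) (toRWT y) → Setoid._≈_ (EG-setoid n) x y
  toRWT-injective {P , (μ , D≐𝕐) , _} {Q , (ν , D≐𝕐′) , _} eq (i , j) =
    trans (sym (extend-toℕ P i j)) (trans (rank-determines (extend-tiling P) (extend-tiling Q) same-rank
        (toℕ i) (toℕ j)) (extend-toℕ Q i j))
    where
    mP = matches-resp (λ _ _ → refl) (≈ᵗ⇒extend eq) (toTableau-matches P μ D≐𝕐)
    mQ = toTableau-matches Q ν D≐𝕐′
    same-rank : ∀ i j → rank (extend P) i j ≡ rank (extend Q) i j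
    same-rank i j = ℕₚ.≤-antisym
      (matches-rank-≤ mP mQ (rank≤row (extend-tiling P)) (rank≤col (extend-tiling P)) i j)
      (matches-rank-≤ mQ mP (rank≤row (extend-tiling Q)) (rank≤col (extend-tiling Q)) i j)

  module _ (y : RWT m) where

    private
      T : DecreasingTableau
      T = proj₁ y
      rwt : IsRWT m T
      rwt = proj₂ y
      bound : extendᵗ T 0 0 ≤ m
      bound = case 0 <? part (parts (shape T)) 0 of λ where
        (yes p) → subst (_≤ m) (sym (extendᵗ-in T p)) (IsRWT.bounded rwt 0 0 p)
        (no ¬p) → subst (_≤ m) (sym (extendᵗ-out T ¬p)) z≤n

      open FromTableau (extendᵗ T) (extendᵗ-decreasing T) bound

    -- `bpd` keeps only the square part of `tiles`. Within the square the count along a row stays in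
    -- the grid, and outside it both ranks are the smaller coordinate.
    rank-bpd : ∀ i j → rank (extend bpd) i j ≡ r i j
    rank-bpd i j = by-cases (i <? n) (j ≤? n)
      where
      outside : n ≤ i ⊎ n ≤ j → rank (extend bpd) i j ≡ r i j
      outside out = trans (extend-outside bpd i j out) (sym (r-outside i j out))
      inside : i < n → ∀ j → j ≤ n → tops (extend bpd i) j ≡ tops (tiles i) j
      inside i<n zero    le = refl
      inside i<n (suc j) le = cong₂ (λ x y → x + bit (onTop y)) (inside i<n j (ℕₚ.<⇒≤ le))
        (trans (extend-in bpd i<n le) (cong₂ tiles (toℕ-fromℕ< i<n) (toℕ-fromℕ< le)))
      by-cases : Dec (i < n) → Dec (j ≤ n) → rank (extend bpd) i j ≡ r i j
      by-cases (yes p) (yes q) = trans (inside p j q) (rank-tiles i j)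
      by-cases (no ¬p) _       = outside (inj₁ (ℕₚ.≮⇒≥ ¬p))
      by-cases _       (no ¬q) = outside (inj₂ (ℕₚ.<⇒≤ (≰⇒> ¬q)))

    bpd-matches : Matches (rank (extend bpd)) (extendᵗ T)
    bpd-matches = matches-resp (λ i j → sym (rank-bpd i j)) (λ _ _ → refl) r-matches

    D-bpd : D bpd ≐ 𝕐 (shape T)
    D-bpd = (λ d → positive⇒in T (blank⇒positive (extend-tiling bpd) bpd-matches (D⇒blank bpd d)))
          , (λ p → blank⇒D bpd (positive⇒blank (extend-tiling bpd) bpd-matches (in⇒positive T p)))

    fromRWT : EG n
    fromRWT = bpd , (shape T , D-bpd) ,
      Correspondence.reducedWordFor⇒reduced bpd T bpd-matches {proj₁ (IsRWT.reduced rwt)}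
          (proj₂ (IsRWT.reduced rwt))

    toRWT-fromRWT : Setoid._≈_ (RWT-setoid m) (toRWT fromRWT) y
    toRWT-fromRWT = record
      { same-shape = refl
      ; same-entries = λ i j p _ → let q = recompute (_ <? _) p in
          trans (matches-unique-τ (heckeTableau-matches bpd (shape T) D-bpd) bpd-matches i j) (extendᵗ-in T q) }

  Ω-bijection : Bijection (EG-setoid n) (RWT-setoid m)
  Ω-bijection = record
    { to = toRWT
    ; cong = λ {x} {y} → toRWT-cong {x} {y}
    ; bijective = (λ {x} {y} → toRWT-injective {x} {y})
        , λ y → fromRWT y , λ {z} eq → Setoid.trans (RWT-setoid m) {toRWT z} {toRWT (fromRWT y)} {y}
            (toRWT-cong {z} {fromRWT y} eq) (toRWT-fromRWT y) }

corollary8p5 : ∀ (m : ℕ) → let n = suc m in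
    Σ[ f ∈ Bijection (EG-setoid n) (RWT-setoid m) ]
    (∀ (P : EG n) → Ω[ proj₁ P ]≈ proj₁ (Bijection.to f P)) ×
    (∀ (P : EG n) → parts (shapeEG P) ≡ parts (shape (proj₁ (Bijection.to f P)))) ×
    (∀ (w : Permutation′ n) (P : EG n) →
    Pipes w (proj₁ P) ⇔ ReducedWordFor (columnWord (proj₁ (Bijection.to f P))) w)
corollary8p5 m = Ω-bijection
  , (λ (P , (μ , D≐𝕐) , _) → Ω-toTableau P μ D≐𝕐)
  , (λ _ → refl)
  , λ w (P , (μ , D≐𝕐) , red) →
      Correspondence.pipes⇔reducedWordFor P (toTableau P μ D≐𝕐) (toTableau-matches P μ D≐𝕐) red w
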